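{- Let $a=(a_i)_{i\in\mathbb Z}$ be a sequence of pairwise distinct complex numbers. Let $f\in\Lambda$ have degree $\le n$ and write $f=\sum_{\lambda:\,|\lambda|\le n}c(\lambda)s_{\lambda;a}$. Then the coefficients are determined recursively in $|\lambda|$ by $c(\varnothing)=f(0;0)$ and $$c(\lambda)=\frac{f(x(\lambda);y(\lambda))-\sum_{\mu\subset\lambda,\ \mu\ne\lambda}c(\mu)\,s_{\mu;a}(x(\lambda);y(\lambda))}{s_{\lambda;a}(x(\lambda);y(\lambda))}.$$
   Context: $\Lambda$ is the algebra of symmetric functions over $\mathbb C$ (graded by degree) with complete homogeneous $h_k$, elementary $e_k$, power sums $\mathbf p_k$. For a sequence $a$ define $h_{k;a}=\sum_{i=1}^k(-1)^{k-i}e_{k-i}(a_1,\dots,a_{k-1})h_i$ ($k\ge1$), $h_{0;a}=1$, $h_{k;a}=0$ ($k<0$); $(\tau^ra)_i=a_{i+r}$; $s_{\mu;a}=\det[h_{\mu_i-i+j;\,\tau^{1-j}a}]_{i,j=1}^N$ for any $N\ge\ell(\mu)$; $s_{\mu;a}$ equals the Schur function $s_\mu$ plus lower-degree terms, and these functions form a basis of $\Lambda$. Dual sequence: $\widehat a_i=-a_{1-i}$. Each $f\in\Lambda$ is evaluated at $(x;y)\in\mathbb C^d\times\mathbb C^d$ via $\mathbf p_k\mapsto\sum_ix_i^k+(-1)^{k-1}\sum_jy_j^k$. For a nonempty diagram $\lambda=(p_1,\dots,p_d\mid q_1,\dots,q_d)$ in Frobenius notation ($p_i=\lambda_i-i$,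 $q_i=\lambda'_i-i$, $d$ the number of diagonal boxes), $(x(\lambda);y(\lambda))=(a_{p_1+1},\dots,a_{p_d+1};\widehat a_{q_1+1},\dots,\widehat a_{q_d+1})$; and $(x(\varnothing);y(\varnothing))=(0;0)$. -}

module Defs where

open import Algebra.Apartness.Bundles using (HeytingField; module HeytingCommutativeRing)
open import Algebra.Bundles using (CommutativeRing)
open import Algebra.Morphism.Structures using (module RingMorphisms)
import Algebra.Properties.CommutativeSemigroup
import Algebra.Properties.Group
import Algebra.Properties.Ring
import Algebra.Properties.Semiring.Exp
import Algebra.Properties.Semiring.Mult
import Algebra.Properties.Semiring.Sum
open import Data.Bool.Base using (if_then_else_)
open import Data.Fin.Base using (Fin; zero; suc; toℕ; punchIn)
open import Data.Integer.Base as ℤ using (ℤ; +_; -[1+_]; 1ℤ; _⊖_)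
open import Data.List.Base as List using (List; []; _∷_; filter; mapMaybe; cartesianProductWith)
open import Data.List.Properties using (≡-dec; ∷-injective)
open import Data.List.Membership.DecPropositional using (_∈?_)
open import Data.List.Membership.Propositional using (_∈_)
open import Data.List.Membership.Propositional.Properties
  using (∈-filter⁺; ∈-filter⁻; ∈-map⁺; ∈-upTo⁺; ∈-cartesianProductWith⁺; ∈-cartesianProductWith⁻)
open import Data.List.Relation.Binary.Permutation.Propositional
  using (_↭_; refl; prep; swap; trans; ↭-sym)
open import Data.List.Relation.Binary.Permutation.Propositional.Properties using (∈-resp-↭)
open import Data.List.Relation.Binary.Prefix.Heterogeneous using (Prefix)
open import Data.List.Relation.Binary.Prefix.Heterogeneous.Properties using (prefix?)
open import Data.List.Relation.Unary.All as All using (All; []; _∷_)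
open import Data.List.Relation.Unary.Any using (here; there)
open import Data.List.Relation.Unary.Linked using (Linked; []; linked?)
open import Data.List.Relation.Unary.Unique.Propositional using (Unique; []; _∷_)
import Data.List.Relation.Unary.Unique.Propositional.Properties as Unique
open import Data.Maybe.Base using (Maybe; just; nothing)
open import Data.Nat.Base as ℕ using (ℕ; zero; suc; _≤_; _<_; _≥_; z≤n; s≤s; NonZero)
open import Data.Nat.ListAction using (sum)
open import Data.Nat.ListAction.Properties using (sum-↭)
import Data.Nat.Properties as ℕ
open import Data.Product.Base using (_×_; _,_; proj₁; proj₂)
open import Data.Sum.Base using (_⊎_; inj₁; inj₂)
open import Data.Vec.Functional using (Vector)
open import Function.Base using (_∘_; flip)
open import Function.Bundles using (_⇔_; mk⇔)
open import Level using (_⊔_)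
open import Relation.Binary.PropositionalEquality.Core as ≡ using (_≡_; _≢_; refl)
import Relation.Binary.Reasoning.Setoid
open import Relation.Nullary.Decidable
  using (Dec; yes; no; does; map′; recompute; _×-dec_; ¬?; dec-true; dec-false; does-⇔)
open import Relation.Nullary.Negation using (¬_; contradiction)

IsPartition : List ℕ → Set
IsPartition ls = Linked _≥_ ls × All (0 <_) ls

isPartition? : ∀ ls → Dec (IsPartition ls)
isPartition? ls = linked? ℕ._≥?_ ls ×-dec All.all? (0 ℕ.<?_) ls

record Partition : Set where
  constructor mkPartition
  field
    parts        : List ℕ
    .isPartition : IsPartition parts

open Partition public using (parts)

partition-proof : ∀ μ → IsPartition (parts μ)
partition-proof (mkPartition ls p) = recompute (isPartition? ls) p

parts-injective : ∀ {μ ν} → parts μ ≡ parts ν → μ ≡ ν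
parts-injective refl = refl

∅ : Partition
∅ = mkPartition [] ([] , [])

infix 4 _≟_ _⊆_ _⊆?_

_≟_ : (μ ν : Partition) → Dec (μ ≡ ν)
μ ≟ ν = map′ parts-injective (≡.cong parts) (≡-dec ℕ._≟_ (parts μ) (parts ν))

∣_∣ : Partition → ℕ
∣ μ ∣ = sum (parts μ)

len : Partition → ℕ
len μ = List.length (parts μ)

-- Containment of diagrams: len μ ≤ len ν, and μᵢ ≤ νᵢ for all i ≤ len μ.

_⊆_ : Partition → Partition → Set
μ ⊆ ν = Prefix _≤_ (parts μ) (parts ν)

_⊆?_ : ∀ μ ν → Dec (μ ⊆ ν)
μ ⊆? ν = prefix? ℕ._≤?_ (parts μ) (parts ν)

-- Rows and columns are numbered from 0: row μ i is μᵢ₊₁ and col μ j is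
-- μ′ⱼ₊₁.

entry : List ℕ → ℕ → ℕ
entry []       _       = 0
entry (l ∷ ls) zero    = l
entry (l ∷ ls) (suc i) = entry ls i

row : Partition → ℕ → ℕ
row μ = entry (parts μ)

col : Partition → ℕ → ℕ
col μ j = List.length (filter (suc j ℕ.≤?_) (parts μ))

-- Frobenius notation: arm μ i is pᵢ₊₁ and leg μ i is qᵢ₊₁.

diagonal : Partition → ℕ
diagonal μ = List.length (filter (λ i → suc i ℕ.≤? row μ i) (List.upTo (len μ)))

arm leg : Partition → ℕ → ℤ
arm μ i = row μ i ⊖ suc i
leg μ i = col μ i ⊖ suc i

-- words n l lists the words of length at most l in the letters 1, …, n.

words : ℕ → ℕ → List (List ℕ)
words n zero    = [] ∷ []
words n (suc l) = [] ∷ cartesianProductWith _∷_ (List.map suc (List.upTo n)) (words n l)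

toPartition : List ℕ → Maybe Partition
toPartition ls with isPartition? ls
... | yes p = just (mkPartition ls p)
... | no  _ = nothing

partitions≤ : ℕ → List Partition
partitions≤ n = filter (λ μ → ∣ μ ∣ ℕ.≤? n) (mapMaybe toPartition (words n n))

properSubdiagrams : Partition → List Partition
properSubdiagrams ν = filter (λ μ → μ ⊆? ν ×-dec ¬? (μ ≟ ν)) (partitions≤ ∣ ν ∣)

-- partitions≤ n lists every partition of size at most n exactly once.

private

  ∈-words : ∀ n l {ls} → All (0 <_) ls → All (_≤ n) ls → List.length ls ≤ l → ls ∈ words n l
  ∈-words n zero    []       []       _         = here refl
  ∈-words n (suc l) []       []       _         = here refl
  ∈-words n (suc l) (s≤s _ ∷ ps) (b ∷ bs) (s≤s q) =
    there (∈-cartesianProductWith⁺ _∷_ (∈-map⁺ suc (∈-upTo⁺ b)) (∈-words n l ps bs q))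

  words-unique : ∀ n l → Unique (words n l)
  words-unique n zero    = [] ∷ []
  words-unique n (suc l) =
    All.tabulate (λ m → nonempty m) ∷
    Unique.cartesianProductWith⁺ _∷_ ∷-injective
      (Unique.map⁺ ℕ.suc-injective (Unique.upTo⁺ n)) (words-unique n l)
    where
    nonempty : ∀ {ls} → ls ∈ cartesianProductWith _∷_ (List.map suc (List.upTo n)) (words n l) → [] ≢ ls
    nonempty m eq with ∈-cartesianProductWith⁻ _∷_ (List.map suc (List.upTo n)) (words n l) m
    ... | _ , _ , _ , _ , refl with eq
    ... | ()

  toPartition-parts : ∀ μ → toPartition (parts μ) ≡ just μ
  toPartition-parts μ with isPartition? (parts μ)
  ... | yes _ = refl
  ... | no ¬p = contradiction (partition-proof μ) ¬p

  toPartition-sound : ∀ {ls μ} → toPartition ls ≡ just μ → parts μ ≡ ls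
  toPartition-sound {ls} eq with isPartition? ls
  toPartition-sound refl | yes _ = refl

  ∈-mapMaybe : ∀ {lss μ} → parts μ ∈ lss → μ ∈ mapMaybe toPartition lss
  ∈-mapMaybe {ls ∷ lss} {μ} (here refl) rewrite toPartition-parts μ = here refl
  ∈-mapMaybe {ls ∷ lss} (there m) with toPartition ls
  ... | just _  = there (∈-mapMaybe m)
  ... | nothing = ∈-mapMaybe m

  mapMaybe-∈ : ∀ lss {μ} → μ ∈ mapMaybe toPartition lss → parts μ ∈ lss
  mapMaybe-∈ (ls ∷ lss) m with toPartition ls in eq
  mapMaybe-∈ (ls ∷ lss) (here refl) | just _  = here (toPartition-sound eq)
  mapMaybe-∈ (ls ∷ lss) (there m)   | just _  = there (mapMaybe-∈ lss m)
  mapMaybe-∈ (ls ∷ lss) m           | nothing = there (mapMaybe-∈ lss m)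

  mapMaybe-unique : ∀ {lss} → Unique lss → Unique (mapMaybe toPartition lss)
  mapMaybe-unique {[]} [] = []
  mapMaybe-unique {ls ∷ lss} (ls∉ ∷ u) with toPartition ls in eq
  ... | nothing = mapMaybe-unique u
  ... | just μ  = All.tabulate fresh ∷ mapMaybe-unique u
    where
    fresh : ∀ {ν} → ν ∈ mapMaybe toPartition lss → μ ≢ ν
    fresh m refl = All.lookup ls∉ (mapMaybe-∈ lss m) (≡.sym (toPartition-sound eq))

  parts≤sum : ∀ ls → All (_≤ sum ls) ls
  parts≤sum []       = []
  parts≤sum (l ∷ ls) =
    ℕ.m≤m+n l _ ∷ All.map (λ q → ℕ.≤-trans q (ℕ.m≤n+m _ l)) (parts≤sum ls)

  length≤sum : ∀ {ls} → All (0 <_) ls → List.length ls ≤ sum ls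
  length≤sum []       = z≤n
  length≤sum (p ∷ ps) = ℕ.+-mono-≤ p (length≤sum ps)

∈-partitions≤ : ∀ n μ → μ ∈ partitions≤ n ⇔ ∣ μ ∣ ≤ n
∈-partitions≤ n μ = mk⇔
  (λ m → proj₂ (∈-filter⁻ size? {xs = mapMaybe toPartition (words n n)} m))
  (λ b → ∈-filter⁺ size? (∈-mapMaybe (∈-words n n positive
    (All.map (λ q → ℕ.≤-trans q b) (parts≤sum (parts μ)))
    (ℕ.≤-trans (length≤sum positive) b))) b)
  where
  size? = λ (ν : Partition) → ∣ ν ∣ ℕ.≤? n
  positive = proj₂ (partition-proof μ)

partitions≤-unique : ∀ n → Unique (partitions≤ n)
partitions≤-unique n = Unique.filter⁺ (λ μ → ∣ μ ∣ ℕ.≤? n) (mapMaybe-unique (words-unique n n))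

module SymmetricFunctions {r ℓ} (R : CommutativeRing r ℓ) where

  open CommutativeRing R hiding (zero) renaming (Carrier to C; refl to ≈-refl; sym to ≈-sym; trans to ≈-trans)
  open Algebra.Properties.Semiring.Exp semiring using (_^_; ^-homo-*)
  open Algebra.Properties.Semiring.Sum semiring using (*-distribˡ-sum; sum-cong-≋)
    renaming (sum to ∑)
  open Algebra.Properties.CommutativeSemigroup +-commutativeSemigroup using () renaming (interchange to +-interchange)
  open Algebra.Properties.CommutativeSemigroup *-commutativeSemigroup using () renaming (interchange to *-interchange; x∙yz≈y∙xz to x*yz≈y*xz)
  open Algebra.Properties.Group +-group using () renaming (ε⁻¹≈ε to -0≈0; ⁻¹-involutive to -‿involutive)
  open Algebra.Properties.Ring ring using (-‿distribˡ-*; -‿+-comm)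
  open Relation.Binary.Reasoning.Setoid setoid

  𝟙 : ∀ {p} {P : Set p} → Dec P → C
  𝟙 P? = if does P? then 1# else 0#

  -- antidiagonal n F is the sum of F i j over all i + j = n.

  antidiagonal : ℕ → (ℕ → ℕ → C) → C
  antidiagonal zero    F = F 0 0
  antidiagonal (suc n) F = F 0 (suc n) + antidiagonal n (F ∘ suc)

  -- A monomial x₁^α₁ x₂^α₂ ⋯ is given by the list of its exponents; lists
  -- that differ by trailing zeros give the same monomial.  A family of
  -- coefficients stands for a power series in x₁, x₂, …

  Series : Set r
  Series = List ℕ → C

  infixl 7 _⊛_

  -- The coefficient of the product at α is the sum of f β * g γ over all
  -- β and γ of the same length as α with β + γ = α entrywise.

  _⊛_ : Series → Series → Series
  (f ⊛ g) []      = f [] * g []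
  (f ⊛ g) (a ∷ α) = antidiagonal a (λ i j → ((f ∘ (i ∷_)) ⊛ (g ∘ (j ∷_))) α)

  -- Symmetric functions: power series of bounded degree that are invariant
  -- under permutations of the variables.  Given this invariance, coeff-0
  -- says that trailing zeros are irrelevant.

  record Λ : Set (r ⊔ ℓ) where
    field
      coeff       : Series
      coeff-↭     : ∀ {α β} → α ↭ β → coeff α ≈ coeff β
      coeff-0     : ∀ α → coeff (0 ∷ α) ≈ coeff α
      bound       : ℕ
      coeff-bound : ∀ α → bound < sum α → coeff α ≈ 0#

  open Λ public

  Degree≤ : ℕ → Λ → Set ℓ
  Degree≤ n f = ∀ α → n < sum α → coeff f α ≈ 0#

  infix 4 _≈Λ_

  _≈Λ_ : Λ → Λ → Set ℓ
  f ≈Λ g = ∀ α → coeff f α ≈ coeff g α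

  private

    0+0≈0 : 0# + 0# ≈ 0#
    0+0≈0 = +-identityˡ 0#

    module Antidiagonal where

      cong′ : ∀ n {F G} → (∀ i j → i ℕ.+ j ≡ n → F i j ≈ G i j) → antidiagonal n F ≈ antidiagonal n G
      cong′ zero    F≈G = F≈G 0 0 ≡.refl
      cong′ (suc n) F≈G = +-cong (F≈G 0 (suc n) ≡.refl) (cong′ n (λ i j e → F≈G (suc i) j (≡.cong suc e)))

      cong : ∀ n {F G} → (∀ i j → F i j ≈ G i j) → antidiagonal n F ≈ antidiagonal n G
      cong n F≈G = cong′ n (λ i j _ → F≈G i j)

      zero′ : ∀ n {F} → (∀ i j → i ℕ.+ j ≡ n → F i j ≈ 0#) → antidiagonal n F ≈ 0#
      zero′ zero    F≈0 = F≈0 0 0 ≡.refl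
      zero′ (suc n) F≈0 = ≈-trans (+-cong (F≈0 0 (suc n) ≡.refl) (zero′ n (λ i j e → F≈0 (suc i) j (≡.cong suc e)))) 0+0≈0

      distrib-+ : ∀ n F G → antidiagonal n (λ i j → F i j + G i j) ≈ antidiagonal n F + antidiagonal n G
      distrib-+ zero    F G = ≈-refl
      distrib-+ (suc n) F G = begin
        (F 0 (suc n) + G 0 (suc n)) + antidiagonal n (λ i j → F (suc i) j + G (suc i) j)
          ≈⟨ +-congˡ (distrib-+ n (F ∘ suc) (G ∘ suc)) ⟩
        (F 0 (suc n) + G 0 (suc n)) + (antidiagonal n (F ∘ suc) + antidiagonal n (G ∘ suc))
          ≈⟨ +-interchange _ _ _ _ ⟩
        antidiagonal (suc n) F + antidiagonal (suc n) G ∎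

      distribˡ-* : ∀ n c F → c * antidiagonal n F ≈ antidiagonal n (λ i j → c * F i j)
      distribˡ-* zero    c F = ≈-refl
      distribˡ-* (suc n) c F = ≈-trans (distribˡ c _ _) (+-congˡ (distribˡ-* n c (F ∘ suc)))

      unfold-last : ∀ n F → antidiagonal (suc n) F ≈ antidiagonal n (λ i j → F i (suc j)) + F (suc n) 0
      unfold-last zero    F = ≈-refl
      unfold-last (suc n) F = ≈-trans
        (+-congˡ (unfold-last n (F ∘ suc))) (≈-sym (+-assoc _ _ _))

      flip′ : ∀ n F → antidiagonal n F ≈ antidiagonal n (flip F)
      flip′ zero    F = ≈-refl
      flip′ (suc n) F = begin
        antidiagonal (suc n) F                                   ≈⟨ unfold-last n F ⟩
        antidiagonal n (λ i j → F i (suc j)) + F (suc n) 0       ≈⟨ +-congʳ (flip′ n (λ i j → F i (suc j))) ⟩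
        antidiagonal n (λ i j → F j (suc i)) + F (suc n) 0       ≈⟨ +-comm _ _ ⟩
        antidiagonal (suc n) (flip F)                            ∎

      assoc : ∀ n (F : ℕ → ℕ → ℕ → C) →
              antidiagonal n (λ i j → antidiagonal i (λ k l → F k l j)) ≈
              antidiagonal n (λ k m → antidiagonal m (λ l j → F k l j))
      assoc zero    F = ≈-refl
      assoc (suc n) F = begin
        F 0 0 (suc n) + antidiagonal n (λ i j → F 0 (suc i) j + antidiagonal i (λ k l → F (suc k) l j))
          ≈⟨ +-congˡ (distrib-+ n _ _) ⟩
        F 0 0 (suc n) + (antidiagonal n (λ i j → F 0 (suc i) j)
                         + antidiagonal n (λ i j → antidiagonal i (λ k l → F (suc k) l j)))
          ≈⟨ +-assoc _ _ _ ⟨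
        antidiagonal (suc n) (F 0) + antidiagonal n (λ i j → antidiagonal i (λ k l → F (suc k) l j))
          ≈⟨ +-congˡ (assoc n (F ∘ suc)) ⟩
        antidiagonal (suc n) (F 0) + antidiagonal n (λ k m → antidiagonal m (F (suc k))) ∎

      interchange : ∀ m n (F : ℕ → ℕ → ℕ → ℕ → C) →
                    antidiagonal m (λ i j → antidiagonal n (F i j)) ≈
                    antidiagonal n (λ k l → antidiagonal m (λ i j → F i j k l))
      interchange zero    n F = ≈-refl
      interchange (suc m) n F = begin
        antidiagonal n (F 0 (suc m)) + antidiagonal m (λ i j → antidiagonal n (F (suc i) j))
          ≈⟨ +-congˡ (interchange m n (F ∘ suc)) ⟩
        antidiagonal n (F 0 (suc m)) + antidiagonal n (λ k l → antidiagonal m (λ i j → F (suc i) j k l))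
          ≈⟨ distrib-+ n _ _ ⟨
        antidiagonal n (λ k l → antidiagonal (suc m) (λ i j → F i j k l)) ∎

  private

    module A = Antidiagonal


    ⊛-cong : ∀ {f f′ g g′} → (∀ α → f α ≈ f′ α) → (∀ α → g α ≈ g′ α) → ∀ α → (f ⊛ g) α ≈ (f′ ⊛ g′) α
    ⊛-cong p q []      = *-cong (p []) (q [])
    ⊛-cong p q (a ∷ α) = A.cong a (λ i j → ⊛-cong (p ∘ (i ∷_)) (q ∘ (j ∷_)) α)

    ⊛-zero′ : ∀ f g α → (∀ β γ → sum β ℕ.+ sum γ ≡ sum α → f β * g γ ≈ 0#) → (f ⊛ g) α ≈ 0#
    ⊛-zero′ f g []      h = h [] [] ≡.refl
    ⊛-zero′ f g (a ∷ α) h = A.zero′ a λ i j i+j≡a → ⊛-zero′ (f ∘ (i ∷_)) (g ∘ (j ∷_)) α λ β γ e →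
      h (i ∷ β) (j ∷ γ) (≡.trans (ℕ-interchange i (sum β) j (sum γ)) (≡.cong₂ ℕ._+_ i+j≡a e))
      where
      open import Algebra.Properties.CommutativeSemigroup ℕ.+-commutativeSemigroup
        using () renaming (interchange to ℕ-interchange)

    ⊛-distribʳ : ∀ f g h α → ((λ β → f β + g β) ⊛ h) α ≈ (f ⊛ h) α + (g ⊛ h) α
    ⊛-distribʳ f g h []      = distribʳ _ _ _
    ⊛-distribʳ f g h (a ∷ α) = ≈-trans
      (A.cong a (λ i j → ⊛-distribʳ (f ∘ (i ∷_)) (g ∘ (i ∷_)) (h ∘ (j ∷_)) α)) (A.distrib-+ a _ _)

    ⊛-scaleˡ : ∀ c f g α → ((λ β → c * f β) ⊛ g) α ≈ c * (f ⊛ g) α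
    ⊛-scaleˡ c f g []      = *-assoc c _ _
    ⊛-scaleˡ c f g (a ∷ α) = ≈-trans
      (A.cong a (λ i j → ⊛-scaleˡ c (f ∘ (i ∷_)) (g ∘ (j ∷_)) α)) (≈-sym (A.distribˡ-* a c _))

    ⊛-comm : ∀ f g α → (f ⊛ g) α ≈ (g ⊛ f) α
    ⊛-comm f g []      = *-comm _ _
    ⊛-comm f g (a ∷ α) = ≈-trans (A.flip′ a _) (A.cong a (λ i j → ⊛-comm (f ∘ (j ∷_)) (g ∘ (i ∷_)) α))

    ⊛-distribˡ : ∀ f g h α → (f ⊛ (λ β → g β + h β)) α ≈ (f ⊛ g) α + (f ⊛ h) α
    ⊛-distribˡ f g h α = ≈-trans (⊛-comm f _ α) (≈-trans (⊛-distribʳ g h f α) (+-cong (⊛-comm g f α) (⊛-comm h f α)))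

    ⊛-scaleʳ : ∀ c f g α → (f ⊛ (λ β → c * g β)) α ≈ c * (f ⊛ g) α
    ⊛-scaleʳ c f g α = ≈-trans (⊛-comm f _ α) (≈-trans (⊛-scaleˡ c g f α) (*-congˡ (⊛-comm g f α)))

    ⊛-antidiagonalˡ : ∀ n (F : ℕ → ℕ → Series) g α →
                    ((λ β → antidiagonal n (λ i j → F i j β)) ⊛ g) α ≈ antidiagonal n (λ i j → (F i j ⊛ g) α)
    ⊛-antidiagonalˡ zero    F g α = ≈-refl
    ⊛-antidiagonalˡ (suc n) F g α = ≈-trans (⊛-distribʳ _ _ g α) (+-congˡ (⊛-antidiagonalˡ n (F ∘ suc) g α))

    ⊛-antidiagonalʳ : ∀ n (F : ℕ → ℕ → Series) g α →
                    (g ⊛ (λ β → antidiagonal n (λ i j → F i j β))) α ≈ antidiagonal n (λ i j → (g ⊛ F i j) α)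
    ⊛-antidiagonalʳ zero    F g α = ≈-refl
    ⊛-antidiagonalʳ (suc n) F g α = ≈-trans (⊛-distribˡ g _ _ α) (+-congˡ (⊛-antidiagonalʳ n (F ∘ suc) g α))

    ⊛-assoc : ∀ f g h α → ((f ⊛ g) ⊛ h) α ≈ (f ⊛ (g ⊛ h)) α
    ⊛-assoc f g h []      = *-assoc _ _ _
    ⊛-assoc f g h (a ∷ α) = begin
      antidiagonal a (λ i j → ((λ β → antidiagonal i (λ k l → (f ∘ (k ∷_) ⊛ g ∘ (l ∷_)) β)) ⊛ h ∘ (j ∷_)) α)
        ≈⟨ A.cong a (λ i j → ⊛-antidiagonalˡ i (λ k l → f ∘ (k ∷_) ⊛ g ∘ (l ∷_)) (h ∘ (j ∷_)) α) ⟩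
      antidiagonal a (λ i j → antidiagonal i (λ k l → ((f ∘ (k ∷_) ⊛ g ∘ (l ∷_)) ⊛ h ∘ (j ∷_)) α))
        ≈⟨ A.cong a (λ i j → A.cong i (λ k l → ⊛-assoc (f ∘ (k ∷_)) (g ∘ (l ∷_)) (h ∘ (j ∷_)) α)) ⟩
      antidiagonal a (λ i j → antidiagonal i (λ k l → (f ∘ (k ∷_) ⊛ (g ∘ (l ∷_) ⊛ h ∘ (j ∷_))) α))
        ≈⟨ A.assoc a (λ k l j → (f ∘ (k ∷_) ⊛ (g ∘ (l ∷_) ⊛ h ∘ (j ∷_))) α) ⟩
      antidiagonal a (λ k m → antidiagonal m (λ l j → (f ∘ (k ∷_) ⊛ (g ∘ (l ∷_) ⊛ h ∘ (j ∷_))) α))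
        ≈⟨ A.cong a (λ k m → ⊛-antidiagonalʳ m (λ l j → g ∘ (l ∷_) ⊛ h ∘ (j ∷_)) (f ∘ (k ∷_)) α) ⟨
      (f ⊛ (g ⊛ h)) (a ∷ α) ∎

    ⊛-permute : ∀ f g → (∀ {α β} → α ↭ β → f α ≈ f β) → (∀ {α β} → α ↭ β → g α ≈ g β) →
              ∀ {α β} → α ↭ β → (f ⊛ g) α ≈ (f ⊛ g) β
    ⊛-permute f g p q refl = ≈-refl
    ⊛-permute f g p q (prep x r) = A.cong x λ i j →
      ⊛-permute (f ∘ (i ∷_)) (g ∘ (j ∷_)) (p ∘ prep i) (q ∘ prep j) r
    ⊛-permute f g p q (swap {xs} x y r) = ≈-trans (A.interchange x y _) (A.cong y λ k l → A.cong x λ i j →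
      ≈-trans (⊛-cong {λ α → f (i ∷ k ∷ α)} {λ α → f (k ∷ i ∷ α)} {λ α → g (j ∷ l ∷ α)} {λ α → g (l ∷ j ∷ α)}
                      (λ α → p (swap i k refl)) (λ α → q (swap j l refl)) xs)
              (⊛-permute (λ α → f (k ∷ i ∷ α)) (λ α → g (l ∷ j ∷ α))
                         (λ s → p (prep k (prep i s))) (λ s → q (prep l (prep j s))) r))
    ⊛-permute f g p q (trans r s) = ≈-trans (⊛-permute f g p q r) (⊛-permute f g p q s)

    ⊛-unit : Series
    ⊛-unit α = 𝟙 (sum α ℕ.≟ 0)

    ⊛-identityˡ : ∀ g α → (⊛-unit ⊛ g) α ≈ g α
    ⊛-identityˡ g []      = *-identityˡ _
    ⊛-identityˡ g (zero  ∷ α) = ⊛-identityˡ (g ∘ (0 ∷_)) α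
    ⊛-identityˡ g (suc a ∷ α) = ≈-trans
      (+-cong (⊛-identityˡ (g ∘ (suc a ∷_)) α)
              (A.zero′ a λ i j _ → ⊛-zero′ (⊛-unit ∘ (suc i ∷_)) (g ∘ (j ∷_)) α λ β γ _ → zeroˡ _))
      (+-identityʳ _)

  private
    +-<-split : ∀ m n {k l} → m ℕ.+ n < k ℕ.+ l → m < k ⊎ n < l
    +-<-split m n {k} {l} p with m ℕ.<? k
    ... | yes q = inj₁ q
    ... | no  q with n ℕ.<? l
    ...   | yes s = inj₂ s
    ...   | no  s = contradiction p (ℕ.≤⇒≯ (ℕ.+-mono-≤ (ℕ.≮⇒≥ q) (ℕ.≮⇒≥ s)))

  infixl 6 _+Λ_
  infixl 7 _*Λ_ _·_

  _+Λ_ : Λ → Λ → Λ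
  f +Λ g = record
    { coeff       = λ α → coeff f α + coeff g α
    ; coeff-↭     = λ p → +-cong (coeff-↭ f p) (coeff-↭ g p)
    ; coeff-0     = λ α → +-cong (coeff-0 f α) (coeff-0 g α)
    ; bound       = bound f ℕ.⊔ bound g
    ; coeff-bound = λ α p → ≈-trans
        (+-cong (coeff-bound f α (ℕ.≤-<-trans (ℕ.m≤m⊔n _ _) p))
                (coeff-bound g α (ℕ.≤-<-trans (ℕ.m≤n⊔m (bound f) _) p))) 0+0≈0
    }

  _*Λ_ : Λ → Λ → Λ
  f *Λ g = record
    { coeff       = coeff f ⊛ coeff g
    ; coeff-↭     = ⊛-permute (coeff f) (coeff g) (coeff-↭ f) (coeff-↭ g)
    ; coeff-0     = ⊛-cong (coeff-0 f) (coeff-0 g)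
    ; bound       = bound f ℕ.+ bound g
    ; coeff-bound = λ α p → ⊛-zero′ (coeff f) (coeff g) α λ β γ e → vanish β γ (≡.subst (_ <_) (≡.sym e) p)
    }
    where
    vanish : ∀ β γ → bound f ℕ.+ bound g < sum β ℕ.+ sum γ → coeff f β * coeff g γ ≈ 0#
    vanish β γ p with +-<-split (bound f) (bound g) p
    ... | inj₁ q = ≈-trans (*-congʳ (coeff-bound f β q)) (zeroˡ _)
    ... | inj₂ q = ≈-trans (*-congˡ (coeff-bound g γ q)) (zeroʳ _)

  _·_ : C → Λ → Λ
  c · f = record
    { coeff       = λ α → c * coeff f α
    ; coeff-↭     = λ p → *-congˡ (coeff-↭ f p)
    ; coeff-0     = λ α → *-congˡ (coeff-0 f α)
    ; bound       = bound f
    ; coeff-bound = λ α p → ≈-trans (*-congˡ (coeff-bound f α p)) (zeroʳ c)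
    }

  -Λ_ : Λ → Λ
  -Λ f = record
    { coeff       = λ α → - coeff f α
    ; coeff-↭     = λ p → -‿cong (coeff-↭ f p)
    ; coeff-0     = λ α → -‿cong (coeff-0 f α)
    ; bound       = bound f
    ; coeff-bound = λ α p → ≈-trans (-‿cong (coeff-bound f α p)) -0≈0
    }

  0Λ : Λ
  0Λ = record
    { coeff       = λ _ → 0#
    ; coeff-↭     = λ _ → ≈-refl
    ; coeff-0     = λ _ → ≈-refl
    ; bound       = 0
    ; coeff-bound = λ _ _ → ≈-refl
    }

  private
    𝟙-⇔ : ∀ {p q} {P : Set p} {Q : Set q} (P? : Dec P) (Q? : Dec Q) → P ⇔ Q → 𝟙 P? ≈ 𝟙 Q?
    𝟙-⇔ P? Q? e = reflexive (≡.cong (if_then 1# else 0#) (does-⇔ e P? Q?))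

    𝟙-false : ∀ {p} {P : Set p} (P? : Dec P) → ¬ P → 𝟙 P? ≈ 0#
    𝟙-false P? ¬p = reflexive (≡.cong (if_then 1# else 0#) (dec-false P? ¬p))

    𝟙-true : ∀ {p} {P : Set p} (P? : Dec P) → P → 𝟙 P? ≈ 1#
    𝟙-true P? p = reflexive (≡.cong (if_then 1# else 0#) (dec-true P? p))

  -- Complete homogeneous: the sum of all monomials of degree k.

  𝐡 : ℕ → Λ
  𝐡 k = record
    { coeff       = λ α → 𝟙 (sum α ℕ.≟ k)
    ; coeff-↭     = λ p → reflexive (≡.cong (λ s → 𝟙 (s ℕ.≟ k)) (sum-↭ p))
    ; coeff-0     = λ α → ≈-refl
    ; bound       = k
    ; coeff-bound = λ α p → 𝟙-false (sum α ℕ.≟ k) (λ e → ℕ.<⇒≢ p (≡.sym e))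
    }

  1Λ : Λ
  1Λ = 𝐡 0

  -- Power sums: xᵢ^k is, for k ≥ 1, the monomial of degree k in which xᵢ
  -- has exponent k.

  𝐩 : (k : ℕ) .{{_ : NonZero k}} → Λ
  𝐩 k@(suc _) = record
    { coeff       = λ α → 𝟙 (power? α)
    ; coeff-↭     = λ {α} {β} p → 𝟙-⇔ (power? α) (power? β) (mk⇔ (respects p) (respects (↭-sym p)))
    ; coeff-0     = λ α → 𝟙-⇔ (power? (0 ∷ α)) (power? α)
                      (mk⇔ (λ { (e , there m) → e , m }) (λ { (e , m) → e , there m }))
    ; bound       = k
    ; coeff-bound = λ α p → 𝟙-false (power? α) (λ e → ℕ.<⇒≢ p (≡.sym (proj₁ e)))
    }
    where
    power? : ∀ α → Dec (sum α ≡ k × k ∈ α)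
    power? α = sum α ℕ.≟ k ×-dec _∈?_ ℕ._≟_ k α
    respects : ∀ {α β} → α ↭ β → sum α ≡ k × k ∈ α → sum β ≡ k × k ∈ β
    respects p (e , m) = ≡.trans (≡.sym (sum-↭ p)) e , ∈-resp-↭ p m

  Λ-commutativeRing : CommutativeRing (r ⊔ ℓ) ℓ
  Λ-commutativeRing = record
    { Carrier = Λ
    ; _≈_ = _≈Λ_
    ; _+_ = _+Λ_
    ; _*_ = _*Λ_
    ; -_  = -Λ_
    ; 0#  = 0Λ
    ; 1#  = 1Λ
    ; isCommutativeRing = record
      { isRing = record
        { +-isAbelianGroup = record
          { isGroup = record
            { isMonoid = record
              { isSemigroup = record
                { isMagma = record
                  { isEquivalence = record
                    { refl  = λ _ → ≈-refl
                    ; sym   = λ p α → ≈-sym (p α)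
                    ; trans = λ p q α → ≈-trans (p α) (q α)
                    }
                  ; ∙-cong = λ p q α → +-cong (p α) (q α)
                  }
                ; assoc = λ f g h α → +-assoc _ _ _
                }
              ; identity = (λ f α → +-identityˡ _) , (λ f α → +-identityʳ _)
              }
            ; inverse = (λ f α → -‿inverseˡ _) , (λ f α → -‿inverseʳ _)
            ; ⁻¹-cong = λ p α → -‿cong (p α)
            }
          ; comm = λ f g α → +-comm _ _
          }
        ; *-cong = ⊛-cong
        ; *-assoc = λ f g h → ⊛-assoc (coeff f) (coeff g) (coeff h)
        ; *-identity = (λ f → ⊛-identityˡ (coeff f))
                     , (λ f α → ≈-trans (⊛-comm (coeff f) _ α) (⊛-identityˡ (coeff f) α))
        ; distrib = (λ f g h → ⊛-distribˡ (coeff f) (coeff g) (coeff h))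
                  , (λ f g h → ⊛-distribʳ (coeff g) (coeff h) (coeff f))
        }
      ; *-comm = λ f g → ⊛-comm (coeff f) (coeff g)
      }
    }

  -- B is a C-algebra through the action _∙_.

  record IsAlgebraHom {b ℓᵇ} (B : CommutativeRing b ℓᵇ) (_∙_ : C → CommutativeRing.Carrier B → CommutativeRing.Carrier B)
                      (φ : Λ → CommutativeRing.Carrier B) : Set (r ⊔ ℓ ⊔ ℓᵇ) where
    private module B = CommutativeRing B
    open RingMorphisms (CommutativeRing.rawRing Λ-commutativeRing) B.rawRing
    field
      isRingHomomorphism : IsRingHomomorphism φ
      ·-homo             : ∀ c f → φ (c · f) B.≈ (c ∙ φ f)
    open IsRingHomomorphism isRingHomomorphism public

  -- Evaluation at (x; y): 𝐩 k ↦ ∑ᵢ xᵢᵏ + (-1)ᵏ⁻¹ ∑ⱼ yⱼᵏ.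

  record Evaluation {d} (x y : Vector C d) : Set (r ⊔ ℓ) where
    field
      ⟦_⟧          : Λ → C
      isAlgebraHom : IsAlgebraHom R _*_ ⟦_⟧
      ⟦𝐩⟧          : ∀ k .{{_ : NonZero k}} →
                     ⟦ 𝐩 k ⟧ ≈ ∑ (λ i → x i ^ k) + (- 1#) ^ (k ℕ.∸ 1) * ∑ (λ j → y j ^ k)
    open IsAlgebraHom isAlgebraHom public

  -- Construction of the evaluation.  Adjoining a variable with value z is an
  -- automorphism of Λ that sends 𝐩 k to 𝐩 k + zᵏ; the evaluation at (x; y)
  -- adjoins every xᵢ, inverts the adjunction of every -yⱼ, and then takes the
  -- constant term.

  private

    module Λᴿ = CommutativeRing Λ-commutativeRing

    mkAlgebraHom : ∀ {b ℓᵇ} (B : CommutativeRing b ℓᵇ) →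
                   let module B = CommutativeRing B in
                   (_∙_ : C → B.Carrier → B.Carrier) (φ : Λ → B.Carrier) →
                   (∀ {f g} → f ≈Λ g → φ f B.≈ φ g) →
                   (∀ f g → φ (f +Λ g) B.≈ (φ f B.+ φ g)) →
                   (∀ f g → φ (f *Λ g) B.≈ (φ f B.* φ g)) →
                   φ 1Λ B.≈ B.1# →
                   (∀ c f → φ (c · f) B.≈ (c ∙ φ f)) →
                   IsAlgebraHom B _∙_ φ
    mkAlgebraHom B _∙_ φ φ-cong φ-+ φ-* φ-1 φ-· = record
      { isRingHomomorphism = record
        { isSemiringHomomorphism = record
          { isNearSemiringHomomorphism = record
            { +-isMonoidHomomorphism = record
              { isMagmaHomomorphism = record
                { isRelHomomorphism = record { cong = φ-cong }
                ; homo = φ-+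
                }
              ; ε-homo = φ-0
              }
            ; *-homo = φ-*
            }
          ; 1#-homo = φ-1
          }
        ; -‿homo = λ f → inverseˡ-unique (φ (-Λ f)) (φ f)
            (B.trans (B.sym (φ-+ (-Λ f) f)) (B.trans (φ-cong (Λᴿ.-‿inverseˡ f)) φ-0))
        }
      ; ·-homo = φ-·
      }
      where
      module B = CommutativeRing B
      open Algebra.Properties.Group B.+-group using (identityˡ-unique; inverseˡ-unique)
      φ-0 : φ 0Λ B.≈ B.0#
      φ-0 = identityˡ-unique (φ 0Λ) (φ 0Λ)
              (B.trans (B.sym (φ-+ 0Λ 0Λ)) (φ-cong (Λᴿ.+-identityˡ 0Λ)))

    upTo : ℕ → (ℕ → C) → C
    upTo zero    F = F 0
    upTo (suc n) F = F 0 + upTo n (F ∘ suc)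

    upTo-cong : ∀ n {F G : ℕ → C} → (∀ i → F i ≈ G i) → upTo n F ≈ upTo n G
    upTo-cong zero    F≈G = F≈G 0
    upTo-cong (suc n) F≈G = +-cong (F≈G 0) (upTo-cong n (F≈G ∘ suc))

    upTo-zero : ∀ n {F} → (∀ i → F i ≈ 0#) → upTo n F ≈ 0#
    upTo-zero zero    F≈0 = F≈0 0
    upTo-zero (suc n) F≈0 = ≈-trans (+-cong (F≈0 0) (upTo-zero n (F≈0 ∘ suc))) 0+0≈0

    upTo-distrib-+ : ∀ n F G → upTo n (λ i → F i + G i) ≈ upTo n F + upTo n G
    upTo-distrib-+ zero    F G = ≈-refl
    upTo-distrib-+ (suc n) F G = ≈-trans (+-congˡ (upTo-distrib-+ n (F ∘ suc) (G ∘ suc))) (+-interchange _ _ _ _)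

    upTo-distribˡ-* : ∀ n c F → c * upTo n F ≈ upTo n (λ i → c * F i)
    upTo-distribˡ-* zero    c F = ≈-refl
    upTo-distribˡ-* (suc n) c F = ≈-trans (distribˡ c _ _) (+-congˡ (upTo-distribˡ-* n c (F ∘ suc)))

    upTo-extend : ∀ m n {F} → m ≤ n → (∀ i → m < i → F i ≈ 0#) → upTo n F ≈ upTo m F
    upTo-extend zero    zero    p       F≈0 = ≈-refl
    upTo-extend zero    (suc n) p       F≈0 = ≈-trans
      (+-congˡ (upTo-zero n (λ i → F≈0 (suc i) (s≤s z≤n)))) (+-identityʳ _)
    upTo-extend (suc m) (suc n) (s≤s p) F≈0 = +-congˡ (upTo-extend m n p (λ i q → F≈0 (suc i) (s≤s q)))

    upTo-antidiagonal : ∀ n G → upTo (suc n) (λ k → antidiagonal k G) ≈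
                        upTo (suc n) (G 0) + upTo n (λ k → antidiagonal k (G ∘ suc))
    upTo-antidiagonal n G = begin
      G 0 0 + upTo n (λ k → G 0 (suc k) + antidiagonal k (G ∘ suc))
        ≈⟨ +-congˡ (upTo-distrib-+ n (λ k → G 0 (suc k)) (λ k → antidiagonal k (G ∘ suc))) ⟩
      G 0 0 + (upTo n (G 0 ∘ suc) + upTo n (λ k → antidiagonal k (G ∘ suc)))
        ≈⟨ +-assoc _ _ _ ⟨
      upTo (suc n) (G 0) + upTo n (λ k → antidiagonal k (G ∘ suc)) ∎

    rectangle : ∀ m n G → (∀ i j → m < i → G i j ≈ 0#) → (∀ i j → n < j → G i j ≈ 0#) →
                upTo (m ℕ.+ n) (λ k → antidiagonal k G) ≈ upTo m (λ i → upTo n (G i))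
    rectangle zero zero G p q = ≈-refl
    rectangle zero (suc n) G p q = begin
      upTo (suc n) (λ k → antidiagonal k G)                            ≈⟨ upTo-antidiagonal n G ⟩
      upTo (suc n) (G 0) + upTo n (λ k → antidiagonal k (G ∘ suc))
        ≈⟨ +-congˡ (upTo-zero n (λ k → A.zero′ k (λ i j _ → p (suc i) j (s≤s z≤n)))) ⟩
      upTo (suc n) (G 0) + 0#                                          ≈⟨ +-identityʳ _ ⟩
      upTo (suc n) (G 0)                                               ∎
    rectangle (suc m) n G p q = begin
      upTo (suc (m ℕ.+ n)) (λ k → antidiagonal k G)                    ≈⟨ upTo-antidiagonal (m ℕ.+ n) G ⟩
      upTo (suc (m ℕ.+ n)) (G 0) + upTo (m ℕ.+ n) (λ k → antidiagonal k (G ∘ suc))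
        ≈⟨ +-cong (upTo-extend n (suc (m ℕ.+ n)) (ℕ.m≤n+m n (suc m)) (q 0))
                  (rectangle m n (G ∘ suc) (λ i j r → p (suc i) j (s≤s r)) (q ∘ suc)) ⟩
      upTo n (G 0) + upTo m (λ i → upTo n (G (suc i)))                 ∎

    ⊛-upToˡ : ∀ n (F : ℕ → Series) g α → ((λ β → upTo n (λ i → F i β)) ⊛ g) α ≈ upTo n (λ i → (F i ⊛ g) α)
    ⊛-upToˡ zero    F g α = ≈-refl
    ⊛-upToˡ (suc n) F g α = ≈-trans (⊛-distribʳ (F 0) _ g α) (+-congˡ (⊛-upToˡ n (F ∘ suc) g α))

    ⊛-upToʳ : ∀ n (F : ℕ → Series) g α → (g ⊛ (λ β → upTo n (λ i → F i β))) α ≈ upTo n (λ i → (g ⊛ F i) α)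
    ⊛-upToʳ n F g α = ≈-trans (⊛-comm g _ α)
      (≈-trans (⊛-upToˡ n F g α) (upTo-cong n (λ i → ⊛-comm (F i) g α)))

    Degree≤-tail : ∀ n f → Degree≤ n f → ∀ i α → n < i → coeff f (i ∷ α) ≈ 0#
    Degree≤-tail n f b i α p = b (i ∷ α) (ℕ.≤-trans p (ℕ.m≤m+n i (sum α)))

    Degree≤-resp : ∀ {n f g} → f ≈Λ g → Degree≤ n f → Degree≤ n g
    Degree≤-resp f≈g b α p = ≈-trans (≈-sym (f≈g α)) (b α p)

    module Adjoin (z : C) where

      adjoin : Λ → Λ
      adjoin f = record
        { coeff       = λ α → upTo (bound f) (λ i → z ^ i * coeff f (i ∷ α))
        ; coeff-↭     = λ p → upTo-cong (bound f) (λ i → *-congˡ (coeff-↭ f (prep i p)))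
        ; coeff-0     = λ α → upTo-cong (bound f) (λ i → *-congˡ
                          (≈-trans (coeff-↭ f (swap i 0 refl)) (coeff-0 f (i ∷ α))))
        ; bound       = bound f
        ; coeff-bound = λ α p → upTo-zero (bound f) (λ i → ≈-trans
                          (*-congˡ (coeff-bound f (i ∷ α) (ℕ.≤-trans p (ℕ.m≤n+m (sum α) i)))) (zeroʳ _))
        }

      adjoin-bound : ∀ n f → Degree≤ n f → ∀ α → coeff (adjoin f) α ≈ upTo n (λ i → z ^ i * coeff f (i ∷ α))
      adjoin-bound n f b α = ≈-trans
        (≈-sym (upTo-extend (bound f) (bound f ℕ.+ n) (ℕ.m≤m+n (bound f) n)
          (λ i p → ≈-trans (*-congˡ (Degree≤-tail (bound f) f (coeff-bound f) i α p)) (zeroʳ _))))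
        (upTo-extend n (bound f ℕ.+ n) (ℕ.m≤n+m n (bound f))
          (λ i p → ≈-trans (*-congˡ (Degree≤-tail n f b i α p)) (zeroʳ _)))

      adjoin-cong : ∀ {f g} → f ≈Λ g → adjoin f ≈Λ adjoin g
      adjoin-cong {f} {g} f≈g α = ≈-trans
        (adjoin-bound (bound g) f (Degree≤-resp {f = g} {f} (≈-sym ∘ f≈g) (coeff-bound g)) α)
        (upTo-cong (bound g) (λ i → *-congˡ (f≈g (i ∷ α))))

      adjoin-+ : ∀ f g → adjoin (f +Λ g) ≈Λ adjoin f +Λ adjoin g
      adjoin-+ f g α = begin
        upTo n (λ i → z ^ i * (coeff f (i ∷ α) + coeff g (i ∷ α)))
          ≈⟨ upTo-cong n (λ i → distribˡ _ _ _) ⟩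
        upTo n (λ i → z ^ i * coeff f (i ∷ α) + z ^ i * coeff g (i ∷ α))
          ≈⟨ upTo-distrib-+ n (λ i → z ^ i * coeff f (i ∷ α)) (λ i → z ^ i * coeff g (i ∷ α)) ⟩
        upTo n (λ i → z ^ i * coeff f (i ∷ α)) + upTo n (λ i → z ^ i * coeff g (i ∷ α))
          ≈⟨ +-cong (adjoin-bound n f (λ β p → coeff-bound f β (ℕ.≤-<-trans (ℕ.m≤m⊔n _ _) p)) α)
                    (adjoin-bound n g (λ β p → coeff-bound g β (ℕ.≤-<-trans (ℕ.m≤n⊔m (bound f) _) p)) α) ⟨
        coeff (adjoin f) α + coeff (adjoin g) α ∎
        where n = bound f ℕ.⊔ bound g

      adjoin-· : ∀ c f → adjoin (c · f) ≈Λ c · adjoin f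
      adjoin-· c f α = ≈-trans (upTo-cong (bound f) (λ i → x*yz≈y*xz (z ^ i) c _))
        (≈-sym (upTo-distribˡ-* (bound f) c (λ i → z ^ i * coeff f (i ∷ α))))

      adjoin-1 : adjoin 1Λ ≈Λ 1Λ
      adjoin-1 α = *-identityˡ _

      adjoin-* : ∀ f g → adjoin (f *Λ g) ≈Λ adjoin f *Λ adjoin g
      adjoin-* f g α = begin
        upTo (m ℕ.+ n) (λ k → z ^ k * antidiagonal k (λ i j → (f′ i ⊛ g′ j) α))
          ≈⟨ upTo-cong (m ℕ.+ n) (λ k → A.distribˡ-* k (z ^ k) (λ i j → (f′ i ⊛ g′ j) α)) ⟩
        upTo (m ℕ.+ n) (λ k → antidiagonal k (λ i j → z ^ k * (f′ i ⊛ g′ j) α))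
          ≈⟨ upTo-cong (m ℕ.+ n) (λ k → A.cong′ k (λ i j e → ≈-trans
               (*-congʳ (≈-trans (reflexive (≡.cong (z ^_) (≡.sym e))) (^-homo-* z i j)))
               (≈-trans (*-assoc _ _ _) (scale i j)))) ⟩
        upTo (m ℕ.+ n) (λ k → antidiagonal k (λ i j → (zf i ⊛ zg j) α))
          ≈⟨ rectangle m n (λ i j → (zf i ⊛ zg j) α)
               (λ i j p → ⊛-zero′ (zf i) (zg j) α (λ β γ _ → ≈-trans (*-congʳ (≈-trans
                 (*-congˡ (Degree≤-tail m f (coeff-bound f) i β p)) (zeroʳ _))) (zeroˡ _)))
               (λ i j p → ⊛-zero′ (zf i) (zg j) α (λ β γ _ → ≈-trans (*-congˡ (≈-trans
                 (*-congˡ (Degree≤-tail n g (coeff-bound g) j γ p)) (zeroʳ _))) (zeroʳ _))) ⟩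
        upTo m (λ i → upTo n (λ j → (zf i ⊛ zg j) α))
          ≈⟨ upTo-cong m (λ i → ⊛-upToʳ n zg (zf i) α) ⟨
        upTo m (λ i → (zf i ⊛ coeff (adjoin g)) α)
          ≈⟨ ⊛-upToˡ m zf (coeff (adjoin g)) α ⟨
        (coeff (adjoin f) ⊛ coeff (adjoin g)) α ∎
        where
        m = bound f
        n = bound g
        f′ g′ zf zg : ℕ → Series
        f′ i β = coeff f (i ∷ β)
        g′ j β = coeff g (j ∷ β)
        zf i β = z ^ i * f′ i β
        zg j β = z ^ j * g′ j β
        scale : ∀ i j → z ^ i * (z ^ j * (f′ i ⊛ g′ j) α) ≈ (zf i ⊛ zg j) α
        scale i j = ≈-trans (*-congˡ (≈-sym (⊛-scaleʳ (z ^ j) (f′ i) (g′ j) α)))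
                            (≈-sym (⊛-scaleˡ (z ^ i) (f′ i) (zg j) α))

      adjoin-𝐩 : ∀ k → adjoin (𝐩 (suc k)) ≈Λ 𝐩 (suc k) +Λ z ^ suc k · 1Λ
      adjoin-𝐩 k α = +-cong
        (≈-trans (*-identityˡ _) (coeff-0 (𝐩 (suc k)) α))
        (last k (λ i → z * z ^ i * coeff (𝐩 (suc k)) (suc i ∷ α)) other
          (*-congˡ (𝟙-⇔ (sum (suc k ∷ α) ℕ.≟ suc k ×-dec _∈?_ ℕ._≟_ (suc k) (suc k ∷ α)) (sum α ℕ.≟ 0)
            (mk⇔ (λ (e , _) → ℕ.+-cancelˡ-≡ (suc k) (sum α) 0 (≡.trans e (≡.sym (ℕ.+-identityʳ _))))
                 (λ e → ≡.trans (≡.cong (suc k ℕ.+_) e) (ℕ.+-identityʳ _) , here ≡.refl)))))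
        where
        -- a sum in which only the term with index k is non-zero
        last : ∀ k F {x} → (∀ i → i ≢ k → F i ≈ 0#) → F k ≈ x → upTo k F ≈ x
        last zero    F p q = q
        last (suc k) F p q = ≈-trans (+-cong (p 0 λ ()) (last k (F ∘ suc) (λ i n → p (suc i) (n ∘ ℕ.suc-injective)) q))
                                     (+-identityˡ _)
        ∈⇒≤ : ∀ {n β} → n ∈ β → n ≤ sum β
        ∈⇒≤ {β = b ∷ β} (here ≡.refl) = ℕ.m≤m+n b (sum β)
        ∈⇒≤ {β = b ∷ β} (there m)     = ℕ.≤-trans (∈⇒≤ m) (ℕ.m≤n+m (sum β) b)
        other : ∀ i → i ≢ k → z * z ^ i * coeff (𝐩 (suc k)) (suc i ∷ α) ≈ 0#
        other i i≢k = ≈-trans (*-congˡ (𝟙-false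
          (sum (suc i ∷ α) ℕ.≟ suc k ×-dec _∈?_ ℕ._≟_ (suc k) (suc i ∷ α)) impossible)) (zeroʳ _)
          where
          impossible : ¬ (sum (suc i ∷ α) ≡ suc k × suc k ∈ suc i ∷ α)
          impossible (e , here e′) = i≢k (≡.sym (ℕ.suc-injective e′))
          impossible (e , there m) = ℕ.<⇒≱ (ℕ.≤-reflexive e) (ℕ.≤-trans (∈⇒≤ m) (ℕ.m≤n+m (sum α) i))

      -- adjoin f - f, with lower degree than f
      rest : Λ → Λ
      rest f = adjoin f +Λ (-Λ f)

      rest-bound : ∀ n f → Degree≤ (suc n) f → Degree≤ n (rest f)
      rest-bound n f b α p = begin
        coeff (adjoin f) α + - coeff f α
          ≈⟨ +-congʳ (adjoin-bound (suc n) f b α) ⟩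
        (1# * coeff f (0 ∷ α) + upTo n (λ i → z ^ suc i * coeff f (suc i ∷ α))) + - coeff f α
          ≈⟨ +-congʳ (+-cong (≈-trans (*-identityˡ _) (coeff-0 f α)) (upTo-zero n (λ i → ≈-trans
               (*-congˡ (b (suc i ∷ α) (s≤s (ℕ.≤-trans p (ℕ.m≤n+m (sum α) i))))) (zeroʳ _)))) ⟩
        (coeff f α + 0#) + - coeff f α
          ≈⟨ +-congʳ (+-identityʳ _) ⟩
        coeff f α + - coeff f α
          ≈⟨ -‿inverseʳ _ ⟩
        0# ∎

      rest-zero : ∀ f → Degree≤ 0 f → rest f ≈Λ 0Λ
      rest-zero f b α = ≈-trans (+-congʳ (≈-trans (adjoin-bound 0 f b α)
        (≈-trans (*-identityˡ _) (coeff-0 f α)))) (-‿inverseʳ _)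

      module ΛG = Algebra.Properties.Group Λᴿ.+-group

      isHom : IsAlgebraHom Λ-commutativeRing _·_ adjoin
      isHom = mkAlgebraHom Λ-commutativeRing _·_ adjoin
        (λ {f} {g} → adjoin-cong {f} {g}) adjoin-+ adjoin-* adjoin-1 adjoin-·

      open IsAlgebraHom isHom using (-‿homo)

      remove′ : ℕ → Λ → Λ
      remove′ zero    f = f
      remove′ (suc n) f = f +Λ (-Λ remove′ n (rest f))

      remove : Λ → Λ
      remove f = remove′ (bound f) f

      adjoin-remove′ : ∀ n f → Degree≤ n f → adjoin (remove′ n f) ≈Λ f
      adjoin-remove′ zero    f b α = ≈-trans (adjoin-bound 0 f b α)
        (≈-trans (*-identityˡ _) (coeff-0 f α))
      adjoin-remove′ (suc n) f b α = begin
        coeff (adjoin (f +Λ (-Λ remove′ n (rest f)))) α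
          ≈⟨ adjoin-+ f (-Λ remove′ n (rest f)) α ⟩
        coeff (adjoin f) α + coeff (adjoin (-Λ remove′ n (rest f))) α
          ≈⟨ +-congˡ (-‿homo (remove′ n (rest f)) α) ⟩
        coeff (adjoin f) α + - coeff (adjoin (remove′ n (rest f))) α
          ≈⟨ +-congˡ (-‿cong (adjoin-remove′ n (rest f) (rest-bound n f b) α)) ⟩
        coeff (adjoin f) α + - (coeff (adjoin f) α + - coeff f α)
          ≈⟨ +-congˡ (-‿+-comm _ _) ⟨
        coeff (adjoin f) α + (- coeff (adjoin f) α + - - coeff f α)
          ≈⟨ +-assoc _ _ _ ⟨
        (coeff (adjoin f) α + - coeff (adjoin f) α) + - - coeff f α
          ≈⟨ +-cong (-‿inverseʳ _) (-‿involutive _) ⟩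
        0# + coeff f α
          ≈⟨ +-identityˡ _ ⟩
        coeff f α ∎

      adjoin-remove : ∀ f → adjoin (remove f) ≈Λ f
      adjoin-remove f = adjoin-remove′ (bound f) f (coeff-bound f)

      kernel : ∀ n f → Degree≤ n f → adjoin f ≈Λ 0Λ → f ≈Λ 0Λ
      kernel zero    f b e α = ≈-trans (≈-sym (≈-trans (adjoin-bound 0 f b α)
        (≈-trans (*-identityˡ _) (coeff-0 f α)))) (e α)
      kernel (suc n) f b e   = kernel n f (λ α p → ≈-trans (f≈-rest α)
        (≈-trans (-‿cong (rest-bound n f b α p)) -0≈0)) e
        where
        f≈-rest : ∀ α → coeff f α ≈ - coeff (rest f) α
        f≈-rest α = ≈-sym (≈-trans (-‿cong (≈-trans (+-congʳ (e α)) (+-identityˡ _))) (-‿involutive _))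

      injective : ∀ {f g} → adjoin f ≈Λ adjoin g → f ≈Λ g
      injective {f} {g} e = Λᴿ.trans {f} {(f +Λ (-Λ g)) +Λ g} {g}
        (λ α → ≈-sym (≈-trans (+-assoc _ _ _) (≈-trans (+-congˡ (-‿inverseˡ _)) (+-identityʳ _))))
        (λ α → ≈-trans (+-congʳ (f-g≈0 α)) (+-identityˡ _))
        where
        f-g≈0 : f +Λ (-Λ g) ≈Λ 0Λ
        f-g≈0 = kernel _ (f +Λ (-Λ g)) (coeff-bound (f +Λ (-Λ g))) (λ α → ≈-trans (adjoin-+ f (-Λ g) α)
          (≈-trans (+-cong (e α) (-‿homo g α)) (-‿inverseʳ _)))

      remove-isHom : IsAlgebraHom Λ-commutativeRing _·_ remove
      remove-isHom = mkAlgebraHom Λ-commutativeRing _·_ remove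
        (λ {f} {g} f≈g → injective {remove f} {remove g} λ α →
          ≈-trans (adjoin-remove f α) (≈-trans (f≈g α) (≈-sym (adjoin-remove g α))))
        (λ f g → injective {remove (f +Λ g)} {remove f +Λ remove g} λ α →
          ≈-trans (adjoin-remove (f +Λ g) α) (≈-sym (≈-trans (adjoin-+ (remove f) (remove g) α)
            (+-cong (adjoin-remove f α) (adjoin-remove g α)))))
        (λ f g → injective {remove (f *Λ g)} {remove f *Λ remove g} λ α →
          ≈-trans (adjoin-remove (f *Λ g) α) (≈-sym (≈-trans (adjoin-* (remove f) (remove g) α)
            (⊛-cong (adjoin-remove f) (adjoin-remove g) α))))
        (injective {remove 1Λ} {1Λ} λ α → ≈-trans (adjoin-remove 1Λ α) (≈-sym (adjoin-1 α)))
        (λ c f → injective {remove (c · f)} {c · remove f} λ α →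
          ≈-trans (adjoin-remove (c · f) α) (≈-sym (≈-trans (adjoin-· c (remove f) α)
            (*-congˡ (adjoin-remove f α)))))

      remove-𝐩 : ∀ k → remove (𝐩 (suc k)) ≈Λ 𝐩 (suc k) +Λ (- (z ^ suc k)) · 1Λ
      remove-𝐩 k = injective {remove p} {p +Λ c · 1Λ} λ α → begin
        coeff (adjoin (remove p)) α                      ≈⟨ adjoin-remove p α ⟩
        coeff p α                                        ≈⟨ +-identityʳ _ ⟨
        coeff p α + 0#                                   ≈⟨ +-congˡ (≈-trans (≈-sym (distribʳ _ _ _))
                                                              (≈-trans (*-congʳ (-‿inverseʳ _)) (zeroˡ _))) ⟨
        coeff p α + (z ^ suc k * coeff 1Λ α + c * coeff 1Λ α) ≈⟨ +-assoc _ _ _ ⟨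
        (coeff p α + z ^ suc k * coeff 1Λ α) + c * coeff 1Λ α
          ≈⟨ +-cong (adjoin-𝐩 k α) (≈-trans (adjoin-· c 1Λ α) (*-congˡ (adjoin-1 α))) ⟨
        coeff (adjoin p) α + coeff (adjoin (c · 1Λ)) α   ≈⟨ adjoin-+ p (c · 1Λ) α ⟨
        coeff (adjoin (p +Λ c · 1Λ)) α                   ∎
        where
        p = 𝐩 (suc k)
        c = - (z ^ suc k)

    -- Endomorphisms of Λ that send 𝐩 (suc k) to 𝐩 (suc k) + v k.

    record Translation (v : ℕ → C) : Set (r ⊔ ℓ) where
      field
        map   : Λ → Λ
        isHom : IsAlgebraHom Λ-commutativeRing _·_ map
        map-𝐩 : ∀ k → map (𝐩 (suc k)) ≈Λ 𝐩 (suc k) +Λ v k · 1Λ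
      open IsAlgebraHom isHom public

    identity : Translation (λ _ → 0#)
    identity = record
      { map   = λ f → f
      ; isHom = mkAlgebraHom Λ-commutativeRing _·_ (λ f → f) (λ e → e)
                  (λ f g → Λᴿ.refl {f +Λ g}) (λ f g → Λᴿ.refl {f *Λ g}) (Λᴿ.refl {1Λ}) (λ c f → Λᴿ.refl {c · f})
      ; map-𝐩 = λ k α → ≈-sym (≈-trans (+-congˡ (zeroˡ _)) (+-identityʳ _))
      }

    compose : ∀ {v w} → Translation v → Translation w → Translation (λ k → v k + w k)
    compose {v} {w} S T = record
      { map   = S.map ∘ T.map
      ; isHom = mkAlgebraHom Λ-commutativeRing _·_ (S.map ∘ T.map)
          (λ {f} {g} e → S.⟦⟧-cong {T.map f} {T.map g} (T.⟦⟧-cong {f} {g} e))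
          (λ f g α → ≈-trans (S.⟦⟧-cong {T.map (f +Λ g)} {T.map f +Λ T.map g} (T.+-homo f g) α) (S.+-homo (T.map f) (T.map g) α))
          (λ f g α → ≈-trans (S.⟦⟧-cong {T.map (f *Λ g)} {T.map f *Λ T.map g} (T.*-homo f g) α) (S.*-homo (T.map f) (T.map g) α))
          (λ α → ≈-trans (S.⟦⟧-cong {T.map 1Λ} {1Λ} T.1#-homo α) (S.1#-homo α))
          (λ c f α → ≈-trans (S.⟦⟧-cong {T.map (c · f)} {c · T.map f} (T.·-homo c f) α) (S.·-homo c (T.map f) α))
      ; map-𝐩 = λ k α → begin
          coeff (S.map (T.map (𝐩 (suc k)))) α
            ≈⟨ S.⟦⟧-cong {T.map (𝐩 (suc k))} {𝐩 (suc k) +Λ w k · 1Λ} (T.map-𝐩 k) α ⟩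
          coeff (S.map (𝐩 (suc k) +Λ w k · 1Λ)) α
            ≈⟨ S.+-homo (𝐩 (suc k)) (w k · 1Λ) α ⟩
          coeff (S.map (𝐩 (suc k))) α + coeff (S.map (w k · 1Λ)) α
            ≈⟨ +-cong (S.map-𝐩 k α) (≈-trans (S.·-homo (w k) 1Λ α) (*-congˡ (S.1#-homo α))) ⟩
          (coeff (𝐩 (suc k)) α + v k * coeff 1Λ α) + w k * coeff 1Λ α
            ≈⟨ ≈-trans (+-assoc _ _ _) (+-congˡ (≈-sym (distribʳ _ _ _))) ⟩
          coeff (𝐩 (suc k)) α + (v k + w k) * coeff 1Λ α ∎
      }
      where
      module S = Translation S
      module T = Translation T

    composeAll : ∀ {d} {v : Fin d → ℕ → C} → (∀ i → Translation (v i)) → Translation (λ k → ∑ (λ i → v i k))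
    composeAll {zero}  T = identity
    composeAll {suc d} T = compose (T zero) (composeAll (T ∘ suc))

    adjunction : (z : C) → Translation (λ k → z ^ suc k)
    adjunction z = record { map = adjoin ; isHom = isHom ; map-𝐩 = adjoin-𝐩 }
      where open Adjoin z

    removal : (z : C) → Translation (λ k → - (z ^ suc k))
    removal z = record { map = remove ; isHom = remove-isHom ; map-𝐩 = remove-𝐩 }
      where open Adjoin z

    translation : ∀ {d} (x y : Vector C d) →
      Translation (λ k → ∑ (λ i → x i ^ suc k) + ∑ (λ j → - ((- y j) ^ suc k)))
    translation x y = compose (composeAll (λ i → adjunction (x i))) (composeAll (λ j → removal (- y j)))

    neg-power : ∀ y k → - ((- y) ^ suc k) ≈ (- 1#) ^ k * y ^ suc k
    neg-power y k = begin
      - (- y * (- y) ^ k)         ≈⟨ -‿cong (-‿distribˡ-* _ _) ⟨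
      - (- (y * (- y) ^ k))       ≈⟨ -‿involutive _ ⟩
      y * (- y) ^ k               ≈⟨ *-congˡ (signs k) ⟩
      y * ((- 1#) ^ k * y ^ k)    ≈⟨ x*yz≈y*xz _ _ _ ⟩
      (- 1#) ^ k * (y * y ^ k)    ∎
      where
      signs : ∀ k → (- y) ^ k ≈ (- 1#) ^ k * y ^ k
      signs zero    = ≈-sym (*-identityˡ _)
      signs (suc k) = ≈-trans (*-cong (≈-trans (-‿cong (≈-sym (*-identityˡ y))) (-‿distribˡ-* _ _)) (signs k))
                              (*-interchange _ _ _ _)

  evaluation : ∀ {d} (x y : Vector C d) → Evaluation x y
  evaluation x y = record
    { ⟦_⟧          = λ f → coeff (T.map f) []
    ; isAlgebraHom = mkAlgebraHom R _*_ (λ f → coeff (T.map f) [])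
        (λ {f} {g} e → T.⟦⟧-cong {f} {g} e []) (λ f g → T.+-homo f g []) (λ f g → T.*-homo f g [])
        (T.1#-homo []) (λ c f → T.·-homo c f [])
    ; ⟦𝐩⟧          = λ where
        (suc k) → begin
          coeff (T.map (𝐩 (suc k))) []
            ≈⟨ T.map-𝐩 k [] ⟩
          0# + (∑ (λ i → x i ^ suc k) + ∑ (λ j → - ((- y j) ^ suc k))) * 1#
            ≈⟨ ≈-trans (+-identityˡ _) (*-identityʳ _) ⟩
          ∑ (λ i → x i ^ suc k) + ∑ (λ j → - ((- y j) ^ suc k))
            ≈⟨ +-congˡ (sum-cong-≋ (λ j → neg-power (y j) k)) ⟩
          ∑ (λ i → x i ^ suc k) + ∑ (λ j → (- 1#) ^ k * y j ^ suc k)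
            ≈⟨ +-congˡ (*-distribˡ-sum ((- 1#) ^ k) (λ j → y j ^ suc k)) ⟨
          ∑ (λ i → x i ^ suc k) + (- 1#) ^ k * ∑ (λ j → y j ^ suc k) ∎
    }
    where
    module T = Translation (translation x y)

  infix 9 _⟨_⨾_⟩

  _⟨_⨾_⟩ : ∀ {d} → Λ → Vector C d → Vector C d → C
  f ⟨ x ⨾ y ⟩ = Evaluation.⟦_⟧ (evaluation x y) f

module _ {r ℓ} (R : CommutativeRing r ℓ) where

  open CommutativeRing R hiding (zero)
  open Algebra.Properties.Semiring.Exp semiring using (_^_)
  open Algebra.Properties.Semiring.Sum semiring using () renaming (sum to ∑)

  det : ∀ {n} → (Fin n → Fin n → Carrier) → Carrier
  det {zero}  M = 1#
  det {suc n} M = ∑ λ j → (- 1#) ^ toℕ j * (M zero j * det (λ i k → M (suc i) (punchIn j k)))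

  ∑-over : ∀ {a} {A : Set a} → List A → (A → Carrier) → Carrier
  ∑-over xs F = List.foldr (λ x s → F x + s) 0# xs

module Interpolation {k ℓ₁ ℓ₂} (K : HeytingField k ℓ₁ ℓ₂) where

  open HeytingField K using (heytingCommutativeRing; #⇒invertible)
  open HeytingField K using (Carrier; _≈_; _#_; _+_; _*_; -_; _-_; 0#; 1#) public
  open HeytingCommutativeRing heytingCommutativeRing using (commutativeRing) public
  open CommutativeRing commutativeRing using (semiring)
  open Algebra.Properties.Semiring.Exp semiring using (_^_)
  open Algebra.Properties.Semiring.Mult semiring using () renaming (_×_ to _×ᴷ_)

  open SymmetricFunctions commutativeRing public
  open Algebra.Properties.Semiring.Sum (CommutativeRing.semiring Λ-commutativeRing) using ()
    renaming (sum to ∑Λ)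

  CharacteristicZero : Set ℓ₂
  CharacteristicZero = ∀ n .{{_ : NonZero n}} → (n ×ᴷ 1#) # 0#

  -- divide u v v#0 is u / v; the library's inverse is that of v - 0#.

  divide : Carrier → (v : Carrier) → v # 0# → Carrier
  divide u v v#0 = u * proj₁ (#⇒invertible v#0)

  e : ℕ → List Carrier → Carrier
  e zero    us       = 1#
  e (suc k) []       = 0#
  e (suc k) (u ∷ us) = u * e k us + e (suc k) us

  τ : ℤ → (ℤ → Carrier) → (ℤ → Carrier)
  τ r a i = a (i ℤ.+ r)

  dual : (ℤ → Carrier) → (ℤ → Carrier)
  dual a i = - a (1ℤ ℤ.- i)

  -- For k ≥ 1, h (+ k) a is the sum over i = 1, …, k of
  -- (-1)ᵏ⁻ⁱ eₖ₋ᵢ(a₁, …, aₖ₋₁) hᵢ; below, k is shifted by 1 and i runs from 0.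

  h : ℤ → (ℤ → Carrier) → Λ
  h (+ zero)  a = 1Λ
  h (+ suc k) a = ∑Λ {suc k} λ i →
    ((- 1#) ^ (k ℕ.∸ toℕ i) * e (k ℕ.∸ toℕ i) (List.map (λ j → a (+ suc j)) (List.upTo k)))
      · 𝐡 (suc (toℕ i))
  h -[1+ _ ]  a = 0Λ

  -- The matrix has size ℓ(μ); each further row i would vanish left of the
  -- diagonal and have diagonal entry 1.  Here i and j run from 0.

  s : Partition → (ℤ → Carrier) → Λ
  s μ a = det Λ-commutativeRing {len μ} λ i j →
    h (+ row μ (toℕ i) ℤ.- + suc (toℕ i) ℤ.+ + suc (toℕ j)) (τ (1ℤ ℤ.- + suc (toℕ j)) a)

  x y : (ℤ → Carrier) → ∀ μ → Vector Carrier (diagonal μ)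
  x a μ i = a (arm μ (toℕ i) ℤ.+ 1ℤ)
  y a μ i = dual a (leg μ (toℕ i) ℤ.+ 1ℤ)

{-# OPTIONS --safe #-}
module Submission where

open import Defs
open import Algebra.Apartness.Bundles using (HeytingField)
open import Algebra.Bundles using (CommutativeRing)
import Algebra.Properties.AbelianGroup
import Algebra.Properties.CommutativeSemigroup
import Algebra.Properties.Group
import Algebra.Properties.Ring
import Algebra.Properties.Semiring.Exp
import Algebra.Properties.Semiring.Mult
import Algebra.Properties.Semiring.Sum
import Algebra.Solver.Ring.NaturalCoefficients.Default
open import Data.Bool.Base using (if_then_else_)
open import Data.Empty using (⊥)
open import Data.Fin.Base as Fin using (Fin; toℕ; punchIn)
open import Data.Fin.Properties using (toℕ<n)
open import Data.Integer.Base as ℤ using (ℤ; +_; 1ℤ; _⊖_)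
import Data.Integer.Properties as ℤ
import Data.Integer.Solver
open import Data.List.Base as List
  using (List; []; _∷_; [_]; _++_; length; filter; foldr; applyUpTo; applyDownFrom; downFrom; upTo)
open import Data.List.Membership.DecPropositional using (_∈?_)
open import Data.List.Membership.Propositional using (_∈_)
open import Data.List.Membership.Propositional.Properties
  using (∈-∃++; ∈-++⁻; ∈-++⁺ʳ; ∈-applyUpTo⁻; ∈-downFrom⁺; ∈-downFrom⁻; ∈-filter⁺; ∈-filter⁻)
open import Data.List.Properties
  using (map-++; map-upTo; map-applyUpTo; length-++; length-map; length-filter; length-upTo; length-applyUpTo;
         length-downFrom; applyUpTo-∷ʳ; reverse-applyUpTo; ++-assoc; ++-identityʳ)
open import Data.List.Relation.Binary.Permutation.Propositional as ↭
  using (_↭_; prep; swap; ↭⇒↭ₛ; ↭-refl; ↭-reflexive; ↭-sym; ↭-trans)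
open import Data.List.Relation.Binary.Permutation.Propositional.Properties as Permutation
  using (map⁺; ++⁺ˡ; ++-comm; shifts; ↭-reverse; ↭-length; ∈-resp-↭)
open import Data.List.Relation.Binary.Permutation.Setoid.Properties using (Unique-resp-↭)
open import Data.List.Relation.Binary.Prefix.Heterogeneous using (Prefix; []; _∷_)
open import Data.List.Relation.Unary.All as All using (All; []; _∷_)
import Data.List.Relation.Unary.All.Properties as All
open import Data.List.Relation.Unary.AllPairs using (AllPairs; []; _∷_)
open import Data.List.Relation.Unary.Any using (here; there)
open import Data.List.Relation.Unary.Linked.Properties using (Linked⇒AllPairs)
open import Data.List.Relation.Unary.Unique.Propositional using (Unique)
import Data.List.Relation.Unary.Unique.Propositional.Properties as Unique
open import Data.Nat.Base as ℕ using (ℕ; zero; suc; _≤_; _<_; _≥_; z≤n; s≤s; _∸_; _⊓_)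
open import Data.Nat.ListAction using (sum)
import Data.Nat.Properties as ℕ
import Data.Nat.Solver
open import Data.Product.Base using (_×_; _,_; proj₁; proj₂; ∃-syntax; Σ-syntax)
open import Data.Sum.Base using (inj₁; inj₂)
open import Data.Vec.Functional using (Vector)
open import Function.Base using (_∘_; flip; id)
open import Function.Bundles using (_⇔_; mk⇔; Equivalence)
open import Relation.Binary.PropositionalEquality as ≡ using (_≡_; _≢_)
import Relation.Binary.Reasoning.Setoid
open import Relation.Nullary.Decidable using (Dec; yes; no; does; _×-dec_; ¬?; does-⇔; dec-true; dec-false)
open import Relation.Nullary.Negation using (¬_; contradiction)
open import Relation.Unary using (Decidable)

-- By Newton's identities the generating function of the complete symmetric
-- functions at (x(ν); y(ν)) is ∏ (1 + yⱼ t) / ∏ (1 - xᵢ t).  Since the Frobenius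
-- coordinates describe the difference of the sets {νᵢ - i + 1} and {1 - i}, it
-- equals ∏ (1 - a₁₋ᵢ t) / (1 - a_{νᵢ - i + 1} t) over i ≤ N for each N ≥ ℓ(ν).  The
-- parameters in h_{k; τ¹⁻ʲ a} multiply the numerator by further factors.  Column
-- operations trade these for factors of the denominator, and so turn the matrix
-- of s_{μ;a} into the matrix whose entry (i, j) is the coefficient of degree
-- μᵢ - i + j of ∏ (1 - aᵣ t) over 1 - N ≤ r ≤ μᵢ - i, divided by the product of
-- 1 - a_{νₗ - l + 1} t over j ≤ l ≤ N.  If νₗ - l < μᵢ - i for all l ≥ j, then the
-- quotient is a polynomial of smaller degree and the entry vanishes.  Hence for
-- μ ⊄ ν a block of zeros annihilates the determinant, and for μ = ν the matrix is
-- triangular with products of differences of parameters on the diagonal.  So the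
-- expansion of f, evaluated at (x(ν); y(ν)), only involves μ ⊆ ν and can be solved
-- for c(ν).

-- An evaluation is known only through its values at the power sums. The complete functions are
-- reached by Newton's recursion, which has to be divided by k + 1 to determine the next
-- coefficient; this is where characteristic zero enters. The column operations are possible because
-- the entries separate. The numerator attached to ν has the parameters from 1 - N to 0, and the
-- entry (i, j) of positive degree adds those from 2 - j to μᵢ - i. Together these are the
-- parameters from 2 - j to 0, which depend only on the column, and those from 1 - N to μᵢ - i,
-- which depend only on the row. Hence the multipliers of the columns are the same in all rows. All
-- factors have constant term 1 and can be cancelled, so identities of quotients are proved after
-- clearing denominators, where they become permutations of lists of parameter numbers. Counting
-- from a_{1-N} makes these numbers natural. One N must serve both diagrams, N ≥ ℓ(ν) for the
-- generating function and N ≥ ℓ(μ) for the matrix. Matrices are therefore indexed by all natural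
-- numbers and their size is a separate argument.

-- punch j enumerates the numbers different from j in increasing order.

punch : ℕ → ℕ → ℕ
punch zero    k       = suc k
punch (suc j) zero    = zero
punch (suc j) (suc k) = suc (punch j k)

toℕ-punchIn : ∀ {n} (j : Fin (suc n)) (k : Fin n) → toℕ (punchIn j k) ≡ punch (toℕ j) (toℕ k)
toℕ-punchIn Fin.zero    k           = ≡.refl
toℕ-punchIn (Fin.suc j) Fin.zero    = ≡.refl
toℕ-punchIn (Fin.suc j) (Fin.suc k) = ≡.cong suc (toℕ-punchIn j k)

punch-injective : ∀ j {k l} → punch j k ≡ punch j l → k ≡ l
punch-injective zero                      e = ℕ.suc-injective e
punch-injective (suc j) {zero}  {zero}  e = ≡.refl
punch-injective (suc j) {suc k} {suc l} e = ≡.cong suc (punch-injective j (ℕ.suc-injective e))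

punch≢ : ∀ j k → punch j k ≢ j
punch≢ (suc j) (suc k) e = punch≢ j k (ℕ.suc-injective e)

punch-< : ∀ {j k} → k < j → punch j k ≡ k
punch-< {suc j} {zero}  p       = ≡.refl
punch-< {suc j} {suc k} (s≤s p) = ≡.cong suc (punch-< p)

punch-≥ : ∀ {j k} → j ≤ k → punch j k ≡ suc k
punch-≥ {zero}          p       = ≡.refl
punch-≥ {suc j} {suc k} (s≤s p) = ≡.cong suc (punch-≥ p)

punch-suc : ∀ j k → k ≢ j → punch j k ≡ punch (suc j) k
punch-suc zero    zero    k≢j = contradiction ≡.refl k≢j
punch-suc zero    (suc k) k≢j = ≡.refl
punch-suc (suc j) zero    k≢j = ≡.refl
punch-suc (suc j) (suc k) k≢j = ≡.cong suc (punch-suc j k (k≢j ∘ ≡.cong suc))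

punch≤suc : ∀ j k → punch j k ≤ suc k
punch≤suc zero    k       = ℕ.≤-refl
punch≤suc (suc j) zero    = z≤n
punch≤suc (suc j) (suc k) = s≤s (punch≤suc j k)

punch-surjective : ∀ {n} j t → j ≢ t → j < suc n → t < suc n → ∃[ s ] s < n × punch j s ≡ t
punch-surjective zero    zero    j≢t p q = contradiction ≡.refl j≢t
punch-surjective zero    (suc t) j≢t p (s≤s q) = t , q , ≡.refl
punch-surjective {suc n} (suc j) zero    j≢t p q = 0 , s≤s z≤n , ≡.refl
punch-surjective {zero}  (suc j) t       j≢t (s≤s ()) q
punch-surjective {suc n} (suc j) (suc t) j≢t (s≤s p) (s≤s q)
  with s , s<n , e ← punch-surjective j t (j≢t ∘ ≡.cong suc) p q = suc s , s≤s s<n , ≡.cong suc e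

-- Neighbouring columns that survive the deletion of column j are still neighbours in the minor, so
-- that the induction in `D-alternating` can continue there.
punch-surjective₂ : ∀ {n} j t → j ≢ t → j ≢ suc t → j < suc n → suc t < suc n →
  ∃[ s ] suc s < n × punch j s ≡ t × punch j (suc s) ≡ suc t
punch-surjective₂ zero    zero    j≢t j≢t′ p q = contradiction ≡.refl j≢t
punch-surjective₂ zero    (suc t) j≢t j≢t′ p (s≤s q) = t , q , ≡.refl , ≡.refl
punch-surjective₂ (suc zero)    zero    j≢t j≢t′ p q = contradiction ≡.refl j≢t′
punch-surjective₂ (suc (suc j)) zero    j≢t j≢t′ (s≤s (s≤s p)) (s≤s q) = 0 , ℕ.≤-trans (s≤s (s≤s z≤n)) (s≤s p) , ≡.refl , ≡.refl
punch-surjective₂ {suc n} (suc j) (suc t) j≢t j≢t′ (s≤s p) (s≤s q)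
  with s , s<n , e , e′ ← punch-surjective₂ j t (j≢t ∘ ≡.cong suc) (j≢t′ ∘ ≡.cong suc) p q
  = suc s , s≤s s<n , ≡.cong suc e , ≡.cong suc e′

-- Determinants by expansion along the first row.

module Determinant {r ℓ} (R : CommutativeRing r ℓ) where

  open CommutativeRing R hiding (zero)
  open Algebra.Properties.Semiring.Exp semiring using (_^_)
  open Algebra.Properties.Semiring.Sum semiring
    using (*-distribˡ-sum; ∑-distrib-+; sum-cong-≋; sum-replicate-zero) renaming (sum to ∑)
  open Algebra.Properties.Ring ring using (-1*x≈-x; -‿distribˡ-*)
  open Relation.Binary.Reasoning.Setoid setoid
  open Algebra.Solver.Ring.NaturalCoefficients.Default commutativeSemiring using (solve; _:+_; _:*_; _:=_)

  Matrix : Set r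
  Matrix = ℕ → ℕ → Carrier

  minor : ℕ → Matrix → Matrix
  minor j M i k = M (suc i) (punch j k)

  sign : ℕ → Carrier
  sign j = (- 1#) ^ j

  -- D n M is the determinant of the entries of M with indices below n.

  D : ℕ → Matrix → Carrier

  term : ℕ → Matrix → ℕ → Carrier
  term n M j = sign j * (M 0 j * D n (minor j M))

  D zero    M = 1#
  D (suc n) M = ∑ {suc n} (λ j → term n M (toℕ j))

  ∑-zero : ∀ n (F : ℕ → Carrier) → (∀ i → i < n → F i ≈ 0#) → ∑ {n} (F ∘ toℕ) ≈ 0#
  ∑-zero n F F≈0 = trans (sum-cong-≋ {n} (λ i → F≈0 (toℕ i) (toℕ<n i))) (sum-replicate-zero n)

  ∑-last : ∀ n (F : ℕ → Carrier) → ∑ {suc n} (F ∘ toℕ) ≈ ∑ {n} (F ∘ toℕ) + F n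
  ∑-last zero    F = +-comm _ _
  ∑-last (suc n) F = trans (+-congˡ (∑-last n (F ∘ suc))) (sym (+-assoc _ _ _))

  *-zero₁ : ∀ {x y z} → y ≈ 0# → x * (y * z) ≈ 0#
  *-zero₁ y≈0 = trans (*-congˡ (trans (*-congʳ y≈0) (zeroˡ _))) (zeroʳ _)

  *-zero₂ : ∀ {x y z} → z ≈ 0# → x * (y * z) ≈ 0#
  *-zero₂ z≈0 = trans (*-congˡ (trans (*-congˡ z≈0) (zeroʳ _))) (zeroʳ _)

  D-cong : ∀ n {M M′} → (∀ i j → i < n → j < n → M i j ≈ M′ i j) → D n M ≈ D n M′
  D-cong zero    e = refl
  D-cong (suc n) {M} {M′} e = sum-cong-≋ {n = suc n} λ j → *-congˡ {sign (toℕ j)} (*-cong (e 0 (toℕ j) (s≤s z≤n) (toℕ<n j))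
    (D-cong n (λ i k p q → e (suc i) (punch (toℕ j) k) (s≤s p) (ℕ.≤-<-trans (punch≤suc (toℕ j) k) (s≤s q)))))

  -- In the expansion, the term of column t is linear through its entry, since its minor avoids that
  -- column; every other term is linear through its minor, in which column t has become column s.
  D-linear : ∀ n {t} → t < n → ∀ c {M P Q} →
    (∀ i → M i t ≈ P i t + c * Q i t) →
    (∀ i j → j ≢ t → M i j ≈ P i j) → (∀ i j → j ≢ t → M i j ≈ Q i j) →
    D n M ≈ D n P + c * D n Q
  D-linear (suc n) {t} t<n c {M} {P} {Q} eq eqP eqQ = begin
    ∑ {suc n} (λ j → term n M (toℕ j))                               ≈⟨ sum-cong-≋ {n = suc n} (λ j → termwise (toℕ j) (toℕ<n j)) ⟩
    ∑ {suc n} (λ j → term n P (toℕ j) + c * term n Q (toℕ j))        ≈⟨ ∑-distrib-+ {suc n} (λ j → term n P (toℕ j)) (λ j → c * term n Q (toℕ j)) ⟩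
    D (suc n) P + ∑ {suc n} (λ j → c * term n Q (toℕ j))             ≈⟨ +-congˡ (*-distribˡ-sum {suc n} c (λ j → term n Q (toℕ j))) ⟨
    D (suc n) P + c * D (suc n) Q                                    ∎
    where
    termwise : ∀ j → j < suc n → term n M j ≈ term n P j + c * term n Q j
    termwise j j<n with j ℕ.≟ t
    ... | yes ≡.refl = trans
      (*-congˡ (trans (*-congʳ (eq 0)) (distribʳ _ _ _)))
      (trans (distribˡ _ _ _) (+-cong
        (*-congˡ (*-congˡ (D-cong n (λ i k _ _ → eqP (suc i) (punch j k) (punch≢ j k)))))
        (trans (*-congˡ (trans (*-congˡ (D-cong n (λ i k _ _ → eqQ (suc i) (punch j k) (punch≢ j k)))) (*-assoc _ _ _)))
               (solve 3 (λ s c q → s :* (c :* q) := c :* (s :* q)) refl (sign j) c _))))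
    ... | no j≢t with s , s<n , e ← punch-surjective j t j≢t j<n t<n = begin
      sign j * (M 0 j * D n (minor j M))
        ≈⟨ *-congˡ (*-congˡ (D-linear n s<n c {minor j M} {minor j P} {minor j Q}
             (λ i → ≡.subst (λ u → M (suc i) u ≈ P (suc i) u + c * Q (suc i) u) (≡.sym e) (eq (suc i)))
             (λ i k k≢s → eqP (suc i) (punch j k) (away k≢s))
             (λ i k k≢s → eqQ (suc i) (punch j k) (away k≢s)))) ⟩
      sign j * (M 0 j * (D n (minor j P) + c * D n (minor j Q)))
        ≈⟨ solve 5 (λ s m p c q → s :* (m :* (p :+ c :* q)) := s :* (m :* p) :+ c :* (s :* (m :* q))) refl
             (sign j) (M 0 j) (D n (minor j P)) c (D n (minor j Q)) ⟩
      sign j * (M 0 j * D n (minor j P)) + c * (sign j * (M 0 j * D n (minor j Q)))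
        ≈⟨ +-cong (*-congˡ (*-congʳ (eqP 0 j j≢t))) (*-congˡ (*-congˡ (*-congʳ (eqQ 0 j j≢t)))) ⟩
      term n P j + c * term n Q j ∎
      where
      away : ∀ {k} → k ≢ s → punch j k ≢ t
      away k≢s e′ = k≢s (punch-injective j (≡.trans e′ (≡.sym e)))

  ∑-cancel-pair : ∀ n t → suc t < n → (F : ℕ → Carrier) →
    F t + F (suc t) ≈ 0# → (∀ j → j < n → j ≢ t → j ≢ suc t → F j ≈ 0#) → ∑ {n} (F ∘ toℕ) ≈ 0#
  ∑-cancel-pair (suc (suc n)) zero    p F pair other = begin
    F 0 + (F 1 + ∑ {n} (λ j → F (suc (suc (toℕ j)))))
      ≈⟨ +-assoc _ _ _ ⟨
    F 0 + F 1 + ∑ {n} (λ j → F (suc (suc (toℕ j))))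
      ≈⟨ +-cong pair (∑-zero n (λ j → F (suc (suc j))) (λ j j<n → other (suc (suc j)) (s≤s (s≤s j<n)) (λ ()) (λ ()))) ⟩
    0# + 0#
      ≈⟨ +-identityˡ _ ⟩
    0# ∎
  ∑-cancel-pair (suc n) (suc t) (s≤s p) F pair other = trans
    (+-cong (other 0 (s≤s z≤n) (λ ()) (λ ()))
            (∑-cancel-pair n t p (F ∘ suc) pair
              (λ j j<n j≢t j≢t′ → other (suc j) (s≤s j<n) (j≢t ∘ ℕ.suc-injective) (j≢t′ ∘ ℕ.suc-injective))))
    (+-identityˡ _)

  -- Neighbouring columns suffice, since the column operations only add multiples of the column to
  -- the left. The terms of the two equal columns cancel by their signs, and every other minor still
  -- contains both columns.
  D-alternating : ∀ n {t} → suc t < n → ∀ {M} → (∀ i → M i t ≈ M i (suc t)) → D n M ≈ 0#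
  D-alternating (suc n) {t} t<n {M} eq = ∑-cancel-pair (suc n) t t<n (term n M) pair other
    where
    -- Deleting column t or column t + 1 leaves the same columns, except that index t then shows
    -- column t + 1 or column t, which are equal.
    minors : ∀ i k → minor t M i k ≈ minor (suc t) M i k
    minors i k with k ℕ.≟ t
    ... | no  k≢t = reflexive (≡.cong (M (suc i)) (punch-suc t k k≢t))
    ... | yes ≡.refl = begin
      M (suc i) (punch t t)       ≡⟨ ≡.cong (M (suc i)) (punch-≥ {t} ℕ.≤-refl) ⟩
      M (suc i) (suc t)           ≈⟨ eq (suc i) ⟨
      M (suc i) t                 ≡⟨ ≡.cong (M (suc i)) (punch-< {suc t} ℕ.≤-refl) ⟨
      M (suc i) (punch (suc t) t) ∎
    pair : term n M t + term n M (suc t) ≈ 0#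
    pair = begin
      term n M t + (- 1# * sign t) * (M 0 (suc t) * D n (minor (suc t) M))
        ≈⟨ +-congˡ (*-cong (sym (-1*x≈-x (sign t))) (*-cong (eq 0) (D-cong n (λ i k _ _ → minors i k)))) ⟨
      term n M t + (- sign t) * (M 0 t * D n (minor t M))
        ≈⟨ +-congˡ (-‿distribˡ-* _ _) ⟨
      term n M t + - term n M t
        ≈⟨ -‿inverseʳ _ ⟩
      0# ∎
    other : ∀ j → j < suc n → j ≢ t → j ≢ suc t → term n M j ≈ 0#
    other j j<n j≢t j≢t′ with s , s<n , e , e′ ← punch-surjective₂ j t j≢t j≢t′ j<n t<n =
      *-zero₂ (D-alternating n s<n {minor j M} (λ i → begin
        M (suc i) (punch j s)       ≡⟨ ≡.cong (M (suc i)) e ⟩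
        M (suc i) t                 ≈⟨ eq (suc i) ⟩
        M (suc i) (suc t)           ≡⟨ ≡.cong (M (suc i)) e′ ⟨
        M (suc i) (punch j (suc s)) ∎))

  -- The columns are replaced one at a time, starting with the last.

  D-columnOperations : ∀ n {M M′} (c : ℕ → Carrier) →
    (∀ i → M′ i 0 ≈ M i 0) →
    (∀ i j → suc j < n → M′ i (suc j) ≈ M i (suc j) + c j * M i j) →
    D n M′ ≈ D n M
  D-columnOperations n {M} {M′} c e₀ e₊ = trans
    (D-cong n (λ i j _ _ → sym (mix-≥ 0 i j z≤n)))
    (trans (sweep n ℕ.≤-refl) (D-cong n (λ i j _ q → mix-< n i j q)))
    where
    mix : ℕ → Matrix
    mix t i j = if does (j ℕ.<? t) then M i j else M′ i j
    mix-< : ∀ t i j → j < t → mix t i j ≈ M i j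
    mix-< t i j p = reflexive (≡.cong (if_then M i j else M′ i j) (dec-true (j ℕ.<? t) p))
    mix-≥ : ∀ t i j → t ≤ j → mix t i j ≈ M′ i j
    mix-≥ t i j p = reflexive (≡.cong (if_then M i j else M′ i j) (dec-false (j ℕ.<? t) (ℕ.≤⇒≯ p)))
    mix-≢ : ∀ t i j → j ≢ t → mix t i j ≈ mix (suc t) i j
    mix-≢ t i j j≢t with ℕ.<-≤-connex j t
    ... | inj₁ p = trans (mix-< t i j p) (sym (mix-< (suc t) i j (ℕ.m≤n⇒m≤1+n p)))
    ... | inj₂ p = trans (mix-≥ t i j p) (sym (mix-≥ (suc t) i j (ℕ.≤∧≢⇒< p (j≢t ∘ ≡.sym))))
    step : ∀ t → t < n → D n (mix t) ≈ D n (mix (suc t))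
    step zero    p = D-cong n same
      where
      same : ∀ i j → i < n → j < n → mix 0 i j ≈ mix 1 i j
      same i zero    _ _ = e₀ i
      same i (suc j) _ _ = refl
    step (suc t) p = begin
      D n (mix (suc t))
        ≈⟨ D-linear n p (c t) {mix (suc t)} {mix (suc (suc t))} {Q} new (mix-≢ (suc t)) other ⟩
      D n (mix (suc (suc t))) + c t * D n Q
        ≈⟨ +-congˡ (trans (*-congˡ (D-alternating n p {Q} (λ i → trans (Q-other i) (sym (Q-col i))))) (zeroʳ _)) ⟩
      D n (mix (suc (suc t))) + 0#
        ≈⟨ +-identityʳ _ ⟩
      D n (mix (suc (suc t))) ∎
      where
      -- `Q` carries column t of `M` at both indices t and t + 1, so its determinant vanishes.
      Q : Matrix
      Q i j = if does (j ℕ.≟ suc t) then M i t else mix (suc t) i j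
      Q-col : ∀ i → Q i (suc t) ≈ M i t
      Q-col i = reflexive (≡.cong (if_then M i t else mix (suc t) i (suc t)) (dec-true (suc t ℕ.≟ suc t) ≡.refl))
      other : ∀ i j → j ≢ suc t → mix (suc t) i j ≈ Q i j
      other i j j≢ = sym (reflexive (≡.cong (if_then M i t else mix (suc t) i j) (dec-false (j ℕ.≟ suc t) j≢)))
      Q-other : ∀ i → Q i t ≈ M i t
      Q-other i = trans (sym (other i t (ℕ.<⇒≢ ℕ.≤-refl))) (mix-< (suc t) i t ℕ.≤-refl)
      new : ∀ i → mix (suc t) i (suc t) ≈ mix (suc (suc t)) i (suc t) + c t * Q i (suc t)
      new i = begin
        mix (suc t) i (suc t)                               ≈⟨ mix-≥ (suc t) i (suc t) ℕ.≤-refl ⟩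
        M′ i (suc t)                                        ≈⟨ e₊ i t p ⟩
        M i (suc t) + c t * M i t                           ≈⟨ +-cong (mix-< (suc (suc t)) i (suc t) ℕ.≤-refl) (*-congˡ (Q-col i)) ⟨
        mix (suc (suc t)) i (suc t) + c t * Q i (suc t)     ∎
    sweep : ∀ t → t ≤ n → D n (mix 0) ≈ D n (mix t)
    sweep zero    p = refl
    sweep (suc t) p = trans (sweep t (ℕ.<⇒≤ p)) (step t p)

  -- The first k + 1 rows live in only k columns. A nonzero entry of row 0 lies in one of these
  -- columns; deleting it and row 0 leaves k rows in k - 1 columns.
  D-zeroBlock : ∀ n k → k < n → ∀ {M} → (∀ i j → i ≤ k → k ≤ j → j < n → M i j ≈ 0#) → D n M ≈ 0#
  D-zeroBlock (suc n) zero    p {M} e = ∑-zero (suc n) (term n M) (λ j j<n → *-zero₁ (e 0 j z≤n z≤n j<n))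
  D-zeroBlock (suc n) (suc k) (s≤s p) {M} e = ∑-zero (suc n) (term n M) vanish
    where
    vanish : ∀ j → j < suc n → term n M j ≈ 0#
    vanish j j<n with j ℕ.≤? k
    ... | no  j≰k = *-zero₁ (e 0 j z≤n (ℕ.≰⇒> j≰k) j<n)
    ... | yes j≤k = *-zero₂ (D-zeroBlock n k p {minor j M} λ i l i≤k k≤l l<n →
      e (suc i) (punch j l) (s≤s i≤k)
        (≡.subst (suc k ≤_) (≡.sym (punch-≥ (ℕ.≤-trans j≤k k≤l))) (s≤s k≤l))
        (ℕ.≤-<-trans (punch≤suc j l) (s≤s l<n)))

  D-zeroRow : ∀ n k → k < n → ∀ {M} → (∀ j → j < n → M k j ≈ 0#) → D n M ≈ 0#
  D-zeroRow (suc n) zero    p {M} e = ∑-zero (suc n) (term n M) (λ j j<n → *-zero₁ (e j j<n))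
  D-zeroRow (suc n) (suc k) (s≤s p) {M} e = ∑-zero (suc n) (term n M) λ j j<n → *-zero₂
    (D-zeroRow n k p {minor j M} λ l l<n → e (punch j l) (ℕ.≤-<-trans (punch≤suc j l) (s≤s l<n)))

  -- This lets the matrix of `s` grow from `len μ` to a larger common size. In the expansion along
  -- row 0, the minor that loses the last column has a zero last row, and the other minors again end
  -- in a unit row.
  D-unitRow : ∀ n {M} → (∀ j → j < n → M n j ≈ 0#) → M n n ≈ 1# → D (suc n) M ≈ D n M
  D-unitRow zero    e₀ e₁ = trans (+-identityʳ _) (trans (*-identityˡ _) (trans (*-identityʳ _) e₁))
  D-unitRow (suc n) {M} e₀ e₁ = begin
    ∑ {suc (suc n)} (term (suc n) M ∘ toℕ)
      ≈⟨ ∑-last (suc n) (term (suc n) M) ⟩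
    ∑ {suc n} (term (suc n) M ∘ toℕ) + term (suc n) M (suc n)
      ≈⟨ +-cong (sum-cong-≋ {n = suc n} (λ j → *-congˡ {sign (toℕ j)} (*-congˡ {M 0 (toℕ j)} (shrink (toℕ j) (toℕ<n j)))))
                (*-zero₂ (D-zeroRow (suc n) n ℕ.≤-refl {minor (suc n) M} λ k k<n →
                  trans (reflexive (≡.cong (M (suc n)) (punch-< k<n))) (e₀ k k<n))) ⟩
    ∑ {suc n} (term n M ∘ toℕ) + 0#
      ≈⟨ +-identityʳ _ ⟩
    D (suc n) M ∎
    where
    shrink : ∀ j → j < suc n → D (suc n) (minor j M) ≈ D n (minor j M)
    shrink j (s≤s j≤n) = D-unitRow n {minor j M}
      (λ k k<n → e₀ (punch j k) (ℕ.≤-<-trans (punch≤suc j k) (s≤s k<n)))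
      (trans (reflexive (≡.cong (M (suc n)) (punch-≥ j≤n))) e₁)

  -- In a Heyting field, being apart from 0 amounts to having an inverse. Inverses multiply, so this
  -- form of nonvanishing passes through products over any commutative ring.
  Unit : Carrier → Set _
  Unit u = ∃[ v ] v * u ≈ 1#

  D-unit : ∀ n {M} → (∀ i j → i < j → j < n → M i j ≈ 0#) → (∀ i → i < n → Unit (M i i)) → Unit (D n M)
  D-unit zero    e u = 1# , *-identityˡ _
  D-unit (suc n) {M} e u
    with v , v*M≈1 ← u 0 (s≤s z≤n)
    with w , w*D≈1 ← D-unit n {minor 0 M} (λ i j p q → e (suc i) (suc j) (s≤s p) (s≤s q)) (λ i p → u (suc i) (s≤s p))
    = v * w , (begin
      (v * w) * D (suc n) M
        ≈⟨ *-congˡ (trans (+-congˡ (∑-zero n (term n M ∘ suc) (λ j j<n → *-zero₁ (e 0 (suc j) (s≤s z≤n) (s≤s j<n)))))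
                          (trans (+-identityʳ _) (*-identityˡ _))) ⟩
      (v * w) * (M 0 0 * D n (minor 0 M))
        ≈⟨ solve 4 (λ v w m d → (v :* w) :* (m :* d) := (v :* m) :* (w :* d)) refl v w (M 0 0) (D n (minor 0 M)) ⟩
      (v * M 0 0) * (w * D n (minor 0 M))
        ≈⟨ *-cong v*M≈1 w*D≈1 ⟩
      1# * 1#
        ≈⟨ *-identityˡ _ ⟩
      1# ∎)

-- Products of linear factors, their quotients, and Newton's recursion.

module GeneratingSeries {r ℓ} (R : CommutativeRing r ℓ) where

  open CommutativeRing R hiding (zero)
  open SymmetricFunctions R using (antidiagonal)
  open Determinant R using (Unit)
  open Algebra.Properties.CommutativeSemigroup +-commutativeSemigroup using (interchange)
  open Algebra.Properties.Group +-group using () renaming (⁻¹-involutive to -‿involutive; ∙-cancelʳ to +-cancelʳ)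
  open Algebra.Properties.Ring ring using (-1*x≈-x; -‿distribʳ-*)
  open Algebra.Properties.Semiring.Exp semiring using (_^_)
  open Algebra.Properties.Semiring.Mult semiring using () renaming (_×_ to _×ᴿ_)
  open Algebra.Properties.Semiring.Sum semiring using () renaming (sum to ∑)
  open Relation.Binary.Reasoning.Setoid setoid
  open Algebra.Solver.Ring.NaturalCoefficients.Default commutativeSemiring using (solve; _:+_; _:*_; _:=_)

  Seq : Set r
  Seq = ℕ → Carrier

  infix 4 _≋_

  _≋_ : Seq → Seq → Set ℓ
  S ≋ T = ∀ k → S k ≈ T k

  one : Seq
  one zero    = 1#
  one (suc k) = 0#

  -- A sequence stands for its generating function; mul w multiplies it by
  -- 1 + w t.

  mul : Carrier → Seq → Seq
  mul w S zero    = S zero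
  mul w S (suc k) = S (suc k) + w * S k

  div : Carrier → Seq → Seq
  div w S zero    = S zero
  div w S (suc k) = S (suc k) + (- w) * div w S k

  mulAll : List Carrier → Seq → Seq
  mulAll us S = foldr mul S us

  divAll : List Carrier → Seq → Seq
  divAll []       S = S
  divAll (u ∷ us) S = divAll us (div u S)

  mul-div : ∀ w S → mul w (div w S) ≋ S
  mul-div w S zero    = refl
  mul-div w S (suc k) = begin
    (S (suc k) + (- w) * div w S k) + w * div w S k ≈⟨ +-assoc _ _ _ ⟩
    S (suc k) + ((- w) * div w S k + w * div w S k) ≈⟨ +-congˡ (distribʳ _ _ _) ⟨
    S (suc k) + (- w + w) * div w S k               ≈⟨ +-congˡ (trans (*-congʳ (-‿inverseˡ w)) (zeroˡ _)) ⟩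
    S (suc k) + 0#                                  ≈⟨ +-identityʳ _ ⟩
    S (suc k)                                       ∎

  mul-cong : ∀ w {S T} → S ≋ T → mul w S ≋ mul w T
  mul-cong w e zero    = e zero
  mul-cong w e (suc k) = +-cong (e (suc k)) (*-congˡ (e k))

  -- The constant term of 1 + w t is 1, so the coefficients of a series can be recovered one after
  -- the other from the product. This is the cancellation law by which quotients are compared below.
  mul-injective : ∀ w {S T} → mul w S ≋ mul w T → S ≋ T
  mul-injective w e zero    = e zero
  mul-injective w {S} {T} e (suc k) = +-cancelʳ (w * S k) _ _
    (trans (e (suc k)) (+-congˡ (*-congˡ (sym (mul-injective w e k)))))

  mul-comm : ∀ v w S → mul v (mul w S) ≋ mul w (mul v S)
  mul-comm v w S zero          = refl
  mul-comm v w S (suc zero)    = solve 4 (λ a v w b → (a :+ w :* b) :+ v :* b := (a :+ v :* b) :+ w :* b) refl (S 1) v w (S 0)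
  mul-comm v w S (suc (suc k)) = solve 5 (λ a b c v w → (a :+ w :* b) :+ v :* (b :+ w :* c) := (a :+ v :* b) :+ w :* (b :+ v :* c))
    refl (S (suc (suc k))) (S (suc k)) (S k) v w

  mulAll-cong : ∀ us {S T} → S ≋ T → mulAll us S ≋ mulAll us T
  mulAll-cong []       e = e
  mulAll-cong (u ∷ us) e = mul-cong u (mulAll-cong us e)

  mulAll-injective : ∀ us {S T} → mulAll us S ≋ mulAll us T → S ≋ T
  mulAll-injective []       e = e
  mulAll-injective (u ∷ us) e = mulAll-injective us (mul-injective u e)

  mulAll-++ : ∀ us vs S → mulAll (us ++ vs) S ≡ mulAll us (mulAll vs S)
  mulAll-++ []       vs S = ≡.refl
  mulAll-++ (u ∷ us) vs S = ≡.cong (mul u) (mulAll-++ us vs S)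

  mulAll-↭ : ∀ {us vs} S → us ↭ vs → mulAll us S ≋ mulAll vs S
  mulAll-↭ S ↭.refl            k = refl
  mulAll-↭ S (prep u p)        k = mul-cong u (mulAll-↭ S p) k
  mulAll-↭ S (swap {us} u v p) k = trans (mul-comm u v (mulAll us S) k) (mul-cong v (mul-cong u (mulAll-↭ S p)) k)
  mulAll-↭ S (↭.trans p q)     k = trans (mulAll-↭ S p k) (mulAll-↭ S q k)

  mul-mulAll : ∀ w us S → mul w (mulAll us S) ≋ mulAll us (mul w S)
  mul-mulAll w []       S k = refl
  mul-mulAll w (u ∷ us) S k = trans (mul-comm w u (mulAll us S) k) (mul-cong u (mul-mulAll w us S) k)

  mulAll-comm : ∀ us vs S → mulAll us (mulAll vs S) ≋ mulAll vs (mulAll us S)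
  mulAll-comm []       vs S k = refl
  mulAll-comm (u ∷ us) vs S k = trans (mul-cong u (mulAll-comm us vs S) k) (mul-mulAll u vs (mulAll us S) k)

  mulAll-divAll : ∀ us S → mulAll us (divAll us S) ≋ S
  mulAll-divAll []       S k = refl
  mulAll-divAll (u ∷ us) S k = trans (mul-cong u (mulAll-divAll us (div u S)) k) (mul-div u S k)

  mulAll-0 : ∀ us S → mulAll us S 0 ≈ S 0
  mulAll-0 []       S = refl
  mulAll-0 (u ∷ us) S = mulAll-0 us S

  mulAll-degree : ∀ us k → length us < k → mulAll us one k ≈ 0#
  mulAll-degree []       (suc k) p       = refl
  mulAll-degree (u ∷ us) (suc k) (s≤s p) = trans
    (+-cong (mulAll-degree us (suc k) (ℕ.m≤n⇒m≤1+n p)) (trans (*-congˡ (mulAll-degree us k p)) (zeroʳ u)))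
    (+-identityˡ _)

  -- The coefficient is ∏ (u - w).

  root-unit : ∀ w us {T} → mul w T ≋ mulAll us one → All (λ u → Unit (u - w)) us → Unit (T (length us))
  root-unit w [] {T} e [] = 1# , trans (*-identityˡ _) (e 0)
  root-unit w (u ∷ us) {T} e ((v , v*[u-w]≈1) ∷ units)
    with v′ , v′*T′≈1 ← root-unit w us {div w (mulAll us one)} (mul-div w (mulAll us one)) units
    = v * v′ , (begin
      (v * v′) * T (suc n)
        ≈⟨ *-congˡ (trans (T≋ (suc n)) (+-congʳ T′-step)) ⟩
      (v * v′) * ((- w) * T′ n + u * T′ n)
        ≈⟨ solve 5 (λ v v′ x u t → (v :* v′) :* (x :* t :+ u :* t) := (v :* (u :+ x)) :* (v′ :* t)) refl v v′ (- w) u (T′ n) ⟩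
      (v * (u - w)) * (v′ * T′ n)
        ≈⟨ *-cong v*[u-w]≈1 v′*T′≈1 ⟩
      1# * 1#
        ≈⟨ *-identityˡ _ ⟩
      1# ∎)
    where
    n = length us
    T′ = div w (mulAll us one)
    T≋ : T ≋ mul u T′
    T≋ = mul-injective w λ k → trans (e k) (trans (mul-cong u (λ j → sym (mul-div w (mulAll us one) j)) k) (mul-comm u w T′ k))
    -- Beyond the degree of its numerator, a quotient by 1 + w t continues geometrically with ratio
    -- -w. Multiplying by 1 + u t then produces the factor u - w.
    T′-step : T′ (suc n) ≈ (- w) * T′ n
    T′-step = trans (+-congʳ (mulAll-degree us (suc n) ℕ.≤-refl)) (+-identityˡ _)

  -- Multiplication by tⁱ. The coefficient of degree μᵢ - i + j is read off at the index μᵢ + j of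
  -- the shifted sequence, which gives 0 for negative degrees without integer indices.
  shift : ℕ → Seq → Seq
  shift zero    S k       = S k
  shift (suc i) S zero    = 0#
  shift (suc i) S (suc k) = shift i S k

  shift-mul : ∀ i w S k → shift i (mul w S) (suc k) ≈ shift i S (suc k) + w * shift i S k
  shift-mul zero          w S k       = refl
  shift-mul (suc zero)    w S zero    = sym (trans (+-congˡ (zeroʳ w)) (+-identityʳ _))
  shift-mul (suc (suc i)) w S zero    = sym (trans (+-congˡ (zeroʳ w)) (+-identityʳ _))
  shift-mul (suc i)       w S (suc k) = shift-mul i w S k

  shift-≤ : ∀ i S k → i ≤ k → shift i S k ≡ S (k ℕ.∸ i)
  shift-≤ zero    S k       p       = ≡.refl
  shift-≤ (suc i) S (suc k) (s≤s p) = shift-≤ i S k p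

  shift-> : ∀ i S k → k < i → shift i S k ≡ 0#
  shift-> (suc i) S zero    p       = ≡.refl
  shift-> (suc i) S (suc k) (s≤s p) = shift-> i S k p

  shift-cong : ∀ i {S T} → S ≋ T → shift i S ≋ shift i T
  shift-cong zero    e k       = e k
  shift-cong (suc i) e zero    = refl
  shift-cong (suc i) e (suc k) = shift-cong i e k

  antidiagonal-cong : ∀ n {F G : ℕ → ℕ → Carrier} → (∀ i j → i ℕ.+ j ≡ n → F i j ≈ G i j) → antidiagonal n F ≈ antidiagonal n G
  antidiagonal-cong zero    F≈G = F≈G 0 0 ≡.refl
  antidiagonal-cong (suc n) F≈G = +-cong (F≈G 0 (suc n) ≡.refl) (antidiagonal-cong n (λ i j e → F≈G (suc i) j (≡.cong suc e)))

  antidiagonal-+ : ∀ n F G → antidiagonal n (λ i j → F i j + G i j) ≈ antidiagonal n F + antidiagonal n G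
  antidiagonal-+ zero    F G = refl
  antidiagonal-+ (suc n) F G = trans (+-congˡ (antidiagonal-+ n (F ∘ suc) (G ∘ suc))) (interchange _ _ _ _)

  antidiagonal-* : ∀ n c F → c * antidiagonal n F ≈ antidiagonal n (λ i j → c * F i j)
  antidiagonal-* zero    c F = refl
  antidiagonal-* (suc n) c F = trans (distribˡ c _ _) (+-congˡ (antidiagonal-* n c (F ∘ suc)))

  antidiagonal-last : ∀ n F → antidiagonal (suc n) F ≈ antidiagonal n (λ i j → F i (suc j)) + F (suc n) 0
  antidiagonal-last zero    F = refl
  antidiagonal-last (suc n) F = trans (+-congˡ (antidiagonal-last n (F ∘ suc))) (sym (+-assoc _ _ _))

  antidiagonal-flip : ∀ n F → antidiagonal n F ≈ antidiagonal n (flip F)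
  antidiagonal-flip zero    F = refl
  antidiagonal-flip (suc n) F = trans (antidiagonal-last n F)
    (trans (+-congʳ (antidiagonal-flip n (λ i j → F i (suc j)))) (+-comm _ _))

  ι : ℕ → Carrier
  ι n = n ×ᴿ 1#

  -- t S′(t) = P(t) S(t), where P(t) = ∑ P i tⁱ⁺¹.

  Newton : (ℕ → Carrier) → Seq → Set ℓ
  Newton P S = ∀ k → ι (suc k) * S (suc k) ≈ antidiagonal k (λ i j → P i * S j)

  newton-cong : ∀ {P Q S} → (∀ i → P i ≈ Q i) → Newton P S → Newton Q S
  newton-cong P≈Q newton k = trans (newton k) (antidiagonal-cong k (λ i j _ → *-congʳ (P≈Q i)))

  -- The recursion expresses (k + 1) times a coefficient by earlier ones, and k + 1 can be divided
  -- out. All earlier coefficients are needed, hence the induction on a bound n.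
  newton-unique : (∀ k → Unit (ι (suc k))) → ∀ {P S T} → S 0 ≈ T 0 → Newton P S → Newton P T → S ≋ T
  newton-unique unit {P} {S} {T} e₀ newtonS newtonT k = below k k ℕ.≤-refl
    where
    below : ∀ n j → j ≤ n → S j ≈ T j
    below n       zero    p       = e₀
    below (suc n) (suc j) (s≤s p) with v , v*ι≈1 ← unit j = begin
      S (suc j)                       ≈⟨ *-identityˡ _ ⟨
      1# * S (suc j)                  ≈⟨ *-congʳ v*ι≈1 ⟨
      (v * ι (suc j)) * S (suc j)     ≈⟨ *-assoc _ _ _ ⟩
      v * (ι (suc j) * S (suc j))     ≈⟨ *-congˡ (trans (newtonS j) (trans
        (antidiagonal-cong j (λ i l i+l≡j → *-congˡ (below n l
          (ℕ.≤-trans (ℕ.m≤n+m l i) (ℕ.≤-trans (ℕ.≤-reflexive i+l≡j) p)))))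
        (sym (newtonT j)))) ⟩
      v * (ι (suc j) * T (suc j))     ≈⟨ *-assoc _ _ _ ⟨
      (v * ι (suc j)) * T (suc j)     ≈⟨ *-congʳ v*ι≈1 ⟩
      1# * T (suc j)                  ≈⟨ *-identityˡ _ ⟩
      T (suc j)                       ∎

  -- The coefficients of w / (1 + w t), the logarithmic derivative of 1 + w t.
  alternatingPower : Carrier → ℕ → Carrier
  alternatingPower w i = (- 1#) ^ i * w ^ suc i

  alternatingPower-suc : ∀ w i → alternatingPower w (suc i) ≈ (- w) * alternatingPower w i
  alternatingPower-suc w i = begin
    (- 1# * (- 1#) ^ i) * (w * w ^ suc i)
      ≈⟨ solve 4 (λ m s w p → (m :* s) :* (w :* p) := (m :* w) :* (s :* p)) refl (- 1#) ((- 1#) ^ i) w (w ^ suc i) ⟩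
    (- 1# * w) * alternatingPower w i
      ≈⟨ *-congʳ (-1*x≈-x w) ⟩
    (- w) * alternatingPower w i ∎

  alternatingPower-neg : ∀ x i → alternatingPower (- x) i ≈ - (x ^ suc i)
  alternatingPower-neg x zero    = trans (*-identityˡ _) (trans (*-identityʳ _) (-‿cong (sym (*-identityʳ _))))
  alternatingPower-neg x (suc i) = begin
    alternatingPower (- x) (suc i)  ≈⟨ alternatingPower-suc (- x) i ⟩
    (- - x) * alternatingPower (- x) i ≈⟨ *-cong (-‿involutive x) (alternatingPower-neg x i) ⟩
    x * - (x ^ suc i)               ≈⟨ -‿distribʳ-* _ _ ⟨
    - (x * x ^ suc i)               ∎

  antidiagonal-mul : ∀ k (Q : ℕ → Carrier) w (S : Seq) → antidiagonal (suc k) (λ i j → Q i * mul w S j) ≈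
    antidiagonal (suc k) (λ i j → Q i * S j) + w * antidiagonal k (λ i j → Q i * S j)
  antidiagonal-mul zero    Q w S = solve 5 (λ q q′ w s s′ → q :* (s′ :+ w :* s) :+ q′ :* s := (q :* s′ :+ q′ :* s) :+ w :* (q :* s))
    refl (Q 0) (Q 1) w (S 0) (S 1)
  antidiagonal-mul (suc k) Q w S = trans (+-congˡ (antidiagonal-mul k (Q ∘ suc) w S))
    (solve 6 (λ q w s s′ A B → q :* (s′ :+ w :* s) :+ (A :+ w :* B) := (q :* s′ :+ A) :+ w :* (q :* s :+ B)) refl
      (Q 0) w (S (suc k)) (S (suc (suc k))) _ _)

  antidiagonal-alternatingPower : ∀ k w S → antidiagonal k (λ i j → alternatingPower w i * mul w S j) ≈ w * S k
  antidiagonal-alternatingPower zero    w S = *-congʳ (trans (*-identityˡ _) (*-identityʳ w))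
  antidiagonal-alternatingPower (suc k) w S = begin
    alternatingPower w 0 * mul w S (suc k) + antidiagonal k (λ i j → alternatingPower w (suc i) * mul w S j)
      ≈⟨ +-cong (*-congʳ (trans (*-identityˡ _) (*-identityʳ w)))
                (trans (antidiagonal-cong k (λ i j _ → trans (*-congʳ (alternatingPower-suc w i)) (*-assoc _ _ _)))
                       (sym (antidiagonal-* k (- w) (λ i j → alternatingPower w i * mul w S j)))) ⟩
    w * (S (suc k) + w * S k) + (- w) * antidiagonal k (λ i j → alternatingPower w i * mul w S j)
      ≈⟨ +-congˡ (*-congˡ (antidiagonal-alternatingPower k w S)) ⟩
    w * (S (suc k) + w * S k) + (- w) * (w * S k)
      ≈⟨ trans (+-congʳ (distribˡ _ _ _)) (+-assoc _ _ _) ⟩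
    w * S (suc k) + (w * (w * S k) + (- w) * (w * S k))
      ≈⟨ +-congˡ (trans (sym (distribʳ _ _ _)) (trans (*-congʳ (-‿inverseʳ w)) (zeroˡ _))) ⟩
    w * S (suc k) + 0#
      ≈⟨ +-identityʳ _ ⟩
    w * S (suc k) ∎

  -- Logarithmic derivatives of products add up.
  newton-mul : ∀ w {P : ℕ → Carrier} {S} → Newton P S → Newton (λ i → P i + alternatingPower w i) (mul w S)
  newton-mul w {P} {S} newton k = begin
    ι (suc k) * (S (suc k) + w * S k)
      ≈⟨ main k ⟩
    antidiagonal k (λ i j → P i * mul w S j) + w * S k
      ≈⟨ +-congˡ (antidiagonal-alternatingPower k w S) ⟨
    antidiagonal k (λ i j → P i * mul w S j) + antidiagonal k (λ i j → alternatingPower w i * mul w S j)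
      ≈⟨ antidiagonal-+ k (λ i j → P i * mul w S j) (λ i j → alternatingPower w i * mul w S j) ⟨
    antidiagonal k (λ i j → P i * mul w S j + alternatingPower w i * mul w S j)
      ≈⟨ antidiagonal-cong k (λ i j _ → distribʳ _ _ _) ⟨
    antidiagonal k (λ i j → (P i + alternatingPower w i) * mul w S j) ∎
    where
    -- The product rule: t times the derivative of (1 + w t) S is (1 + w t) P S + w t S.
    main : ∀ k → ι (suc k) * (S (suc k) + w * S k) ≈ antidiagonal k (λ i j → P i * mul w S j) + w * S k
    main zero    = begin
      ι 1 * (S 1 + w * S 0)            ≈⟨ distribˡ _ _ _ ⟩
      ι 1 * S 1 + ι 1 * (w * S 0)      ≈⟨ +-cong (newton 0) (trans (*-congʳ (+-identityʳ _)) (*-identityˡ _)) ⟩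
      P 0 * S 0 + w * S 0              ∎
    main (suc k) = begin
      (1# + ι (suc k)) * (S (2 ℕ.+ k) + w * S (suc k))
        ≈⟨ solve 5 (λ o i s w t → (o :+ i) :* (s :+ w :* t) := ((o :+ i) :* s :+ w :* (i :* t)) :+ w :* (o :* t))
             refl 1# (ι (suc k)) (S (2 ℕ.+ k)) w (S (suc k)) ⟩
      ((1# + ι (suc k)) * S (2 ℕ.+ k) + w * (ι (suc k) * S (suc k))) + w * (1# * S (suc k))
        ≈⟨ +-cong (+-cong (newton (suc k)) (*-congˡ (newton k))) (*-congˡ (*-identityˡ _)) ⟩
      (antidiagonal (suc k) (λ i j → P i * S j) + w * antidiagonal k (λ i j → P i * S j)) + w * S (suc k)
        ≈⟨ +-congʳ (antidiagonal-mul k P w S) ⟨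
      antidiagonal (suc k) (λ i j → P i * mul w S j) + w * S (suc k) ∎

  newton-one : Newton (λ _ → 0#) one
  newton-one k = trans (zeroʳ _) (sym vanish)
    where
    vanish : antidiagonal k (λ i j → 0# * one j) ≈ 0#
    vanish = trans (sym (antidiagonal-* k 0# (λ i j → one j))) (zeroˡ _)

  newton-mulAll : ∀ {d} (y : Vector Carrier d) {P S} → Newton P S →
    Newton (λ i → P i + ∑ (λ j → alternatingPower (y j) i)) (mulAll (List.tabulate y) S)
  newton-mulAll {zero}  y newton = newton-cong (λ i → sym (+-identityʳ _)) newton
  newton-mulAll {suc d} y newton = newton-cong (λ i → trans (+-assoc _ _ _) (+-congˡ (+-comm _ _)))
    (newton-mul (y Fin.zero) (newton-mulAll (y ∘ Fin.suc) newton))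

-- Newton's identities in the ring of symmetric functions and under evaluation.

module SymmetricFunctionsProperties {r ℓ} (R : CommutativeRing r ℓ) where

  open CommutativeRing R hiding (zero)
  open SymmetricFunctions R
  open SymmetricFunctions Λ-commutativeRing using () renaming (antidiagonal to antidiagonalΛ)
  open Determinant R using (Unit)
  open GeneratingSeries R
  open Algebra.Properties.Semiring.Exp semiring using (_^_)
  open Algebra.Properties.Semiring.Mult semiring using (×-homo-+)
  open Algebra.Properties.Semiring.Sum semiring
    using (*-distribˡ-sum; ∑-distrib-+; sum-cong-≋; sum-replicate-zero) renaming (sum to ∑)
  open Algebra.Properties.CommutativeSemigroup +-commutativeSemigroup using (xy∙z≈xz∙y)
  open Relation.Binary.Reasoning.Setoid setoid

  𝟙-⇔ : ∀ {p q} {P : Set p} {Q : Set q} (P? : Dec P) (Q? : Dec Q) → P ⇔ Q → 𝟙 P? ≈ 𝟙 Q?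
  𝟙-⇔ P? Q? e = reflexive (≡.cong (if_then 1# else 0#) (does-⇔ e P? Q?))

  𝟙-× : ∀ {p q} {P : Set p} {Q : Set q} (P? : Dec P) (Q? : Dec Q) → 𝟙 (P? ×-dec Q?) ≈ 𝟙 P? * 𝟙 Q?
  𝟙-× (yes _) Q? = sym (*-identityˡ _)
  𝟙-× (no _)  Q? = sym (zeroˡ _)

  antidiagonal-zero : ∀ n {F : ℕ → ℕ → Carrier} → (∀ i j → F i j ≈ 0#) → antidiagonal n F ≈ 0#
  antidiagonal-zero zero    F≈0 = F≈0 0 0
  antidiagonal-zero (suc n) F≈0 = trans (+-cong (F≈0 0 (suc n)) (antidiagonal-zero n (λ i j → F≈0 (suc i) j))) (+-identityˡ _)

  antidiagonal-const : ∀ n c → antidiagonal n (λ _ _ → c) ≈ ι (suc n) * c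
  antidiagonal-const zero    c = sym (trans (*-congʳ (+-identityʳ _)) (*-identityˡ c))
  antidiagonal-const (suc n) c = trans (+-cong (sym (*-identityˡ c)) (antidiagonal-const n c)) (sym (distribʳ _ _ _))

  antidiagonal-interchange : ∀ m n (F : ℕ → ℕ → ℕ → ℕ → Carrier) →
    antidiagonal m (λ i j → antidiagonal n (F i j)) ≈ antidiagonal n (λ k l → antidiagonal m (λ i j → F i j k l))
  antidiagonal-interchange zero    n F = refl
  antidiagonal-interchange (suc m) n F = trans (+-congˡ (antidiagonal-interchange m n (F ∘ suc)))
    (sym (antidiagonal-+ n (F 0 (suc m)) (λ k l → antidiagonal m (λ i j → F (suc i) j k l))))

  antidiagonal-𝟙 : ∀ k m n → antidiagonal k (λ i j → 𝟙 (m ℕ.≟ i) * 𝟙 (n ℕ.≟ j)) ≈ 𝟙 (m ℕ.+ n ℕ.≟ k)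
  antidiagonal-𝟙 zero    zero    n = *-identityˡ _
  antidiagonal-𝟙 zero    (suc m) n = zeroˡ _
  antidiagonal-𝟙 (suc k) zero    n = trans (+-cong (*-identityˡ _) (antidiagonal-zero k (λ i j → zeroˡ _))) (+-identityʳ _)
  antidiagonal-𝟙 (suc k) (suc m) n = trans (+-cong (zeroˡ _) (antidiagonal-𝟙 k m n)) (+-identityˡ _)

  ⊛-cong : ∀ {f f′ g g′} → (∀ α → f α ≈ f′ α) → (∀ α → g α ≈ g′ α) → ∀ α → (f ⊛ g) α ≈ (f′ ⊛ g′) α
  ⊛-cong p q []      = *-cong (p []) (q [])
  ⊛-cong p q (a ∷ α) = antidiagonal-cong a (λ i j _ → ⊛-cong (p ∘ (i ∷_)) (q ∘ (j ∷_)) α)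

  ⊛-constant : ∀ c {f} g → (∀ α → f α ≈ c * coeff 1Λ α) → ∀ α → (f ⊛ g) α ≈ c * g α
  ⊛-constant c g e []          = *-congʳ (trans (e []) (*-identityʳ c))
  ⊛-constant c g e (zero ∷ α)  = ⊛-constant c (g ∘ (0 ∷_)) (e ∘ (0 ∷_)) α
  ⊛-constant c g e (suc a ∷ α) = trans
    (+-cong (⊛-constant c (g ∘ (suc a ∷_)) (e ∘ (0 ∷_)) α)
            -- A positive exponent has coefficient 0 in a constant series, so the same statement
            -- applies with the constant 0.
            (antidiagonal-zero a λ i j → trans
              (⊛-constant 0# (g ∘ (j ∷_)) (λ β → trans (e (suc i ∷ β)) (trans (zeroʳ c) (sym (zeroˡ _)))) α) (zeroˡ _)))
    (+-identityʳ _)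

  -- A monomial of a power sum involves a single variable. If the first variable occurs, it carries
  -- the whole exponent and the others are absent.
  coeff-𝐩-suc : ∀ i m α → coeff (𝐩 (suc i)) (suc m ∷ α) ≈ 𝟙 (m ℕ.≟ i) * coeff 1Λ α
  coeff-𝐩-suc i m α = trans
    (𝟙-⇔ (sum (suc m ∷ α) ℕ.≟ suc i ×-dec _∈?_ ℕ._≟_ (suc i) (suc m ∷ α)) (m ℕ.≟ i ×-dec sum α ℕ.≟ 0)
      (mk⇔ (λ (e , i∈) → only (ℕ.suc-injective e) i∈)
           (λ { (≡.refl , e) → ≡.trans (≡.cong (suc m ℕ.+_) e) (ℕ.+-identityʳ _) , here ≡.refl })))
    (𝟙-× (m ℕ.≟ i) (sum α ℕ.≟ 0))
    where
    ∈⇒≤ : ∀ {n β} → n ∈ β → n ≤ sum β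
    ∈⇒≤ {β = b ∷ β} (here ≡.refl) = ℕ.m≤m+n b (sum β)
    ∈⇒≤ {β = b ∷ β} (there n∈)    = ℕ.≤-trans (∈⇒≤ n∈) (ℕ.m≤n+m (sum β) b)
    only : m ℕ.+ sum α ≡ i → suc i ∈ suc m ∷ α → m ≡ i × sum α ≡ 0
    only e (here e′) = ≡.sym m≡i , ℕ.+-cancelˡ-≡ m (sum α) 0 (≡.trans e (≡.trans m≡i (≡.sym (ℕ.+-identityʳ m))))
      where m≡i = ℕ.suc-injective e′
    only e (there i∈) = contradiction (ℕ.≤-trans (∈⇒≤ i∈) (ℕ.m≤n+m (sum α) m)) (ℕ.<⇒≱ (s≤s (ℕ.≤-reflexive e)))

  -- Newton's identity is the case s = 0; the offset allows an induction on α.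

  coeff-newton : ∀ k s α → antidiagonal k (λ i j → (coeff (𝐩 (suc i)) ⊛ (λ β → 𝟙 (s ℕ.+ sum β ℕ.≟ j))) α) ≈
    ι (sum α) * 𝟙 (s ℕ.+ sum α ℕ.≟ suc k)
  coeff-newton k s []         = trans (antidiagonal-zero k (λ i j → zeroˡ _)) (sym (zeroˡ _))
  coeff-newton k s (zero ∷ α) = trans
    (antidiagonal-cong k (λ i j _ → ⊛-cong (coeff-0 (𝐩 (suc i))) (λ β → refl) α)) (coeff-newton k s α)
  coeff-newton k s (suc a ∷ α) = begin
    antidiagonal k (λ i j → (coeff (𝐩 (suc i)) ∘ (0 ∷_) ⊛ G j (suc a)) α
      + antidiagonal a (λ m c → (coeff (𝐩 (suc i)) ∘ (suc m ∷_) ⊛ G j c) α))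
      ≈⟨ antidiagonal-+ k (λ i j → (coeff (𝐩 (suc i)) ∘ (0 ∷_) ⊛ G j (suc a)) α) _ ⟩
    antidiagonal k (λ i j → (coeff (𝐩 (suc i)) ∘ (0 ∷_) ⊛ G j (suc a)) α)
      + antidiagonal k (λ i j → antidiagonal a (λ m c → (coeff (𝐩 (suc i)) ∘ (suc m ∷_) ⊛ G j c) α))
      ≈⟨ +-cong first second ⟩
    ι (sum α) * 𝟙 (s ℕ.+ (suc a ℕ.+ sum α) ℕ.≟ suc k) + ι (suc a) * 𝟙 (s ℕ.+ (suc a ℕ.+ sum α) ℕ.≟ suc k)
      ≈⟨ distribʳ _ _ _ ⟨
    (ι (sum α) + ι (suc a)) * 𝟙 (s ℕ.+ (suc a ℕ.+ sum α) ℕ.≟ suc k)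
      ≈⟨ *-congʳ (trans (+-comm _ _) (sym (×-homo-+ 1# (suc a) (sum α)))) ⟩
    ι (suc a ℕ.+ sum α) * 𝟙 (s ℕ.+ (suc a ℕ.+ sum α) ℕ.≟ suc k) ∎
    where
    G : ℕ → ℕ → Series
    G j c β = 𝟙 (s ℕ.+ (c ℕ.+ sum β) ℕ.≟ j)
    -- The power sum takes nothing from the first variable, whose exponent a + 1 goes into the
    -- offset of the complete function.
    first : antidiagonal k (λ i j → (coeff (𝐩 (suc i)) ∘ (0 ∷_) ⊛ G j (suc a)) α) ≈
            ι (sum α) * 𝟙 (s ℕ.+ (suc a ℕ.+ sum α) ℕ.≟ suc k)
    first = begin
      antidiagonal k (λ i j → (coeff (𝐩 (suc i)) ∘ (0 ∷_) ⊛ G j (suc a)) α)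
        ≈⟨ antidiagonal-cong k (λ i j _ → ⊛-cong (coeff-0 (𝐩 (suc i)))
             (λ β → reflexive (≡.cong (λ n → 𝟙 (n ℕ.≟ j)) (≡.sym (ℕ.+-assoc s (suc a) (sum β))))) α) ⟩
      antidiagonal k (λ i j → (coeff (𝐩 (suc i)) ⊛ (λ β → 𝟙 (s ℕ.+ suc a ℕ.+ sum β ℕ.≟ j))) α)
        ≈⟨ coeff-newton k (s ℕ.+ suc a) α ⟩
      ι (sum α) * 𝟙 (s ℕ.+ suc a ℕ.+ sum α ℕ.≟ suc k)
        ≡⟨ ≡.cong (λ n → ι (sum α) * 𝟙 (n ℕ.≟ suc k)) (ℕ.+-assoc s (suc a) (sum α)) ⟩
      ι (sum α) * 𝟙 (s ℕ.+ (suc a ℕ.+ sum α) ℕ.≟ suc k) ∎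
    total : ∀ m c → m ℕ.+ c ≡ a → suc (m ℕ.+ (s ℕ.+ (c ℕ.+ sum α))) ≡ s ℕ.+ (suc a ℕ.+ sum α)
    total m c ≡.refl = let open Data.Nat.Solver.+-*-Solver in
      solve 4 (λ m s c n → con 1 :+ (m :+ (s :+ (c :+ n))) := s :+ (con 1 :+ (m :+ c) :+ n)) ≡.refl m s c (sum α)
    -- The power sum is taken from the first variable. For each of the a + 1 splittings of a into m
    -- + c only i = m contributes, which accounts for the factor a + 1.
    second : antidiagonal k (λ i j → antidiagonal a (λ m c → (coeff (𝐩 (suc i)) ∘ (suc m ∷_) ⊛ G j c) α)) ≈
             ι (suc a) * 𝟙 (s ℕ.+ (suc a ℕ.+ sum α) ℕ.≟ suc k)
    second = begin
      antidiagonal k (λ i j → antidiagonal a (λ m c → (coeff (𝐩 (suc i)) ∘ (suc m ∷_) ⊛ G j c) α))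
        ≈⟨ antidiagonal-cong k (λ i j _ → antidiagonal-cong a (λ m c _ →
             ⊛-constant (𝟙 (m ℕ.≟ i)) (G j c) (coeff-𝐩-suc i m) α)) ⟩
      antidiagonal k (λ i j → antidiagonal a (λ m c → 𝟙 (m ℕ.≟ i) * G j c α))
        ≈⟨ antidiagonal-interchange k a (λ i j m c → 𝟙 (m ℕ.≟ i) * G j c α) ⟩
      antidiagonal a (λ m c → antidiagonal k (λ i j → 𝟙 (m ℕ.≟ i) * G j c α))
        ≈⟨ antidiagonal-cong a (λ m c m+c≡a → trans (antidiagonal-𝟙 k m (s ℕ.+ (c ℕ.+ sum α)))
             (reflexive (≡.cong (λ n → 𝟙 (n ℕ.≟ suc k)) (total m c m+c≡a)))) ⟩
      antidiagonal a (λ m c → 𝟙 (s ℕ.+ (suc a ℕ.+ sum α) ℕ.≟ suc k))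
        ≈⟨ antidiagonal-const a _ ⟩
      ι (suc a) * 𝟙 (s ℕ.+ (suc a ℕ.+ sum α) ℕ.≟ suc k) ∎

  coeff-antidiagonalΛ : ∀ k F α → coeff (antidiagonalΛ k F) α ≈ antidiagonal k (λ i j → coeff (F i j) α)
  coeff-antidiagonalΛ zero    F α = refl
  coeff-antidiagonalΛ (suc k) F α = +-congˡ (coeff-antidiagonalΛ k (F ∘ suc) α)

  𝐡-newton : ∀ k → ι (suc k) · 𝐡 (suc k) ≈Λ antidiagonalΛ k (λ i j → 𝐩 (suc i) *Λ 𝐡 j)
  𝐡-newton k α = begin
    ι (suc k) * 𝟙 (sum α ℕ.≟ suc k)
      ≈⟨ degree (sum α ℕ.≟ suc k) ⟩
    ι (sum α) * 𝟙 (sum α ℕ.≟ suc k)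
      ≈⟨ coeff-newton k 0 α ⟨
    antidiagonal k (λ i j → coeff (𝐩 (suc i) *Λ 𝐡 j) α)
      ≈⟨ coeff-antidiagonalΛ k (λ i j → 𝐩 (suc i) *Λ 𝐡 j) α ⟨
    coeff (antidiagonalΛ k (λ i j → 𝐩 (suc i) *Λ 𝐡 j)) α ∎
    where
    degree : ∀ {n} (d : Dec (n ≡ suc k)) → ι (suc k) * 𝟙 d ≈ ι n * 𝟙 d
    degree (yes ≡.refl) = refl
    degree (no  _)      = trans (zeroʳ _) (sym (zeroʳ _))

  module EvaluationProperties {d} {x y : Vector Carrier d} (ev : Evaluation x y) where

    open Evaluation ev

    H : Seq
    H k = ⟦ 𝐡 k ⟧

    powerSum : ℕ → Carrier
    powerSum i = ∑ (λ j → x j ^ suc i) + ∑ (λ j → alternatingPower (y j) i)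

    ⟦antidiagonal⟧ : ∀ k F → ⟦ antidiagonalΛ k F ⟧ ≈ antidiagonal k (λ i j → ⟦ F i j ⟧)
    ⟦antidiagonal⟧ zero    F = refl
    ⟦antidiagonal⟧ (suc k) F = trans (+-homo _ _) (+-congˡ (⟦antidiagonal⟧ k (F ∘ suc)))

    H-newton : Newton powerSum H
    H-newton k = begin
      ι (suc k) * ⟦ 𝐡 (suc k) ⟧                                   ≈⟨ ·-homo _ _ ⟨
      ⟦ ι (suc k) · 𝐡 (suc k) ⟧                                   ≈⟨ ⟦⟧-cong (𝐡-newton k) ⟩
      ⟦ antidiagonalΛ k (λ i j → 𝐩 (suc i) *Λ 𝐡 j) ⟧              ≈⟨ ⟦antidiagonal⟧ k _ ⟩
      antidiagonal k (λ i j → ⟦ 𝐩 (suc i) *Λ 𝐡 j ⟧)               ≈⟨ antidiagonal-cong k (λ i j _ → *-homo _ _) ⟩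
      antidiagonal k (λ i j → ⟦ 𝐩 (suc i) ⟧ * H j)
        ≈⟨ antidiagonal-cong k (λ i j _ → *-congʳ (trans (⟦𝐩⟧ (suc i))
             (+-congˡ (*-distribˡ-sum ((- 1#) ^ i) (λ j → y j ^ suc i))))) ⟩
      antidiagonal k (λ i j → powerSum i * H j)                   ∎

    -- Both sides satisfy Newton's recursion for the power sums of y alone: the factor 1 - xⱼ t
    -- removes the powers of xⱼ from the logarithmic derivative of `H`.
    H-generating : (∀ k → Unit (ι (suc k))) → mulAll (List.tabulate (-_ ∘ x)) H ≋ mulAll (List.tabulate y) one
    H-generating unit = newton-unique unit
      (trans (mulAll-0 (List.tabulate (-_ ∘ x)) H) (trans 1#-homo (sym (mulAll-0 (List.tabulate y) one))))
      (newton-cong cancel (newton-mulAll (-_ ∘ x) H-newton))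
      (newton-cong (λ i → +-identityˡ _) (newton-mulAll y newton-one))
      where
      cancel : ∀ i → powerSum i + ∑ (λ j → alternatingPower (- x j) i) ≈ ∑ (λ j → alternatingPower (y j) i)
      cancel i = begin
        (∑ (λ j → x j ^ suc i) + Y) + ∑ (λ j → alternatingPower (- x j) i)
          ≈⟨ xy∙z≈xz∙y _ _ _ ⟩
        (∑ (λ j → x j ^ suc i) + ∑ (λ j → alternatingPower (- x j) i)) + Y
          ≈⟨ +-congʳ (∑-distrib-+ {d} (λ j → x j ^ suc i) (λ j → alternatingPower (- x j) i)) ⟨
        ∑ (λ j → x j ^ suc i + alternatingPower (- x j) i) + Y
          ≈⟨ +-congʳ (trans (sum-cong-≋ (λ j → trans (+-congˡ (alternatingPower-neg (x j) i)) (-‿inverseʳ _)))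
                            (sum-replicate-zero d)) ⟩
        0# + Y
          ≈⟨ +-identityˡ _ ⟩
        Y ∎
        where Y = ∑ (λ j → alternatingPower (y j) i)

-- Beta-numbers and Frobenius coordinates of a diagram.

module Diagrams where

  open import Data.Nat.Base using (_+_)
  open import Data.Nat.Properties hiding (_≟_)
  open Permutation using (shift)
  open ≡ using (refl; sym; trans; cong; cong₂; subst; ≢-sym; setoid)

  module _ {a} {A : Set a} where

    ∈-∷⁻ : ∀ {x z : A} {ws} → z ≢ x → z ∈ x ∷ ws → z ∈ ws
    ∈-∷⁻ z≢x (here z≡x) = contradiction z≡x z≢x
    ∈-∷⁻ z≢x (there m)  = m

    -- Inclusions of sets of numbers are turned into permutations of lists, the form in which common
    -- factors of products are split off.
    complement : ∀ {xs ys : List A} → Unique xs → (∀ {x} → x ∈ xs → x ∈ ys) → ∃[ zs ] ys ↭ xs ++ zs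
    complement {[]}     {ys} []        xs⊆ys = ys , ↭-refl
    complement {x ∷ xs} {ys} (x∉ ∷ u) xs⊆ys
      with as , bs , refl ← ∈-∃++ (xs⊆ys (here refl))
      with zs , p ← complement {xs} {as ++ bs} u
             (λ m → ∈-∷⁻ (≢-sym (All.lookup x∉ m)) (∈-resp-↭ (shift x as bs) (xs⊆ys (there m))))
      = zs , ↭-trans (shift x as bs) (prep x p)

    unique-↭ : ∀ {xs ys : List A} → Unique xs → (∀ {x} → x ∈ xs → x ∈ ys) → length xs ≡ length ys → ys ↭ xs
    unique-↭ {xs} {ys} u xs⊆ys e with complement u xs⊆ys
    ... | []     , p = ↭-trans p (↭-reflexive (++-identityʳ xs))
    ... | z ∷ zs , p = contradiction
      (trans (+-identityʳ _) (trans e (trans (↭-length p) (length-++ xs))))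
      (λ e′ → 0≢1+n (+-cancelˡ-≡ (length xs) 0 (suc (length zs)) e′))

    applyUpTo-++ : ∀ (f : ℕ → A) m n → applyUpTo f (m + n) ≡ applyUpTo f m ++ applyUpTo (λ i → f (m + i)) n
    applyUpTo-++ f zero    n = refl
    applyUpTo-++ f (suc m) n = cong (f 0 ∷_) (applyUpTo-++ (f ∘ suc) m n)

    -- `col` and `diagonal` count the solutions of conditions that, once false along a decreasing
    -- sequence, remain false. The solutions thus form an initial segment, and comparing an index
    -- with the count decides the condition.
    module InitialSegment {p} {P : A → Set p} (P? : Decidable P) where

      count : (ℕ → A) → ℕ → ℕ
      count f n = length (filter P? (applyUpTo f n))

      ¬⇒count≡0 : ∀ {f : ℕ → A} n → (∀ i → ¬ P (f i)) → count f n ≡ 0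
      ¬⇒count≡0 zero    ¬P = refl
      ¬⇒count≡0 {f} (suc n) ¬P with P? (f 0)
      ... | yes p = contradiction p (¬P 0)
      ... | no  _ = ¬⇒count≡0 {f ∘ suc} n (¬P ∘ suc)

      all-¬ : ∀ {f : ℕ → A} → (∀ i → P (f (suc i)) → P (f i)) → ¬ P (f 0) → ∀ i → ¬ P (f i)
      all-¬ closed ¬p zero    = ¬p
      all-¬ {f} closed ¬p (suc i) = all-¬ {f} closed ¬p i ∘ closed i

      <count⇒ : ∀ {f : ℕ → A} n → (∀ i → P (f (suc i)) → P (f i)) → ∀ {i} → i < count f n → P (f i)
      <count⇒ {f} (suc n) closed i< with P? (f 0)
      <count⇒ {f} (suc n) closed {zero}  i<       | yes p = p
      <count⇒ {f} (suc n) closed {suc i} (s≤s i<) | yes p = <count⇒ {f ∘ suc} n (closed ∘ suc) i<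
      <count⇒ {f} (suc n) closed {i}     i<       | no ¬p =
        contradiction (subst (i <_) (¬⇒count≡0 {f ∘ suc} n (all-¬ {f} closed ¬p ∘ suc)) i<) n≮0

      ⇒<count : ∀ {f : ℕ → A} n → (∀ i → P (f (suc i)) → P (f i)) → ∀ {i} → i < n → P (f i) → i < count f n
      ⇒<count {f} (suc n) closed i<n Pi with P? (f 0)
      ⇒<count {f} (suc n) closed {zero}  i<n       Pi | yes p = s≤s z≤n
      ⇒<count {f} (suc n) closed {suc i} (s≤s i<n) Pi | yes p = s≤s (⇒<count {f ∘ suc} n (closed ∘ suc) i<n Pi)
      ⇒<count {f} (suc n) closed {i}     i<n       Pi | no ¬p = contradiction Pi (all-¬ {f} closed ¬p i)

  ∸-suc-< : ∀ {j N} → j < N → N ∸ j ≡ suc (N ∸ suc j)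
  ∸-suc-< {zero}  {suc N} p       = refl
  ∸-suc-< {suc j} {suc N} (s≤s p) = ∸-suc-< p

  downFrom-top : ∀ N j → j ≤ N → downFrom N ↭ applyDownFrom (λ s → N ∸ suc s) j ++ downFrom (N ∸ j)
  downFrom-top N zero    p = ↭-refl
  downFrom-top N (suc j) p = ↭-trans (downFrom-top N j (<⇒≤ p))
    (↭-trans (↭-reflexive (cong (λ n → applyDownFrom (λ s → N ∸ suc s) j ++ downFrom n) (∸-suc-< p)))
             (shift (N ∸ suc j) (applyDownFrom (λ s → N ∸ suc s) j) (downFrom (N ∸ suc j))))

  downFrom-+ : ∀ p k → downFrom (p + k) ↭ applyUpTo (λ s → p + s) k ++ downFrom p
  downFrom-+ p zero    = ↭-reflexive (cong downFrom (+-identityʳ p))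
  downFrom-+ p (suc k) = ↭-trans (↭-reflexive (cong downFrom (+-suc p k)))
    (↭-trans (prep (p + k) (downFrom-+ p k))
    (↭-trans (↭-sym (shift (p + k) (applyUpTo (λ s → p + s) k) (downFrom p)))
    (↭-reflexive (trans (sym (++-assoc (applyUpTo (λ s → p + s) k) [ p + k ] (downFrom p)))
                        (cong (_++ downFrom p) (applyUpTo-∷ʳ (λ s → p + s) k))))))

  entry-antitone : ∀ {ls} → AllPairs _≥_ ls → ∀ i → entry ls (suc i) ≤ entry ls i
  entry-antitone []        i       = z≤n
  entry-antitone (_ ∷ [])  zero    = z≤n
  entry-antitone ((p ∷ _) ∷ (_ ∷ _)) zero = p
  entry-antitone (_ ∷ ps)  (suc i) = entry-antitone ps i

  entry-0 : ∀ ls {i} → length ls ≤ i → entry ls i ≡ 0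
  entry-0 []       p       = refl
  entry-0 (l ∷ ls) (s≤s p) = entry-0 ls p

  applyUpTo-entry : ∀ ls → applyUpTo (entry ls) (length ls) ≡ ls
  applyUpTo-entry []       = refl
  applyUpTo-entry (l ∷ ls) = cong (l ∷_) (applyUpTo-entry ls)

  row-suc : ∀ μ i → row μ (suc i) ≤ row μ i
  row-suc μ = entry-antitone (Linked⇒AllPairs (λ p q → ≤-trans q p) (proj₁ (partition-proof μ)))

  row-antitone : ∀ μ {i j} → i ≤ j → row μ j ≤ row μ i
  row-antitone μ {i} {zero}  z≤n = ≤-refl
  row-antitone μ {i} {suc j} i≤j with m≤n⇒m<n∨m≡n i≤j
  ... | inj₂ refl    = ≤-refl
  ... | inj₁ (s≤s p) = ≤-trans (row-suc μ j) (row-antitone μ p)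

  row>0⇒<len : ∀ μ {i} → 0 < row μ i → i < len μ
  row>0⇒<len μ {i} p with i <? len μ
  ... | yes q = q
  ... | no ¬q = contradiction (subst (0 <_) (entry-0 (parts μ) (≮⇒≥ ¬q)) p) n≮0

  module _ (μ : Partition) (j : ℕ) where

    private
      open InitialSegment (suc j ≤?_)
      closed : ∀ i → suc j ≤ row μ (suc i) → suc j ≤ row μ i
      closed i p = ≤-trans p (row-suc μ i)
      col≡count : col μ j ≡ count (row μ) (len μ)
      col≡count = cong (length ∘ filter (suc j ≤?_)) (sym (applyUpTo-entry (parts μ)))

    <col⇒<row : ∀ {i} → i < col μ j → j < row μ i
    <col⇒<row {i} p = <count⇒ {row μ} (len μ) closed (subst (i <_) col≡count p)

    <row⇒<col : ∀ {i} → j < row μ i → i < col μ j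
    <row⇒<col {i} p = subst (i <_) (sym col≡count)
      (⇒<count {row μ} (len μ) closed (row>0⇒<len μ (≤-trans (s≤s z≤n) p)) p)

    col≤len : col μ j ≤ len μ
    col≤len = length-filter (suc j ≤?_) (parts μ)

  module _ (μ : Partition) where

    private
      open InitialSegment (λ i → suc i ≤? row μ i)
      closed : ∀ i → suc (suc i) ≤ row μ (suc i) → suc i ≤ row μ i
      closed i p = ≤-trans (<⇒≤ p) (row-suc μ i)

    <diagonal⇒<row : ∀ {i} → i < diagonal μ → i < row μ i
    <diagonal⇒<row p = <count⇒ {id} (len μ) closed p

    <row⇒<diagonal : ∀ {i} → i < row μ i → i < diagonal μ
    <row⇒<diagonal p = ⇒<count {id} (len μ) closed (row>0⇒<len μ (≤-trans (s≤s z≤n) p)) p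

    diagonal≤len : diagonal μ ≤ len μ
    diagonal≤len = ≤-trans (length-filter (λ i → suc i ≤? row μ i) (upTo (len μ))) (≤-reflexive (length-upTo (len μ)))

  col-antitone : ∀ μ {j k} → j ≤ k → col μ k ≤ col μ j
  col-antitone μ {j} {k} j≤k with col μ k ≤? col μ j
  ... | yes p = p
  ... | no ¬p = contradiction (<row⇒<col μ j (≤-trans (s≤s j≤k) (<col⇒<row μ k (≰⇒> ¬p)))) (n≮n (col μ j))

  -- When the parameter a_r is given the number r + N - 1, beta N ν i is the
  -- number of a_{νᵢ₊₁ - i}, and gap N ν j that of -y(ν)ⱼ₊₁.

  beta gap : ℕ → Partition → ℕ → ℕ
  beta N μ i = row μ i + (N ∸ suc i)
  gap  N μ j = N + j ∸ col μ j

  beta-antitone : ∀ N μ {i j} → i ≤ j → beta N μ j ≤ beta N μ i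
  beta-antitone N μ i≤j = +-mono-≤ (row-antitone μ i≤j) (∸-monoʳ-≤ N (s≤s i≤j))

  beta-decreasing : ∀ N μ {i j} → i < j → j < N → beta N μ j < beta N μ i
  beta-decreasing N μ i<j j<N = +-mono-≤-< (row-antitone μ (<⇒≤ i<j)) (∸-monoʳ-< (s≤s i<j) j<N)

  module _ {N} μ (len≤N : len μ ≤ N) where

    private
      d = diagonal μ
      d≤N : d ≤ N
      d≤N = ≤-trans (diagonal≤len μ) len≤N
      col≤ : ∀ j → col μ j ≤ N + j
      col≤ j = ≤-trans (col≤len μ j) (≤-trans len≤N (m≤m+n N j))

      gap-increasing : ∀ {j k} → j < k → gap N μ j < gap N μ k
      gap-increasing {j} {k} j<k = ≤-<-trans (∸-monoʳ-≤ (N + j) (col-antitone μ (<⇒≤ j<k)))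
        (∸-monoˡ-< (+-monoʳ-< N j<k) (≤-trans (col-antitone μ (<⇒≤ j<k)) (col≤ j)))

      gap<N : ∀ {j} → j < d → gap N μ j < N
      gap<N {j} j<d = +-cancelʳ-< (col μ j) (gap N μ j) N
        (subst (_< N + col μ j) (sym (m∸n+n≡m (col≤ j))) (+-monoʳ-< N (<row⇒<col μ j (<diagonal⇒<row μ j<d))))

      beta<N : ∀ {i} → d ≤ i → i < N → beta N μ i < N
      beta<N {i} d≤i i<N with i <? row μ i
      ... | yes p = contradiction (<row⇒<diagonal μ p) (≤⇒≯ d≤i)
      ... | no ¬p = ≤-<-trans (+-monoˡ-≤ (N ∸ suc i) (≮⇒≥ ¬p)) (≤-reflexive (m+[n∸m]≡n i<N))

      -- An equality would mean row μ i + col μ j = i + j + 1, but the left side is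
      -- larger or smaller according to whether the box (i, j) is in the diagram.

      beta≢gap : ∀ {i j} → i < N → beta N μ i ≢ gap N μ j
      beta≢gap {i} {j} i<N e = absurd
        where
        q = N ∸ suc i
        sum≡ : row μ i + col μ j ≡ suc i + j
        sum≡ = +-cancelʳ-≡ q _ _ (begin
          (row μ i + col μ j) + q  ≡⟨ solve 3 (λ r c q → (r :+ c) :+ q := (r :+ q) :+ c) refl (row μ i) (col μ j) q ⟩
          beta N μ i + col μ j     ≡⟨ cong (_+ col μ j) e ⟩
          gap N μ j + col μ j      ≡⟨ m∸n+n≡m (col≤ j) ⟩
          N + j                    ≡⟨ cong (_+ j) (m+[n∸m]≡n i<N) ⟨
          (suc i + q) + j          ≡⟨ solve 3 (λ i q j → (i :+ q) :+ j := (i :+ j) :+ q) refl (suc i) q j ⟩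
          (suc i + j) + q          ∎)
          where
          open Data.Nat.Solver.+-*-Solver
          open ≡.≡-Reasoning
        absurd : ⊥
        absurd with j <? row μ i
        ... | yes p = <⇒≢ (subst (_≤ row μ i + col μ j)
          (trans (cong suc (+-suc j i)) (cong suc (cong suc (+-comm j i))))
          (+-mono-≤ p (<row⇒<col μ j p))) (sym sum≡)
        ... | no ¬p = <⇒≢ (s≤s (≤-trans (+-mono-≤ (≮⇒≥ ¬p) (≮⇒≥ (¬p ∘ <col⇒<row μ j)))
          (≤-reflexive (+-comm j i)))) sum≡

    -- The beta-numbers beyond the diagonal and the gaps are N distinct numbers below N, hence all
    -- of them. This is the link between the Frobenius coordinates and the first N beta-numbers.
    beta-gap-↭ : downFrom N ↭ applyUpTo (λ i → beta N μ (d + i)) (N ∸ d) ++ applyUpTo (gap N μ) d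
    beta-gap-↭ = unique-↭
      (Unique.++⁺
        (Unique.applyUpTo⁺₁ (λ i → beta N μ (d + i)) (N ∸ d) (λ i<j j<n → ≢-sym (<⇒≢
          (beta-decreasing N μ (+-monoʳ-< d i<j) (below j<n)))))
        (Unique.applyUpTo⁺₁ (gap N μ) d (λ j<k _ → <⇒≢ (gap-increasing j<k)))
        disjoint)
      member
      (trans (length-++ (applyUpTo (λ i → beta N μ (d + i)) (N ∸ d)))
        (trans (cong₂ _+_ (length-applyUpTo (λ i → beta N μ (d + i)) (N ∸ d)) (length-applyUpTo (gap N μ) d))
          (trans (m∸n+n≡m d≤N) (sym (length-downFrom N)))))
      where
      below : ∀ {i} → i < N ∸ d → d + i < N
      below i<n = <-≤-trans (+-monoʳ-< d i<n) (≤-reflexive (m+[n∸m]≡n d≤N))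
      disjoint : ∀ {x} → ¬ (x ∈ applyUpTo (λ i → beta N μ (d + i)) (N ∸ d) × x ∈ applyUpTo (gap N μ) d)
      disjoint (m , m′)
        with i , i<n , refl ← ∈-applyUpTo⁻ (λ i → beta N μ (d + i)) m
        with j , _ , e ← ∈-applyUpTo⁻ (gap N μ) m′ = beta≢gap {d + i} {j} (below i<n) e
      member : ∀ {x} → x ∈ applyUpTo (λ i → beta N μ (d + i)) (N ∸ d) ++ applyUpTo (gap N μ) d → x ∈ downFrom N
      member m with ∈-++⁻ (applyUpTo (λ i → beta N μ (d + i)) (N ∸ d)) m
      ... | inj₁ m′ with i , i<n , refl ← ∈-applyUpTo⁻ (λ i → beta N μ (d + i)) m′ = ∈-downFrom⁺ (beta<N (m≤m+n d i) (below i<n))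
      ... | inj₂ m′ with j , j<d , refl ← ∈-applyUpTo⁻ (gap N μ) m′ = ∈-downFrom⁺ (gap<N j<d)

    beta-split : applyUpTo (beta N μ) N ≡ applyUpTo (beta N μ) d ++ applyUpTo (λ i → beta N μ (d + i)) (N ∸ d)
    beta-split = trans (cong (applyUpTo (beta N μ)) (sym (m+[n∸m]≡n d≤N))) (applyUpTo-++ (beta N μ) d (N ∸ d))

  -- `rest` lists the numerator factors that survive when the denominator divides the numerator.
  beta-complement : ∀ N μ {j m} → j ≤ N → (∀ {i} → j ≤ i → i < N → beta N μ i < m) →
    ∃[ rest ] downFrom m ↭ applyUpTo (λ i → beta N μ (j + i)) (N ∸ j) ++ rest
  beta-complement N μ {j} {m} j≤N bounded = complement
    (Unique.applyUpTo⁺₁ (λ i → beta N μ (j + i)) (N ∸ j) (λ i<k k<n → ≢-sym (<⇒≢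
      (beta-decreasing N μ (+-monoʳ-< j i<k) (below k<n)))))
    member
    where
    below : ∀ {i} → i < N ∸ j → j + i < N
    below i<n = <-≤-trans (+-monoʳ-< j i<n) (≤-reflexive (m+[n∸m]≡n j≤N))
    member : ∀ {x} → x ∈ applyUpTo (λ i → beta N μ (j + i)) (N ∸ j) → x ∈ downFrom m
    member x∈ with i , i<n , refl ← ∈-applyUpTo⁻ (λ i → beta N μ (j + i)) x∈ = ∈-downFrom⁺ (bounded (m≤m+n j i) (below i<n))

  ⊆⇒∣∣≤ : ∀ {ks ls} → Prefix _≤_ ks ls → sum ks ≤ sum ls
  ⊆⇒∣∣≤ []       = z≤n
  ⊆⇒∣∣≤ (p ∷ ps) = +-mono-≤ p (⊆⇒∣∣≤ ps)

  ⊈⇒< : ∀ {ks ls} → All (0 <_) ks → ¬ Prefix _≤_ ks ls → ∃[ i ] i < length ks × entry ls i < entry ks i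
  ⊈⇒< {[]}              []       ⊈ = contradiction [] ⊈
  ⊈⇒< {k ∷ ks} {[]}     (p ∷ ps) ⊈ = 0 , s≤s z≤n , p
  ⊈⇒< {k ∷ ks} {l ∷ ls} (p ∷ ps) ⊈ with k ≤? l
  ... | no  k≰l = 0 , s≤s z≤n , ≰⇒> k≰l
  ... | yes k≤l with i , i<len , q ← ⊈⇒< ps (⊈ ∘ (k≤l ∷_)) = suc i , s≤s i<len , q

  ++-disjoint : ∀ {a} {A : Set a} {xs ys : List A} → Unique (xs ++ ys) → ∀ {x} → x ∈ xs → ¬ x ∈ ys
  ++-disjoint {xs = x ∷ xs} (x∉ ∷ u) (here refl) x∈ys = All.lookup x∉ (∈-++⁺ʳ xs x∈ys) refl
  ++-disjoint {xs = x ∷ xs} (x∉ ∷ u) (there x∈)  x∈ys = ++-disjoint u x∈ x∈ys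

  ∈-properSubdiagrams : ∀ {μ ν} → μ ⊆ ν → μ ≢ ν → μ ∈ properSubdiagrams ν
  ∈-properSubdiagrams {μ} {ν} μ⊆ν μ≢ν = ∈-filter⁺ (λ κ → κ ⊆? ν ×-dec ¬? (κ ≟ ν))
    (Equivalence.from (∈-partitions≤ ∣ ν ∣ μ) (⊆⇒∣∣≤ μ⊆ν)) (μ⊆ν , μ≢ν)

  properSubdiagrams-∈ : ∀ {μ ν} → μ ∈ properSubdiagrams ν → μ ⊆ ν × μ ≢ ν
  properSubdiagrams-∈ {μ} {ν} m = proj₂ (∈-filter⁻ (λ κ → κ ⊆? ν ×-dec ¬? (κ ≟ ν)) {xs = partitions≤ ∣ ν ∣} m)

  -- The three groups are the coefficient sought, those found earlier in the recursion, and those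
  -- whose functions vanish at the point of ν.
  partitions≤-↭ : ∀ {n} ν → ∣ ν ∣ ≤ n →
    ∃[ rest ] partitions≤ n ↭ (ν ∷ properSubdiagrams ν) ++ rest × (∀ {μ} → μ ∈ rest → ¬ μ ⊆ ν)
  partitions≤-↭ {n} ν ∣ν∣≤n
    with rest , p ← complement {xs = ν ∷ properSubdiagrams ν} {partitions≤ n}
           (All.tabulate (λ m → ≢-sym (proj₂ (properSubdiagrams-∈ {ν = ν} m))) ∷
            Unique.filter⁺ (λ κ → κ ⊆? ν ×-dec ¬? (κ ≟ ν)) (partitions≤-unique ∣ ν ∣))
           (λ { (here refl) → Equivalence.from (∈-partitions≤ n ν) ∣ν∣≤n
              ; (there m)   → Equivalence.from (∈-partitions≤ n _) (≤-trans (⊆⇒∣∣≤ (proj₁ (properSubdiagrams-∈ {ν = ν} m))) ∣ν∣≤n) })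
    = rest , p , λ {μ} μ∈rest μ⊆ν →
        ++-disjoint (Unique-resp-↭ (setoid Partition) (↭⇒↭ₛ p) (partitions≤-unique n)) (listed μ μ⊆ν) μ∈rest
    where
    listed : ∀ μ → μ ⊆ ν → μ ∈ ν ∷ properSubdiagrams ν
    listed μ μ⊆ν with μ ≟ ν
    ... | yes refl = here refl
    ... | no  μ≢ν  = there (∈-properSubdiagrams μ⊆ν μ≢ν)

open Diagrams

-- Reduction of the Jacobi-Trudi matrix by column operations.

applyUpTo-↭ : ∀ {a} {A : Set a} (f : ℕ → A) n → applyUpTo f n ↭ applyDownFrom f n
applyUpTo-↭ f n = ↭-trans (↭-sym (↭-reverse (applyUpTo f n))) (↭-reflexive (reverse-applyUpTo f n))

module JacobiTrudi {r ℓ} (R : CommutativeRing r ℓ) (g : ℕ → CommutativeRing.Carrier R) (N : ℕ) (μ ν : Partition) where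

  open CommutativeRing R hiding (zero)
  open Determinant R
  open GeneratingSeries R
  open Relation.Binary.Reasoning.Setoid setoid

  mulAt : List ℕ → Seq → Seq
  mulAt is = mulAll (List.map g is)

  mulAt-↭ : ∀ {is js} S → is ↭ js → mulAt is S ≋ mulAt js S
  mulAt-↭ S p = mulAll-↭ S (map⁺ g p)

  mulAt-++ : ∀ is js S → mulAt (is ++ js) S ≡ mulAt is (mulAt js S)
  mulAt-++ is js S = ≡.trans (≡.cong (λ us → mulAll us S) (map-++ g is js)) (mulAll-++ (List.map g is) (List.map g js) S)

  mulAt-++-↭ : ∀ {is js ks} S → is ↭ js ++ ks → mulAt is S ≋ mulAt js (mulAt ks S)
  mulAt-++-↭ {is} {js} {ks} S p k = trans (mulAt-↭ S p k) (reflexive (≡.cong (λ T → T k) (mulAt-++ js ks S)))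

  β m : ℕ → ℕ
  β = beta N ν
  m = beta N μ

  -- The number of the parameter a₋ₛ, for s < N.
  top : ℕ → ℕ
  top s = N ∸ suc s

  -- With H(t) = ∏ (1 + g s t) / (1 + g (β s) t) over s < N, the quotient of index i
  -- is H(t) with the numerator replaced by the product over s < m i.

  quotient : ℕ → Seq
  quotient i = divAll (List.map g (applyUpTo β N)) (mulAt (downFrom (m i)) one)

  mulAt-quotient : ∀ i → mulAt (applyUpTo β N) (quotient i) ≋ mulAt (downFrom (m i)) one
  mulAt-quotient i = mulAll-divAll (List.map g (applyUpTo β N)) (mulAt (downFrom (m i)) one)

  quotient-0 : ∀ i → quotient i 0 ≈ 1#
  quotient-0 i = begin
    quotient i 0                               ≈⟨ mulAll-0 (List.map g (applyUpTo β N)) (quotient i) ⟨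
    mulAt (applyUpTo β N) (quotient i) 0       ≈⟨ mulAt-quotient i 0 ⟩
    mulAt (downFrom (m i)) one 0               ≈⟨ mulAll-0 (List.map g (downFrom (m i))) one ⟩
    1#                                         ∎

  stageSeq : ℕ → ℕ → ℕ → Seq
  stageSeq r s i = mulAt (applyDownFrom β r) (mulAt (applyDownFrom top s) (quotient i))

  -- stage r is the matrix after r rounds of column operations: in each column j the
  -- factors with the parameters top (j - 1), …, top (j - r) have been replaced by
  -- those with the parameters β 0, …, β (r - 1).

  stage : ℕ → Matrix
  stage r i j = shift i (stageSeq (r ⊓ j) (j ∸ r) i) (row μ i ℕ.+ j)

  final : Matrix
  final i j = shift i (mulAt (applyDownFrom β j) (quotient i)) (row μ i ℕ.+ j)

  -- Replacing a factor 1 + v t by 1 + u t changes a product by (u - v) t times its other factors.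
  -- In column j + 1 these other factors are exactly those of column j at the same stage, and t
  -- lowers the degree by the difference between the two columns.
  stage-suc : ∀ r → D N (stage (suc r)) ≈ D N (stage r)
  stage-suc r = D-columnOperations N {stage r} {stage (suc r)} c first next
    where
    c : ℕ → Carrier
    -- For j < r, column j + 1 has no `top` factor left to exchange. Otherwise its last one has
    -- index j - r.
    c j = if does (j ℕ.<? r) then 0# else g (β r) - g (top (j ∸ r))
    c-< : ∀ j → j < r → c j ≈ 0#
    c-< j p = reflexive (≡.cong (if_then 0# else (g (β r) - g (top (j ∸ r)))) (dec-true (j ℕ.<? r) p))
    c-≥ : ∀ j → r ≤ j → c j ≈ g (β r) - g (top (j ∸ r))
    c-≥ j p = reflexive (≡.cong (if_then 0# else (g (β r) - g (top (j ∸ r)))) (dec-false (j ℕ.<? r) (ℕ.≤⇒≯ p)))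
    stage-≡ : ∀ i j {p q p′ q′} → p ≡ p′ → q ≡ q′ →
      shift i (stageSeq p q i) (row μ i ℕ.+ j) ≈ shift i (stageSeq p′ q′ i) (row μ i ℕ.+ j)
    stage-≡ i j ≡.refl ≡.refl = refl
    first : ∀ i → stage (suc r) i 0 ≈ stage r i 0
    first i = stage-≡ i 0 (≡.sym (ℕ.⊓-zeroʳ r)) (≡.sym (ℕ.0∸n≡0 r))
    next : ∀ i j → suc j < N → stage (suc r) i (suc j) ≈ stage r i (suc j) + c j * stage r i j
    next i j _ with ℕ.<-≤-connex j r
    ... | inj₁ j<r = begin
      stage (suc r) i (suc j)
        ≈⟨ stage-≡ i (suc j) (≡.trans (≡.cong suc (ℕ.m≥n⇒m⊓n≡n (ℕ.<⇒≤ j<r))) (≡.sym (ℕ.m≥n⇒m⊓n≡n j<r)))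
                             (≡.trans (ℕ.m≤n⇒m∸n≡0 (ℕ.<⇒≤ j<r)) (≡.sym (ℕ.m≤n⇒m∸n≡0 j<r))) ⟩
      stage r i (suc j)
        ≈⟨ +-identityʳ _ ⟨
      stage r i (suc j) + 0#
        ≈⟨ +-congˡ (trans (*-congʳ (c-< j j<r)) (zeroˡ _)) ⟨
      stage r i (suc j) + c j * stage r i j ∎
    ... | inj₂ r≤j = begin
      stage (suc r) i (suc j)
        ≈⟨ stage-≡ i (suc j) {q′ = s} (≡.cong suc r⊓j≡r) ≡.refl ⟩
      shift i (mul (g (β r)) X) (row μ i ℕ.+ suc j)
        ≈⟨ step (g (β r)) X ⟩
      shift i X (suc k) + g (β r) * shift i X k
        ≈⟨ +-congˡ (*-congʳ split) ⟩
      shift i X (suc k) + (g (top s) + (g (β r) - g (top s))) * shift i X k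
        ≈⟨ +-congˡ (distribʳ _ _ _) ⟩
      shift i X (suc k) + (g (top s) * shift i X k + (g (β r) - g (top s)) * shift i X k)
        ≈⟨ +-assoc _ _ _ ⟨
      (shift i X (suc k) + g (top s) * shift i X k) + (g (β r) - g (top s)) * shift i X k
        ≈⟨ +-cong (step (g (top s)) X) (*-congʳ (c-≥ j r≤j)) ⟨
      shift i (mul (g (top s)) X) (row μ i ℕ.+ suc j) + c j * shift i X k
        ≈⟨ +-congʳ (shift-cong i (mul-mulAll (g (top s)) (List.map g (applyDownFrom β r))
             (mulAt (applyDownFrom top s) (quotient i))) (row μ i ℕ.+ suc j)) ⟩
      shift i (stageSeq r (suc s) i) (row μ i ℕ.+ suc j) + c j * shift i X k
        ≈⟨ +-cong (stage-≡ i (suc j) (ℕ.m≤n⇒m⊓n≡m (ℕ.m≤n⇒m≤1+n r≤j)) (ℕ.+-∸-assoc 1 r≤j))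
                  (*-congˡ (stage-≡ i j {q = s} r⊓j≡r ≡.refl)) ⟨
      stage r i (suc j) + c j * stage r i j ∎
      where
      s = j ∸ r
      k = row μ i ℕ.+ j
      X = stageSeq r s i
      r⊓j≡r = ℕ.m≤n⇒m⊓n≡m r≤j
      step : ∀ w S → shift i (mul w S) (row μ i ℕ.+ suc j) ≈ shift i S (suc k) + w * shift i S k
      step w S = trans (reflexive (≡.cong (shift i (mul w S)) (ℕ.+-suc (row μ i) j))) (shift-mul i w S k)
      split : g (β r) ≈ g (top s) + (g (β r) - g (top s))
      split = sym (trans (+-congˡ (+-comm _ _)) (trans (sym (+-assoc _ _ _)) (trans (+-congʳ (-‿inverseʳ _)) (+-identityˡ _))))

  stage-final : D N (stage 0) ≈ D N final
  stage-final = trans (sym (stages N)) (D-cong N λ i j _ j<N → reflexive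
    (≡.cong₂ (λ p q → shift i (stageSeq p q i) (row μ i ℕ.+ j)) (ℕ.m≥n⇒m⊓n≡n (ℕ.<⇒≤ j<N)) (ℕ.m≤n⇒m∸n≡0 (ℕ.<⇒≤ j<N))))
    where
    stages : ∀ r → D N (stage r) ≈ D N (stage 0)
    stages zero    = refl
    stages (suc r) = trans (stage-suc r) (stages r)

  -- The factors `β` below j disappear from the denominator by multiplication, and those from j on
  -- divide the numerator. Both sides are compared after multiplication by the latter.
  tail-cancel : ∀ i {j rest} → j ≤ N → downFrom (m i) ↭ applyUpTo (λ l → β (j ℕ.+ l)) (N ∸ j) ++ rest →
    mulAt (applyDownFrom β j) (quotient i) ≋ mulAt rest one
  tail-cancel i {j} {rest} j≤N p = mulAll-injective (List.map g tail) λ k → begin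
    mulAt tail (mulAt (applyDownFrom β j) (quotient i)) k
      ≈⟨ mulAt-++-↭ {js = tail} (quotient i) all k ⟨
    mulAt (applyUpTo β N) (quotient i) k
      ≈⟨ mulAt-quotient i k ⟩
    mulAt (downFrom (m i)) one k
      ≈⟨ mulAt-++-↭ {js = tail} one p k ⟩
    mulAt tail (mulAt rest one) k ∎
    where
    tail = applyUpTo (λ l → β (j ℕ.+ l)) (N ∸ j)
    all : applyUpTo β N ↭ tail ++ applyDownFrom β j
    all = ↭-trans (↭-reflexive (≡.trans (≡.cong (applyUpTo β) (≡.sym (ℕ.m+[n∸m]≡n j≤N))) (applyUpTo-++ β j (N ∸ j))))
      (↭-trans (++-comm (applyUpTo β j) tail) (++⁺ˡ tail (applyUpTo-↭ β j)))

  length-rest : ∀ i j {rest} → downFrom (m i) ↭ applyUpTo (λ l → β (j ℕ.+ l)) (N ∸ j) ++ rest →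
    length rest ℕ.+ (N ∸ j) ≡ row μ i ℕ.+ (N ∸ suc i)
  length-rest i j {rest} p = ≡.trans (ℕ.+-comm (length rest) _) (≡.sym
    (≡.trans (≡.sym (length-downFrom (m i))) (≡.trans (↭-length p)
      (≡.trans (length-++ (applyUpTo (λ l → β (j ℕ.+ l)) (N ∸ j)))
        (≡.cong (ℕ._+ length rest) (length-applyUpTo (λ l → β (j ℕ.+ l)) (N ∸ j)))))))

  -- The polynomial left by `tail-cancel` has at most μᵢ - i + j - 1 factors in either numbering of
  -- rows and columns, one less than the degree of the coefficient.
  final-zero : ∀ i j → i < N → j < N → (∀ {l} → j ≤ l → l < N → β l < m i) → final i j ≈ 0#
  final-zero i j i<N j<N bounded with ℕ.<-≤-connex (row μ i ℕ.+ j) i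
  ... | inj₁ p = reflexive (shift-> i _ _ p)
  ... | inj₂ i≤ with rest , p ← beta-complement N ν (ℕ.<⇒≤ j<N) bounded = begin
    final i j                                  ≡⟨ shift-≤ i _ _ i≤ ⟩
    mulAt (applyDownFrom β j) (quotient i) t   ≈⟨ tail-cancel i (ℕ.<⇒≤ j<N) p t ⟩
    mulAt rest one t                           ≈⟨ mulAll-degree (List.map g rest) t
      (≡.subst (_< t) (≡.sym (length-map g rest)) (ℕ.≤-reflexive (degree (length-rest i j p)))) ⟩
    0#                                         ∎
    where
    t = row μ i ℕ.+ j ∸ i
    degree : ∀ {l} → l ℕ.+ (N ∸ j) ≡ row μ i ℕ.+ (N ∸ suc i) → suc l ≡ t
    degree {l} e = ℕ.+-cancelʳ-≡ (N ℕ.+ i) (suc l) t (R.begin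
      suc l ℕ.+ (N ℕ.+ i)
        R.≡⟨ ≡.cong (λ n → suc l ℕ.+ (n ℕ.+ i)) (ℕ.m∸n+n≡m (ℕ.<⇒≤ j<N)) ⟨
      suc l ℕ.+ (N ∸ j ℕ.+ j ℕ.+ i)
        R.≡⟨ solve 4 (λ l p j i → con 1 :+ l :+ (p :+ j :+ i) := (l :+ p) :+ (j :+ (con 1 :+ i))) ≡.refl l (N ∸ j) j i ⟩
      (l ℕ.+ (N ∸ j)) ℕ.+ (j ℕ.+ suc i)
        R.≡⟨ ≡.cong (ℕ._+ (j ℕ.+ suc i)) e ⟩
      (row μ i ℕ.+ (N ∸ suc i)) ℕ.+ (j ℕ.+ suc i)
        R.≡⟨ solve 4 (λ r q j i → (r :+ q) :+ (j :+ i) := (r :+ j) :+ (q :+ i)) ≡.refl (row μ i) (N ∸ suc i) j (suc i) ⟩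
      (row μ i ℕ.+ j) ℕ.+ (N ∸ suc i ℕ.+ suc i)
        R.≡⟨ ≡.cong₂ ℕ._+_ (≡.sym (ℕ.m∸n+n≡m i≤)) (ℕ.m∸n+n≡m i<N) ⟩
      (t ℕ.+ i) ℕ.+ N
        R.≡⟨ solve 3 (λ t i n → (t :+ i) :+ n := t :+ (n :+ i)) ≡.refl t i N ⟩
      t ℕ.+ (N ℕ.+ i) R.∎)
      where
      module R = ≡.≡-Reasoning
      open Data.Nat.Solver.+-*-Solver

  -- For rows i ≤ k and columns l ≥ k monotonicity gives `β l` ≤ `β k` < `m k` ≤ `m i`, so the block
  -- from k on is zero.
  D-final-zero : ∀ {k} → k < N → row ν k < row μ k → D N final ≈ 0#
  D-final-zero {k} k<N p = D-zeroBlock N k k<N λ i j i≤k k≤j j<N →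
    final-zero i j (ℕ.≤-<-trans i≤k k<N) j<N λ j≤l l<N →
      ℕ.≤-<-trans (beta-antitone N ν (ℕ.≤-trans k≤j j≤l))
        (ℕ.<-≤-trans (ℕ.+-monoˡ-< (N ∸ suc k) p) (beta-antitone N μ i≤k))

  module _ (H : Seq) (generating : mulAt (applyUpTo β N) H ≋ mulAt (downFrom N) one) where

    -- The three cases for the index of h. Rows are not bounded by `len μ`, since `extend` also uses
    -- those below the diagram; `positive` is restricted to j < N, where the truncated `N ∸ j` is
    -- the true number of the first parameter of the column.
    record IsJacobiTrudi (M : Matrix) : Set ℓ where
      field
        negative : ∀ i j → row μ i ℕ.+ j < i → M i j ≈ 0#
        null     : ∀ i j → row μ i ℕ.+ j ≡ i → M i j ≈ 1#
        positive : ∀ i j k → j < N → row μ i ℕ.+ j ≡ i ℕ.+ suc k → M i j ≈ mulAt (applyUpTo (N ∸ j ℕ.+_) k) H (suc k)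

    -- This is the separation of row and column: on the right only the `top` factors depend on j and
    -- only the quotient depends on i.
    multiparameter : ∀ i j k → i < N → j < N → row μ i ℕ.+ j ≡ i ℕ.+ suc k →
      mulAt (applyUpTo (N ∸ j ℕ.+_) k) H ≋ mulAt (applyDownFrom top j) (quotient i)
    multiparameter i j k i<N j<N e = mulAll-injective (List.map g (applyUpTo β N)) λ n → begin
      mulAt (applyUpTo β N) (mulAt U H) n
        ≈⟨ mulAll-comm (List.map g (applyUpTo β N)) (List.map g U) H n ⟩
      mulAt U (mulAt (applyUpTo β N) H) n
        ≈⟨ mulAll-cong (List.map g U) generating n ⟩
      mulAt U (mulAt (downFrom N) one) n
        ≡⟨ ≡.cong (λ S → S n) (mulAt-++ U (downFrom N) one) ⟨
      mulAt (U ++ downFrom N) one n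
        ≈⟨ mulAt-++-↭ {js = G} one exchange n ⟩
      mulAt G (mulAt (downFrom (m i)) one) n
        ≈⟨ mulAll-cong (List.map g G) (mulAt-quotient i) n ⟨
      mulAt G (mulAt (applyUpTo β N) (quotient i)) n
        ≈⟨ mulAll-comm (List.map g G) (List.map g (applyUpTo β N)) (quotient i) n ⟩
      mulAt (applyUpTo β N) (mulAt G (quotient i)) n ∎
      where
      U = applyUpTo (N ∸ j ℕ.+_) k
      G = applyDownFrom top j
      count : N ∸ j ℕ.+ k ≡ m i
      count = ℕ.+-cancelʳ-≡ (j ℕ.+ suc i) _ _ (R.begin
        (N ∸ j ℕ.+ k) ℕ.+ (j ℕ.+ suc i)
          R.≡⟨ solve 4 (λ p k j i → (p :+ k) :+ (j :+ (con 1 :+ i)) := (p :+ j) :+ (i :+ (con 1 :+ k))) ≡.refl (N ∸ j) k j i ⟩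
        (N ∸ j ℕ.+ j) ℕ.+ (i ℕ.+ suc k)
          R.≡⟨ ≡.cong₂ ℕ._+_ (≡.trans (ℕ.m∸n+n≡m (ℕ.<⇒≤ j<N)) (≡.sym (ℕ.m∸n+n≡m i<N))) (≡.sym e) ⟩
        (N ∸ suc i ℕ.+ suc i) ℕ.+ (row μ i ℕ.+ j)
          R.≡⟨ solve 4 (λ q i r j → (q :+ i) :+ (r :+ j) := (r :+ q) :+ (j :+ i)) ≡.refl (N ∸ suc i) (suc i) (row μ i) j ⟩
        m i ℕ.+ (j ℕ.+ suc i) R.∎)
        where
        module R = ≡.≡-Reasoning
        open Data.Nat.Solver.+-*-Solver
      -- The numbers below N without the top j of them end at N - j, where the k parameters of the
      -- column begin; together they are the numbers below `m i`.
      exchange : U ++ downFrom N ↭ G ++ downFrom (m i)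
      exchange = ↭-trans (++⁺ˡ U (downFrom-top N j (ℕ.<⇒≤ j<N)))
        (↭-trans (shifts U G)
          (++⁺ˡ G (↭-trans (↭-sym (downFrom-+ (N ∸ j) k)) (↭-reflexive (≡.cong downFrom count)))))

    jacobiTrudi : ∀ {M} → IsJacobiTrudi M → D N M ≈ D N final
    jacobiTrudi {M} jt = trans (D-cong N entries) stage-final
      where
      open IsJacobiTrudi jt
      entries : ∀ i j → i < N → j < N → M i j ≈ stage 0 i j
      entries i j i<N j<N with ℕ.<-≤-connex (row μ i ℕ.+ j) i
      ... | inj₁ p = trans (negative i j p) (reflexive (≡.sym (shift-> i _ _ p)))
      ... | inj₂ i≤ with row μ i ℕ.+ j ∸ i in t≡
      ...   | zero  = begin
        M i j                                               ≈⟨ null i j (≡.sym (ℕ.≤-antisym i≤ (ℕ.m∸n≡0⇒m≤n t≡))) ⟩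
        1#                                                  ≈⟨ quotient-0 i ⟨
        quotient i 0                                        ≈⟨ mulAll-0 (List.map g (applyDownFrom top j)) (quotient i) ⟨
        mulAt (applyDownFrom top j) (quotient i) 0          ≡⟨ ≡.cong (mulAt (applyDownFrom top j) (quotient i)) t≡ ⟨
        mulAt (applyDownFrom top j) (quotient i) (row μ i ℕ.+ j ∸ i)  ≡⟨ shift-≤ i _ _ i≤ ⟨
        stage 0 i j                                         ∎
      ...   | suc k = begin
        M i j                                               ≈⟨ positive i j k j<N e ⟩
        mulAt (applyUpTo (N ∸ j ℕ.+_) k) H (suc k)          ≈⟨ multiparameter i j k i<N j<N e (suc k) ⟩
        mulAt (applyDownFrom top j) (quotient i) (suc k)    ≡⟨ ≡.cong (mulAt (applyDownFrom top j) (quotient i)) t≡ ⟨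
        mulAt (applyDownFrom top j) (quotient i) (row μ i ℕ.+ j ∸ i)  ≡⟨ shift-≤ i _ _ i≤ ⟨
        stage 0 i j                                         ∎
        where
        e : row μ i ℕ.+ j ≡ i ℕ.+ suc k
        e = ≡.trans (≡.sym (ℕ.m+[n∸m]≡n i≤)) (≡.cong (i ℕ.+_) t≡)

    -- The rows from len μ on are those of the identity matrix below and on
    -- the diagonal.

    extend : ∀ {M} → IsJacobiTrudi M → ∀ n → D (n ℕ.+ len μ) M ≈ D (len μ) M
    extend {M} jt zero    = refl
    extend {M} jt (suc n) = trans (D-unitRow (n ℕ.+ len μ)
      (λ j j<n → negative _ j (≡.subst (λ r → r ℕ.+ j < n ℕ.+ len μ) (≡.sym row≡0) j<n))
      (null _ _ (≡.cong (ℕ._+ (n ℕ.+ len μ)) row≡0))) (extend jt n)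
      where
      open IsJacobiTrudi jt
      row≡0 : row μ (n ℕ.+ len μ) ≡ 0
      row≡0 = entry-0 (parts μ) (ℕ.m≤n+m (len μ) n)

module _ {r ℓ} (R : CommutativeRing r ℓ) (g : ℕ → CommutativeRing.Carrier R) (N : ℕ) (ν : Partition) where

  open CommutativeRing R hiding (zero)
  open Determinant R
  open GeneratingSeries R
  open JacobiTrudi R g N ν ν

  -- For μ = ν the inequality required by `final-zero` holds in all columns right of the diagonal,
  -- because the beta-numbers decrease strictly.
  D-final-unit : (∀ {p q} → p ≢ q → Unit (g p - g q)) → Unit (D N final)
  D-final-unit distinct = D-unit N
    (λ i j i<j j<N → final-zero i j (ℕ.<-trans i<j j<N) j<N (λ j≤l l<N → beta-decreasing N ν (ℕ.<-≤-trans i<j j≤l) l<N))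
    diagonal-unit
    where
    diagonal-unit : ∀ i → i < N → Unit (final i i)
    -- Cancelling from index i + 1 on leaves `β i` alone in the denominator. There are νᵢ numerator
    -- factors left, all with numbers below `β i`, and the degree read off is νᵢ as well, so
    -- `root-unit` gives a product of differences.
    diagonal-unit i i<N with rest , p ← beta-complement N ν i<N (λ i<l l<N → beta-decreasing N ν i<l l<N)
      = ≡.subst Unit (≡.trans (≡.cong X (≡.trans (length-map g rest)
                       (≡.trans (ℕ.+-cancelʳ-≡ (N ∸ suc i) _ _ (length-rest i (suc i) p))
                                (≡.sym (ℕ.m+n∸n≡m (row ν i) i)))))
                     (≡.sym (shift-≤ i X (row ν i ℕ.+ i) (ℕ.m≤n+m i (row ν i)))))
          (root-unit (g (β i)) (List.map g rest) (tail-cancel i i<N p)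
            (All.map⁺ (All.tabulate λ z∈ → distinct (ℕ.<⇒≢
              (∈-downFrom⁻ (∈-resp-↭ (↭-sym p) (∈-++⁺ʳ (applyUpTo (λ l → β (suc i ℕ.+ l)) (N ∸ suc i)) z∈)))))))
      where
      X = mulAt (applyDownFrom β i) (quotient i)

tabulate-toℕ : ∀ {a} {A : Set a} {n} {F : Fin n → A} (f : ℕ → A) → (∀ i → F i ≡ f (toℕ i)) → List.tabulate F ≡ applyUpTo f n
tabulate-toℕ {n = zero}  f e = ≡.refl
tabulate-toℕ {n = suc n} f e = ≡.cong₂ _∷_ (e Fin.zero) (tabulate-toℕ (f ∘ suc) (e ∘ Fin.suc))

applyUpTo-cong : ∀ {a} {A : Set a} {f g : ℕ → A} n → (∀ i → f i ≡ g i) → applyUpTo f n ≡ applyUpTo g n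
applyUpTo-cong zero    e = ≡.refl
applyUpTo-cong (suc n) e = ≡.cong₂ _∷_ (e 0) (applyUpTo-cong n (e ∘ suc))

-- Sums over partitions, and determinants under a homomorphism.

module _ {r ℓ} (R : CommutativeRing r ℓ) where

  open CommutativeRing R hiding (zero)
  open Relation.Binary.Reasoning.Setoid setoid

  ∑-over-↭ : ∀ {a} {A : Set a} {xs ys : List A} (F : A → Carrier) → xs ↭ ys → ∑-over R xs F ≈ ∑-over R ys F
  ∑-over-↭ F ↭.refl        = refl
  ∑-over-↭ F (prep x p)    = +-congˡ (∑-over-↭ F p)
  ∑-over-↭ F (swap x y p)  = trans (+-congˡ (+-congˡ (∑-over-↭ F p)))
    (Algebra.Properties.CommutativeSemigroup.x∙yz≈y∙xz +-commutativeSemigroup _ _ _)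
  ∑-over-↭ F (↭.trans p q) = trans (∑-over-↭ F p) (∑-over-↭ F q)

  ∑-over-cong : ∀ {a} {A : Set a} (xs : List A) {F G : A → Carrier} → (∀ x → F x ≈ G x) → ∑-over R xs F ≈ ∑-over R xs G
  ∑-over-cong []       F≈G = refl
  ∑-over-cong (x ∷ xs) F≈G = +-cong (F≈G x) (∑-over-cong xs F≈G)

  ∑-over-zero : ∀ {a} {A : Set a} (xs : List A) (F : A → Carrier) → (∀ {x} → x ∈ xs → F x ≈ 0#) → ∑-over R xs F ≈ 0#
  ∑-over-zero []       F F≈0 = refl
  ∑-over-zero (x ∷ xs) F F≈0 = trans (+-cong (F≈0 (here ≡.refl)) (∑-over-zero xs F (F≈0 ∘ there))) (+-identityˡ 0#)

  ∑-over-++ : ∀ {a} {A : Set a} (xs ys : List A) (F : A → Carrier) → ∑-over R (xs ++ ys) F ≈ ∑-over R xs F + ∑-over R ys F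
  ∑-over-++ []       ys F = sym (+-identityˡ _)
  ∑-over-++ (x ∷ xs) ys F = trans (+-congˡ (∑-over-++ xs ys F)) (sym (+-assoc _ _ _))

  ∑-over-partitions≤ : ∀ {n} ν → ∣ ν ∣ ≤ n → (F : Partition → Carrier) → (∀ {μ} → ¬ μ ⊆ ν → F μ ≈ 0#) →
    ∑-over R (partitions≤ n) F ≈ F ν + ∑-over R (properSubdiagrams ν) F
  ∑-over-partitions≤ {n} ν ∣ν∣≤n F F≈0 with rest , p , ⊈ν ← partitions≤-↭ {n} ν ∣ν∣≤n =
    trans (∑-over-↭ F p) (trans (∑-over-++ (ν ∷ properSubdiagrams ν) rest F)
      (trans (+-congˡ (∑-over-zero rest F (F≈0 ∘ ⊈ν))) (+-identityʳ _)))

module EvaluationHomomorphism {r ℓ} (R : CommutativeRing r ℓ)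
  {d} {x y : Vector (CommutativeRing.Carrier R) d} (ev : SymmetricFunctions.Evaluation R x y) where

  open CommutativeRing R hiding (zero)
  open SymmetricFunctions R
  open Evaluation ev
  open Determinant R
  private module Λᴿ = CommutativeRing Λ-commutativeRing
  open Algebra.Properties.Semiring.Exp semiring using (_^_)
  open Algebra.Properties.Semiring.Exp Λᴿ.semiring using () renaming (_^_ to _^Λ_)
  open Algebra.Properties.Semiring.Sum semiring using (sum-cong-≋) renaming (sum to ∑)
  open Algebra.Properties.Semiring.Sum Λᴿ.semiring using () renaming (sum to ∑Λ)

  ⟦∑⟧ : ∀ {n} (F : Fin n → Λ) → ⟦ ∑Λ F ⟧ ≈ ∑ (λ i → ⟦ F i ⟧)
  ⟦∑⟧ {zero}  F = 0#-homo
  ⟦∑⟧ {suc n} F = trans (+-homo _ _) (+-congˡ (⟦∑⟧ (F ∘ Fin.suc)))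

  ⟦∑-over⟧ : ∀ {a} {A : Set a} (xs : List A) (F : A → Λ) → ⟦ ∑-over Λ-commutativeRing xs F ⟧ ≈ ∑-over R xs (λ x → ⟦ F x ⟧)
  ⟦∑-over⟧ []       F = 0#-homo
  ⟦∑-over⟧ (x ∷ xs) F = trans (+-homo _ _) (+-congˡ (⟦∑-over⟧ xs F))

  ⟦sign⟧ : ∀ k → ⟦ (-Λ 1Λ) ^Λ k ⟧ ≈ (- 1#) ^ k
  ⟦sign⟧ zero    = 1#-homo
  ⟦sign⟧ (suc k) = trans (*-homo _ _) (*-cong (trans (-‿homo 1Λ) (-‿cong 1#-homo)) (⟦sign⟧ k))

  ⟦det⟧ : ∀ {n} (A : Fin n → Fin n → Λ) (M : Matrix) → (∀ i j → ⟦ A i j ⟧ ≈ M (toℕ i) (toℕ j)) →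
    ⟦ det Λ-commutativeRing A ⟧ ≈ D n M
  ⟦det⟧ {zero}  A M e = 1#-homo
  ⟦det⟧ {suc n} A M e = trans (⟦∑⟧ cofactors) (sum-cong-≋ {n = suc n} λ j →
    trans (*-homo _ _) (*-cong (⟦sign⟧ (toℕ j)) (trans (*-homo _ _) (*-cong (e Fin.zero j)
      (⟦det⟧ (λ i k → A (Fin.suc i) (punchIn j k)) (minor (toℕ j) M) λ i k → trans (e (Fin.suc i) (punchIn j k))
        (reflexive (≡.cong (M (suc (toℕ i))) (toℕ-punchIn j k))))))))
    where
    cofactors : Fin (suc n) → Λ
    cofactors j = (-Λ 1Λ) ^Λ toℕ j *Λ (A Fin.zero j *Λ det Λ-commutativeRing (λ i k → A (Fin.suc i) (punchIn j k)))

-- Indices of the complete functions and numbering of the parameters.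

index : ∀ r i j → + r ℤ.- + suc i ℤ.+ + suc j ≡ (r ℕ.+ j) ⊖ i
index r i j = ≡.trans (ℤ.distribˡ-⊖-+-pos (suc j) r (suc i))
  (≡.trans (≡.cong (_⊖ suc i) (ℕ.+-suc r j)) (ℤ.[1+m]⊖[1+n]≡m⊖n (r ℕ.+ j) i))

-- The parameters a₁₋ₙ, a₂₋ₙ, … with n = N are numbered from 0.

position : ℕ → ℕ → ℤ
position N r = + r ℤ.+ (1ℤ ℤ.- + N)

position-injective : ∀ N {p q} → position N p ≡ position N q → p ≡ q
position-injective N e = ℤ.+-injective (Algebra.Properties.AbelianGroup.∙-cancelʳ ℤ.+-0-abelianGroup (1ℤ ℤ.- + N) _ _ e)

module _ where

  open Data.Integer.Solver.+-*-Solver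

  position-arm : ∀ {N} ν {i} → i < N → arm ν i ℤ.+ 1ℤ ≡ position N (beta N ν i)
  position-arm {N} ν {i} i<N = ≡.trans (≡.cong (ℤ._+ 1ℤ) (≡.sym (ℤ.m-n≡m⊖n (row ν i) (suc i))))
    (≡.trans (solve 3 (λ r q i → (r :- i) :+ con 1ℤ := (r :+ q) :+ (con 1ℤ :- (i :+ q))) ≡.refl
      (+ row ν i) (+ (N ∸ suc i)) (+ suc i))
    (≡.cong (λ n → + beta N ν i ℤ.+ (1ℤ ℤ.- + n)) (ℕ.m+[n∸m]≡n i<N)))

  position-leg : ∀ {N} ν j → col ν j ≤ N ℕ.+ j → 1ℤ ℤ.- (leg ν j ℤ.+ 1ℤ) ≡ position N (gap N ν j)
  position-leg {N} ν j col≤ = ≡.trans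
    (≡.cong (λ k → 1ℤ ℤ.- (k ℤ.+ 1ℤ)) (≡.sym (ℤ.m-n≡m⊖n (col ν j) (suc j))))
    (≡.trans (solve 3 (λ c j n → con 1ℤ :- ((c :- (con 1ℤ :+ j)) :+ con 1ℤ) := ((n :+ j) :- c) :+ (con 1ℤ :- n)) ≡.refl
      (+ col ν j) (+ j) (+ N))
    (≡.cong (ℤ._+ (1ℤ ℤ.- + N)) (≡.trans (ℤ.m-n≡m⊖n (N ℕ.+ j) (col ν j)) (ℤ.⊖-≥ col≤))))

  position-shift : ∀ {N j} s → j ≤ N → + suc s ℤ.+ (1ℤ ℤ.- + suc j) ≡ position N (N ∸ j ℕ.+ s)
  position-shift {N} {j} s j≤N = ≡.trans
    (solve 3 (λ s j p → (con 1ℤ :+ s) :+ (con 1ℤ :- (con 1ℤ :+ j)) := (p :+ s) :+ (con 1ℤ :- (p :+ j))) ≡.refl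
      (+ s) (+ j) (+ (N ∸ j)))
    (≡.cong (λ n → + (N ∸ j ℕ.+ s) ℤ.+ (1ℤ ℤ.- + n)) (ℕ.m∸n+n≡m j≤N))

-- Evaluation of the multiparameter Schur functions and solution for the coefficients.

module InterpolationProperties {k ℓ₁ ℓ₂} (K : HeytingField k ℓ₁ ℓ₂) where

  open Interpolation K
  open HeytingField K using (#⇒invertible; invertible⇒#)
  open CommutativeRing commutativeRing hiding (zero; Carrier; _≈_; _+_; _*_; -_; _-_; 0#; 1#)
  open Algebra.Properties.Group +-group using () renaming (ε⁻¹≈ε to -0≈0; ⁻¹-involutive to -‿involutive)
  open Algebra.Properties.Ring ring using (-1*x≈-x; -‿distribˡ-*)
  open Algebra.Properties.Semiring.Exp semiring using (_^_)
  open Algebra.Properties.Semiring.Sum semiring using (sum-cong-≋; sum-replicate-zero) renaming (sum to ∑)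
  open Determinant commutativeRing
  open GeneratingSeries commutativeRing
  open SymmetricFunctionsProperties commutativeRing using (antidiagonal-zero; module EvaluationProperties)
  open Relation.Binary.Reasoning.Setoid setoid

  x-0≈x : ∀ v → v - 0# ≈ v
  x-0≈x v = trans (+-congˡ -0≈0) (+-identityʳ v)

  #⇒unit : ∀ {u v} → u # v → Unit (u - v)
  #⇒unit u#v with w , w*≈1 , _ ← #⇒invertible u#v = w , w*≈1

  Unit-resp : ∀ {u v} → u ≈ v → Unit u → Unit v
  Unit-resp u≈v (w , w*u≈1) = w , trans (*-congˡ (sym u≈v)) w*u≈1

  unit⇒#0 : ∀ {v} → Unit v → v # 0#
  unit⇒#0 {v} (w , w*v≈1) = invertible⇒#
    (w , trans (*-congˡ (x-0≈x v)) w*v≈1 , trans (*-comm _ _) (trans (*-congˡ (x-0≈x v)) w*v≈1))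

  coefficientE : List Carrier → ℕ → Carrier
  coefficientE us j = (- 1#) ^ j * e j us

  -- The signed elementary functions are the coefficients of ∏ (1 - u t), and the recursion defining
  -- `e` is multiplication by one such factor.
  mulAll-e : ∀ us S n → mulAll (List.map -_ us) S n ≈ antidiagonal n (λ j i → coefficientE us j * S i)
  mulAll-e [] S zero    = sym (trans (*-congʳ (*-identityˡ _)) (*-identityˡ _))
  mulAll-e [] S (suc n) = sym (trans (+-cong (trans (*-congʳ (*-identityˡ _)) (*-identityˡ _))
    (antidiagonal-zero n (λ i j → trans (*-congʳ (zeroʳ _)) (zeroˡ _)))) (+-identityʳ _))
  mulAll-e (u ∷ us) S zero    = mulAll-e us S zero
  mulAll-e (u ∷ us) S (suc n) = begin
    mulAll (List.map -_ us) S (suc n) + (- u) * mulAll (List.map -_ us) S n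
      ≈⟨ +-cong (mulAll-e us S (suc n)) (*-congˡ (mulAll-e us S n)) ⟩
    (coefficientE us 0 * S (suc n) + antidiagonal n (λ j i → coefficientE us (suc j) * S i))
      + (- u) * antidiagonal n (λ j i → coefficientE us j * S i)
      ≈⟨ trans (+-assoc _ _ _) (+-congˡ (+-congˡ (antidiagonal-* n (- u) (λ j i → coefficientE us j * S i)))) ⟩
    coefficientE us 0 * S (suc n) + (antidiagonal n (λ j i → coefficientE us (suc j) * S i)
      + antidiagonal n (λ j i → (- u) * (coefficientE us j * S i)))
      ≈⟨ +-congˡ (antidiagonal-+ n (λ j i → coefficientE us (suc j) * S i) (λ j i → (- u) * (coefficientE us j * S i))) ⟨
    coefficientE us 0 * S (suc n) + antidiagonal n (λ j i → coefficientE us (suc j) * S i + (- u) * (coefficientE us j * S i))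
      ≈⟨ +-congˡ (antidiagonal-cong n (λ j i _ → trans (+-congˡ (sym (*-assoc _ _ _)))
           (trans (sym (distribʳ _ _ _)) (*-congʳ (recurrence j))))) ⟩
    coefficientE us 0 * S (suc n) + antidiagonal n (λ j i → coefficientE (u ∷ us) (suc j) * S i) ∎
    where
    recurrence : ∀ j → coefficientE us (suc j) + (- u) * coefficientE us j ≈ coefficientE (u ∷ us) (suc j)
    recurrence j = begin
      σ′ * e (suc j) us + (- u) * (σ * e j us)
        ≈⟨ +-congˡ (trans (sym (-‿distribˡ-* _ _))
             (-‿cong (Algebra.Properties.CommutativeSemigroup.x∙yz≈y∙xz *-commutativeSemigroup _ _ _))) ⟩
      σ′ * e (suc j) us + - (σ * (u * e j us))
        ≈⟨ +-congˡ (trans (-‿distribˡ-* _ _) (*-congʳ (sym (-1*x≈-x σ)))) ⟩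
      σ′ * e (suc j) us + σ′ * (u * e j us)
        ≈⟨ trans (+-comm _ _) (sym (distribˡ _ _ _)) ⟩
      σ′ * (u * e j us + e (suc j) us) ∎
      where
      σ = (- 1#) ^ j
      σ′ = (- 1#) ^ suc j

  e-length : ∀ us k → length us < k → e k us ≈ 0#
  e-length []       (suc k) p       = refl
  e-length (u ∷ us) (suc k) (s≤s p) = trans
    (+-cong (trans (*-congˡ (e-length us k p)) (zeroʳ u)) (e-length us (suc k) (ℕ.m≤n⇒m≤1+n p))) (+-identityˡ 0#)

  ∑-antidiagonal : ∀ k F → ∑ {suc k} (λ i → F (toℕ i) (k ∸ toℕ i)) ≈ antidiagonal k F
  ∑-antidiagonal zero    F = +-identityʳ _
  ∑-antidiagonal (suc k) F = +-congˡ (∑-antidiagonal k (F ∘ suc))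

  module _ {d} {x y : Vector Carrier d} (ev : Evaluation x y) where

    open Evaluation ev
    open EvaluationProperties ev
    open EvaluationHomomorphism commutativeRing ev

    ⟦h⟧ : ∀ k a → ⟦ h (+ suc k) a ⟧ ≈ mulAll (List.map -_ (List.map (λ j → a (+ suc j)) (upTo k))) H (suc k)
    ⟦h⟧ k a = begin
      ⟦ h (+ suc k) a ⟧
        ≈⟨ ⟦∑⟧ {suc k} (λ i → coefficientE us (k ∸ toℕ i) · 𝐡 (suc (toℕ i))) ⟩
      ∑ {suc k} (λ i → ⟦ coefficientE us (k ∸ toℕ i) · 𝐡 (suc (toℕ i)) ⟧)
        ≈⟨ sum-cong-≋ {n = suc k} (λ i → ·-homo (coefficientE us (k ∸ toℕ i)) (𝐡 (suc (toℕ i)))) ⟩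
      ∑ {suc k} (λ i → coefficientE us (k ∸ toℕ i) * H (suc (toℕ i)))
        ≈⟨ ∑-antidiagonal k (λ i j → coefficientE us j * H (suc i)) ⟩
      antidiagonal k (λ i j → coefficientE us j * H (suc i))
        ≈⟨ +-identityˡ _ ⟨
      -- The definition of h sums from i = 1. The term i = 0 that completes the convolution contains
      -- the elementary function of degree k + 1 in k parameters, which is 0.
      0# + antidiagonal k (λ i j → coefficientE us j * H (suc i))
        ≈⟨ +-congʳ (trans (*-congʳ (trans (*-congˡ (e-length us (suc k) (ℕ.≤-reflexive (≡.cong suc length-us)))) (zeroʳ _))) (zeroˡ _)) ⟨
      antidiagonal (suc k) (λ i j → coefficientE us j * H i)
        ≈⟨ antidiagonal-flip (suc k) (λ i j → coefficientE us j * H i) ⟩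
      antidiagonal (suc k) (λ j i → coefficientE us j * H i)
        ≈⟨ mulAll-e us H (suc k) ⟨
      mulAll (List.map -_ us) H (suc k) ∎
      where
      us = List.map (λ j → a (+ suc j)) (upTo k)
      length-us : length us ≡ k
      length-us = ≡.trans (length-map (λ j → a (+ suc j)) (upTo k)) (length-upTo k)

    entries : Partition → (ℤ → Carrier) → Matrix
    entries μ a i j = ⟦ h (+ row μ i ℤ.- + suc i ℤ.+ + suc j) (τ (1ℤ ℤ.- + suc j) a) ⟧

    ⟦s⟧ : ∀ μ a → ⟦ s μ a ⟧ ≈ D (len μ) (entries μ a)
    ⟦s⟧ μ a = ⟦det⟧ {len μ} _ (entries μ a) (λ i j → refl)

    entries-≡ : ∀ μ a i j {z} → (row μ i ℕ.+ j) ⊖ i ≡ z → entries μ a i j ≡ ⟦ h z (τ (1ℤ ℤ.- + suc j) a) ⟧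
    entries-≡ μ a i j e′ = ≡.cong (λ z → ⟦ h z (τ (1ℤ ℤ.- + suc j) a) ⟧) (≡.trans (index (row μ i) i j) e′)

    entries-negative : ∀ μ a i j → row μ i ℕ.+ j < i → entries μ a i j ≈ 0#
    entries-negative μ a i j p with q , e′ ← ℕ.m≤n⇒∃[o]m+o≡n p =
      trans (reflexive (entries-≡ μ a i j (≡.trans (ℤ.⊖-< p) (≡.cong (λ n → ℤ.- + n)
        (≡.trans (≡.cong (_∸ (row μ i ℕ.+ j)) (≡.trans (≡.sym e′) (≡.sym (ℕ.+-suc (row μ i ℕ.+ j) q))))
                 (ℕ.m+n∸m≡n (row μ i ℕ.+ j) (suc q))))))) 0#-homo

    entries-null : ∀ μ a i j → row μ i ℕ.+ j ≡ i → entries μ a i j ≈ 1#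
    entries-null μ a i j e′ = trans (reflexive (entries-≡ μ a i j (≡.trans (≡.cong (_⊖ i) e′) (ℤ.n⊖n≡0 i)))) 1#-homo

    entries-positive : ∀ μ a i j k → row μ i ℕ.+ j ≡ i ℕ.+ suc k →
      entries μ a i j ≈ mulAll (List.map -_ (List.map (λ s → τ (1ℤ ℤ.- + suc j) a (+ suc s)) (upTo k))) H (suc k)
    entries-positive μ a i j k e′ = trans
      (reflexive (entries-≡ μ a i j (≡.trans (≡.cong (_⊖ i) e′)
        (≡.trans (ℤ.⊖-≥ (ℕ.m≤m+n i (suc k))) (≡.cong +_ (ℕ.m+n∸m≡n i (suc k)))))))
      (⟦h⟧ k (τ (1ℤ ℤ.- + suc j) a))

    ⟦expansion⟧ : ∀ {n f} {c : Partition → Carrier} a → f ≈Λ ∑-over Λ-commutativeRing (partitions≤ n) (λ μ → c μ · s μ a) →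
      ∀ ν → ∣ ν ∣ ≤ n → (∀ {μ} → ¬ μ ⊆ ν → ⟦ s μ a ⟧ ≈ 0#) →
      ⟦ f ⟧ ≈ c ν * ⟦ s ν a ⟧ + ∑-over commutativeRing (properSubdiagrams ν) (λ μ → c μ * ⟦ s μ a ⟧)
    ⟦expansion⟧ {n} {f} {c} a f≈ ν ∣ν∣≤n s≈0 = begin
      ⟦ f ⟧
        ≈⟨ ⟦⟧-cong f≈ ⟩
      ⟦ ∑-over Λ-commutativeRing (partitions≤ n) (λ μ → c μ · s μ a) ⟧
        ≈⟨ ⟦∑-over⟧ (partitions≤ n) (λ μ → c μ · s μ a) ⟩
      ∑-over commutativeRing (partitions≤ n) (λ μ → ⟦ c μ · s μ a ⟧)
        ≈⟨ ∑-over-cong commutativeRing (partitions≤ n) (λ μ → ·-homo (c μ) (s μ a)) ⟩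
      ∑-over commutativeRing (partitions≤ n) (λ μ → c μ * ⟦ s μ a ⟧)
        ≈⟨ ∑-over-partitions≤ commutativeRing ν ∣ν∣≤n (λ μ → c μ * ⟦ s μ a ⟧) (λ {μ} ⊈ν → trans (*-congˡ (s≈0 {μ} ⊈ν)) (zeroʳ _)) ⟩
      c ν * ⟦ s ν a ⟧ + ∑-over commutativeRing (properSubdiagrams ν) (λ μ → c μ * ⟦ s μ a ⟧) ∎

  module _ (char0 : CharacteristicZero) (a : ℤ → Carrier) where

    ι-unit : ∀ k → Unit (ι (suc k))
    ι-unit k = Unit-resp (x-0≈x _) (#⇒unit (char0 (suc k)))

    module Origin {d} (ev : Evaluation {d} (λ _ → 0#) (λ _ → 0#)) where

      open Evaluation ev
      open EvaluationProperties ev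

      H≋one : H ≋ one
      H≋one = newton-unique ι-unit 1#-homo
        (newton-cong (λ i → trans (+-cong
            (trans (sum-cong-≋ {d} (λ j → zeroˡ _)) (sum-replicate-zero d))
            (trans (sum-cong-≋ {d} (λ j → trans (*-congˡ (zeroˡ _)) (zeroʳ _))) (sum-replicate-zero d)))
          (+-identityˡ 0#)) H-newton)
        newton-one

      -- At the origin `H` is 1, so h of positive index k becomes the coefficient of degree k in a
      -- product of k - 1 linear factors. A nonempty diagram has only such entries in its first row.
      s-vanishes : ∀ {μ} → ¬ μ ⊆ ∅ → ⟦ s μ a ⟧ ≈ 0#
      s-vanishes {μ} ⊈∅ with i , i<len , p ← ⊈⇒< (proj₂ (partition-proof μ)) ⊈∅ =
        trans (⟦s⟧ ev μ a) (D-zeroRow (len μ) 0 (ℕ.≤-<-trans z≤n i<len) {entries ev μ a} λ j _ → first j)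
        where
        first : ∀ j → entries ev μ a 0 j ≈ 0#
        first j with l , e′ ← ℕ.m≤n⇒∃[o]m+o≡n (ℕ.<-≤-trans p (row-antitone μ z≤n)) =
          trans (entries-positive ev μ a 0 j (l ℕ.+ j) (≡.cong (ℕ._+ j) (≡.sym e′)))
            (trans (mulAll-cong us H≋one (suc (l ℕ.+ j)))
              (mulAll-degree us (suc (l ℕ.+ j)) (ℕ.≤-reflexive (≡.cong suc length-us))))
          where
          us = List.map -_ (List.map (λ s → τ (1ℤ ℤ.- + suc j) a (+ suc s)) (upTo (l ℕ.+ j)))
          length-us : length us ≡ l ℕ.+ j
          length-us = ≡.trans (length-map -_ (List.map (λ s → τ (1ℤ ℤ.- + suc j) a (+ suc s)) (upTo (l ℕ.+ j))))
            (≡.trans (length-map (λ s → τ (1ℤ ℤ.- + suc j) a (+ suc s)) (upTo (l ℕ.+ j))) (length-upTo (l ℕ.+ j)))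

      constantCoefficient : ∀ {n f c} → f ≈Λ ∑-over Λ-commutativeRing (partitions≤ n) (λ μ → c μ · s μ a) → c ∅ ≈ ⟦ f ⟧
      constantCoefficient {n} {f} {c} f≈ = sym (begin
        ⟦ f ⟧                          ≈⟨ ⟦expansion⟧ ev {n} {f} {c} a f≈ ∅ z≤n (λ {μ} → s-vanishes {μ}) ⟩
        c ∅ * ⟦ s ∅ a ⟧ + 0#           ≈⟨ +-identityʳ _ ⟩
        c ∅ * ⟦ s ∅ a ⟧                ≈⟨ *-congˡ 1#-homo ⟩
        c ∅ * 1#                       ≈⟨ *-identityʳ _ ⟩
        c ∅                            ∎)

    module At (ν : Partition) {X Y : Vector Carrier (diagonal ν)}
      (X≡x : X ≡ x a ν) (Y≡y : Y ≡ y a ν) (ev : Evaluation X Y) where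

      open Evaluation ev
      open EvaluationProperties ev

      module Rows (N : ℕ) (μ : Partition) (ν≤N : len ν ≤ N) where

        g : ℕ → Carrier
        g r = - a (position N r)

        open JacobiTrudi commutativeRing g N μ ν public

        d = diagonal ν
        tail = applyUpTo (λ i → β (d ℕ.+ i)) (N ∸ d)

        numerator : List.tabulate (-_ ∘ X) ≡ List.map g (applyUpTo β d)
        numerator = ≡.trans
          (tabulate-toℕ (g ∘ β) (λ i → ≡.trans (≡.cong (λ X → - X i) X≡x)
            (≡.cong (-_ ∘ a) (position-arm ν
            (ℕ.<-≤-trans (toℕ<n i) (ℕ.≤-trans (diagonal≤len ν) ν≤N))))))
          (≡.sym (map-applyUpTo β g d))

        denominator : List.tabulate Y ≡ List.map g (applyUpTo (gap N ν) d)
        denominator = ≡.trans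
          (tabulate-toℕ (g ∘ gap N ν) (λ j → ≡.trans (≡.cong (λ Y → Y j) Y≡y)
            (≡.cong (-_ ∘ a) (position-leg ν (toℕ j)
            (ℕ.≤-trans (col≤len ν (toℕ j)) (ℕ.≤-trans ν≤N (ℕ.m≤m+n N (toℕ j))))))))
          (≡.sym (map-applyUpTo (gap N ν) g d))

        -- Both sides of `H-generating` are multiplied by the factors of the beta-numbers beyond the
        -- diagonal. On the left they join those of the x, which are the first d beta-numbers; on
        -- the right they fill up the gaps.
        generating : mulAt (applyUpTo β N) H ≋ mulAt (downFrom N) one
        generating n = begin
          mulAt (applyUpTo β N) H n
            ≈⟨ mulAt-++-↭ {js = tail} H (↭-trans (↭-reflexive (beta-split ν ν≤N)) (++-comm (applyUpTo β d) tail)) n ⟩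
          mulAt tail (mulAt (applyUpTo β d) H) n
            ≡⟨ ≡.cong (λ us → mulAt tail (mulAll us H) n) numerator ⟨
          mulAt tail (mulAll (List.tabulate (-_ ∘ X)) H) n
            ≈⟨ mulAll-cong (List.map g tail) (H-generating ι-unit) n ⟩
          mulAt tail (mulAll (List.tabulate Y) one) n
            ≡⟨ ≡.cong (λ us → mulAt tail (mulAll us one) n) denominator ⟩
          mulAt tail (mulAt (applyUpTo (gap N ν) d) one) n
            ≈⟨ mulAt-++-↭ {js = tail} one (beta-gap-↭ ν ν≤N) n ⟨
          mulAt (downFrom N) one n ∎

        isJacobiTrudi : IsJacobiTrudi H generating (entries ev μ a)
        isJacobiTrudi = record
          { negative = entries-negative ev μ a
          ; null     = entries-null ev μ a
          ; positive = λ i j k j<N e′ → trans (entries-positive ev μ a i j k e′)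
              (reflexive (≡.cong (λ us → mulAll us H (suc k)) (parameters j k j<N)))
          }
          where
          parameters : ∀ j k → j < N → List.map -_ (List.map (λ s → τ (1ℤ ℤ.- + suc j) a (+ suc s)) (upTo k)) ≡
                       List.map g (applyUpTo (N ∸ j ℕ.+_) k)
          parameters j k j<N = ≡.trans (≡.cong (λ us → List.map -_ us) (map-upTo (λ s → τ (1ℤ ℤ.- + suc j) a (+ suc s)) k))
            (≡.trans (map-applyUpTo (λ s → τ (1ℤ ℤ.- + suc j) a (+ suc s)) -_ k)
            (≡.trans (applyUpTo-cong k (λ s → ≡.cong (-_ ∘ a) (position-shift s (ℕ.<⇒≤ j<N))))
                     (≡.sym (map-applyUpTo (N ∸ j ℕ.+_) g k))))

        s-final : len μ ≤ N → ⟦ s μ a ⟧ ≈ D N final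
        s-final μ≤N = begin
          ⟦ s μ a ⟧                                ≈⟨ ⟦s⟧ ev μ a ⟩
          D (len μ) (entries ev μ a)               ≈⟨ extend H generating isJacobiTrudi (N ∸ len μ) ⟨
          D (N ∸ len μ ℕ.+ len μ) (entries ev μ a) ≡⟨ ≡.cong (λ n → D n (entries ev μ a)) (ℕ.m∸n+n≡m μ≤N) ⟩
          D N (entries ev μ a)                     ≈⟨ jacobiTrudi H generating isJacobiTrudi ⟩
          D N final                                ∎

      -- The larger of the two lengths is taken as N, and the zero block starts at a row in which μ
      -- exceeds ν.
      s-vanishes : ∀ {μ} → ¬ μ ⊆ ν → ⟦ s μ a ⟧ ≈ 0#
      s-vanishes {μ} ⊈ν with i , i<len , p ← ⊈⇒< (proj₂ (partition-proof μ)) ⊈ν =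
        trans (s-final (ℕ.m≤n⊔m (len ν) (len μ))) (D-final-zero (ℕ.<-≤-trans i<len (ℕ.m≤n⊔m (len ν) (len μ))) p)
        where open Rows (len ν ℕ.⊔ len μ) μ (ℕ.m≤m⊔n (len ν) (len μ))

      s#0 : (∀ {i j} → i ≢ j → a i # a j) → ⟦ s ν a ⟧ # 0#
      s#0 distinct = unit⇒#0 (Unit-resp (sym (s-final ℕ.≤-refl)) (D-final-unit commutativeRing g (len ν) ν
        -- As `g` negates the parameters, `g p - g q` is the parameter at q minus that at p; hence
        -- the exchange of the two.
        λ {p} {q} p≢q → Unit-resp (trans (+-comm _ _) (+-congˡ (sym (-‿involutive _))))
          (#⇒unit (distinct (p≢q ∘ ≡.sym ∘ position-injective (len ν))))))
        where open Rows (len ν) ν ℕ.≤-refl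

    module _ (distinct : ∀ {i j} → i ≢ j → a i # a j) where

      -- X, Y and S stand for x a ν, y a ν and λ μ → s μ a.  As the equations are
      -- instance arguments, X, Y and S are read off from the goal; unifying two
      -- unfolded evaluations would compare all the proofs in them.

      coefficient : ∀ {n f c} → f ≈Λ ∑-over Λ-commutativeRing (partitions≤ n) (λ μ → c μ · s μ a) →
        ∀ ν → ∣ ν ∣ ≤ n → {X Y : Vector Carrier (diagonal ν)} {S : Partition → Λ}
        ⦃ X≡x : X ≡ x a ν ⦄ ⦃ Y≡y : Y ≡ y a ν ⦄ ⦃ S≡s : ∀ {μ} → S μ ≡ s μ a ⦄ →
        Σ[ s#0 ∈ S ν ⟨ X ⨾ Y ⟩ # 0# ]
          c ν ≈ divide (f ⟨ X ⨾ Y ⟩ - ∑-over commutativeRing (properSubdiagrams ν) (λ μ → c μ * S μ ⟨ X ⨾ Y ⟩))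
                       (S ν ⟨ X ⨾ Y ⟩) s#0
      coefficient {n} {f} {c} f≈ ν ∣ν∣≤n {X} {Y} {S} ⦃ X≡x ⦄ ⦃ Y≡y ⦄ ⦃ S≡s ⦄ = S#0 , sym (begin
        (⟦ f ⟧ - Σ) * w
          ≈⟨ *-congʳ (trans (+-congʳ expansion) (trans (+-assoc _ _ _) (trans (+-congˡ (-‿inverseʳ Σ)) (+-identityʳ _)))) ⟩
        (c ν * ⟦ S ν ⟧) * w
          ≈⟨ trans (*-assoc _ _ _) (*-congˡ (*-comm _ _)) ⟩
        c ν * (w * ⟦ S ν ⟧)
          -- The element `w` is the inverse of `⟦ S ν ⟧ - 0#`.
          ≈⟨ *-congˡ (trans (*-congˡ (sym (x-0≈x _))) (proj₁ (proj₂ inverse))) ⟩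
        c ν * 1#
          ≈⟨ *-identityʳ _ ⟩
        c ν ∎)
        where
        ev = evaluation X Y
        open Evaluation ev
        S#0 : ⟦ S ν ⟧ # 0#
        S#0 = ≡.subst (λ f → ⟦ f ⟧ # 0#) (≡.sym S≡s) (At.s#0 ν X≡x Y≡y ev distinct)
        Σ = ∑-over commutativeRing (properSubdiagrams ν) (λ μ → c μ * ⟦ S μ ⟧)
        inverse = #⇒invertible S#0
        w = proj₁ inverse
        expansion : ⟦ f ⟧ ≈ c ν * ⟦ S ν ⟧ + Σ
        expansion = trans (⟦expansion⟧ ev {n} {f} {c} a f≈ ν ∣ν∣≤n (λ {μ} → At.s-vanishes ν X≡x Y≡y ev {μ}))
          (+-cong (*-congˡ (reflexive (≡.cong ⟦_⟧ (≡.sym S≡s))))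
                  (∑-over-cong commutativeRing (properSubdiagrams ν) (λ μ → *-congˡ (reflexive (≡.cong ⟦_⟧ (≡.sym S≡s))))))

theorem12 : ∀ {k ℓ₁ ℓ₂} (K : HeytingField k ℓ₁ ℓ₂) →
    let open Interpolation K in
    CharacteristicZero →
    (a : ℤ → Carrier) → (∀ {i j} → i ≢ j → a i # a j) →
    (n : ℕ) (f : Λ) → Degree≤ n f →
    (c : Partition → Carrier) →
    f ≈Λ ∑-over Λ-commutativeRing (partitions≤ n) (λ μ → c μ · s μ a) →
    (∀ d → c ∅ ≈ f ⟨ (λ _ → 0#) ⨾ (λ (_ : Fin d) → 0#) ⟩)
    ×
    (∀ ν → ∣ ν ∣ ≤ n → ν ≢ ∅ →
      Σ[ s#0 ∈ s ν a ⟨ x a ν ⨾ y a ν ⟩ # 0# ]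
        c ν ≈ divide
          (f ⟨ x a ν ⨾ y a ν ⟩
            - ∑-over commutativeRing (properSubdiagrams ν) (λ μ → c μ * s μ a ⟨ x a ν ⨾ y a ν ⟩))
          (s ν a ⟨ x a ν ⨾ y a ν ⟩)
          s#0)
theorem12 K char0 a distinct n f _ c f≈ =
  (λ d → Origin.constantCoefficient char0 a (evaluation (λ _ → 0#) (λ (_ : Fin d) → 0#)) {n} {f} {c} f≈) ,
  (λ ν ∣ν∣≤n _ → coefficient char0 a distinct {n} {f} {c} f≈ ν ∣ν∣≤n)
  where
  open Interpolation K
  open InterpolationProperties K
  instance
    ≡-refl : ∀ {a} {A : Set a} {u : A} → u ≡ u
    ≡-refl = ≡.refl
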